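{- Let $\mathrm{simp}_n(s,t)=\sum_{\sigma\in\mathrm{Simp}_n}s^{\mathrm{des}(\sigma)}t^{\mathrm{ides}(\sigma)}$, where $\mathrm{Simp}_n$ is the set of simple permutations of length $n$. Let \[ F(x)=F(x,s,t)=\sum_{n=1}^{\infty}\Bigl(\sum_{\pi\in S_n}s^{\mathrm{des}(\pi)}t^{\mathrm{ides}(\pi)}\Bigr)x^n, \] regarded as a formal power series in $x$ over the field $\mathbb{Q}(s,t)$, and let $F^{\langle -1\rangle}(u)=\sum_{n\ge 1}f_n^{\langle -1\rangle}(s,t)\,u^n$ be its functional (compositional) inverse. Then for all $n\ge 4$, \[ \mathrm{simp}_n(s,t)=-f_n^{\langle -1\rangle}(s,t)+(-1)^{n-1}+(-st)^{n-1}. \]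
   Context: For $\pi \in S_n$ (written in one-line notation), $\mathrm{des}(\pi)=|\{i\in\{1,\dots,n-1\} : \pi(i)>\pi(i+1)\}|$ and $\mathrm{ides}(\pi)=\mathrm{des}(\pi^{ -1})$. A block of a permutation $a_1\ldots a_n$ is a nonempty contiguous sequence of entries $a_i a_{i+1}\ldots a_{i+k}$ whose values also form a contiguous sequence of integers. Singletons and the whole permutation are trivial blocks; all other blocks are proper. A permutation is simple if it has no proper blocks. -}

module Defs where

open import Algebra.Apartness.Bundles using (HeytingField)
open import Algebra.Bundles using (CommutativeRing)
import Algebra.Properties.Group as GroupProperties
import Algebra.Properties.Ring as RingProperties
import Algebra.Properties.Semiring.Exp as Exponentiation
import Algebra.Solver.Ring.NaturalCoefficients.Default as SemiringSolver
open import Data.Fin.Base as Fin using (Fin; zero; suc; toℕ; inject₁; punchIn)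
open import Data.Fin.Permutation as Perm
  using (Permutation′; _⟨$⟩ʳ_; flip; insert; remove; insert-remove; insert-punchIn)
import Data.Fin.Properties as Fin
open import Data.List.Base
  using (List; []; _∷_; map; foldr; filter; length; allFin; cartesianProductWith)
import Data.List.Membership.Setoid as SetoidMembership
import Data.List.Membership.Setoid.Properties as SetoidMembership
open import Data.List.Membership.Propositional.Properties using (∈-allFin)
open import Data.List.Relation.Unary.All using ([])
open import Data.List.Relation.Unary.AllPairs using ([]; _∷_)
open import Data.List.Relation.Unary.Any using (here)
import Data.List.Relation.Unary.Unique.Setoid as SetoidUnique
import Data.List.Relation.Unary.Unique.Setoid.Properties as SetoidUnique
open import Data.List.Relation.Unary.Unique.Propositional.Properties using (allFin⁺)
open import Data.Nat.Base as ℕ using (ℕ; zero; suc; _∸_; z≤n; s≤s)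
import Data.Nat.Properties as ℕ
open import Data.Product.Base using (∃; ∃₂; _×_; _,_)
open import Data.Rational.Base as ℚ using (ℚ)
import Data.Rational.Properties as ℚ
open import Data.Sum.Base as Sum using (_⊎_; inj₁; inj₂)
open import Function.Base using (_∘_)
open import Function.Bundles using (_⇔_; mk⇔; Equivalence)
open import Level using (0ℓ; _⊔_) renaming (suc to lsuc)
open import Relation.Binary.Bundles using (Setoid; DecSetoid)
open import Relation.Binary.Definitions using (Decidable)
import Relation.Binary.Properties.DecSetoid as DecSetoidProperties
open import Relation.Binary.PropositionalEquality as ≡ using (_≡_; refl)
import Relation.Binary.Reasoning.Setoid as SetoidReasoning
open import Relation.Nullary.Decidable
  using (Dec; yes; no; map′; ¬?; _×-dec_; _⊎-dec_; _→-dec_)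
open import Relation.Nullary.Negation using (¬_; contradiction)
import Relation.Unary as Unary

module PowerSeries {c ℓ} (R : CommutativeRing c ℓ) where

  open CommutativeRing R hiding (zero) renaming (refl to ≈-refl)
  open SetoidReasoning setoid

  -- f stands for the series whose coefficient in degree n is f n.
  Series : Set c
  Series = ℕ → Carrier

  infix 4 _≋_

  _≋_ : Series → Series → Set ℓ
  f ≋ g = ∀ n → f n ≈ g n

  -- sumUpTo n h = h 0 + h 1 + ⋯ + h n, with the upper bound included.
  sumUpTo : ℕ → Series → Carrier
  sumUpTo zero    h = h 0
  sumUpTo (suc n) h = h 0 + sumUpTo n (h ∘ suc)

  infixl 7 _⊛_
  infixl 6 _⊞_

  _⊞_ : Series → Series → Series
  (f ⊞ g) n = f n + g n

  _⊛_ : Series → Series → Series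
  (f ⊛ g) n = sumUpTo n (λ k → f k * g (n ∸ k))

  ⊟_ : Series → Series
  (⊟ f) n = - f n

  const : Carrier → Series
  const a zero    = a
  const a (suc _) = 0#

  X : Series
  X 1 = 1#
  X _ = 0#

  private
    variable
      f g h f′ g′ : Series

  open SemiringSolver commutativeSemiring using (solve; _:+_; _:*_; _:=_)

  ⊛-cong : f ≋ f′ → g ≋ g′ → f ⊛ g ≋ f′ ⊛ g′
  ⊛-cong p q zero    = *-cong (p 0) (q 0)
  ⊛-cong p q (suc n) = +-cong (*-cong (p 0) (q (suc n))) (⊛-cong (p ∘ suc) q n)

  ⊛-zeroˡ : ∀ f g → (∀ n → f n ≈ 0#) → ∀ n → (f ⊛ g) n ≈ 0#
  ⊛-zeroˡ f g p zero    = trans (*-congʳ (p 0)) (zeroˡ _)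
  ⊛-zeroˡ f g p (suc n) = trans
    (+-cong (trans (*-congʳ (p 0)) (zeroˡ _)) (⊛-zeroˡ (f ∘ suc) g (p ∘ suc) n))
    (+-identityˡ 0#)

  ⊛-sucʳ : ∀ f g n → (f ⊛ g) (suc n) ≈ (f ⊛ (g ∘ suc)) n + f (suc n) * g 0
  ⊛-sucʳ f g zero    = ≈-refl
  ⊛-sucʳ f g (suc n) = trans (+-congˡ (⊛-sucʳ (f ∘ suc) g n)) (sym (+-assoc _ _ _))

  ⊛-comm : ∀ f g → f ⊛ g ≋ g ⊛ f
  ⊛-comm f g zero    = *-comm _ _
  ⊛-comm f g (suc n) = begin
    f 0 * g (suc n) + ((f ∘ suc) ⊛ g) n ≈⟨ +-cong (*-comm _ _) (⊛-comm (f ∘ suc) g n) ⟩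
    g (suc n) * f 0 + (g ⊛ (f ∘ suc)) n ≈⟨ +-comm _ _ ⟩
    (g ⊛ (f ∘ suc)) n + g (suc n) * f 0 ≈⟨ ⊛-sucʳ g f n ⟨
    (g ⊛ f) (suc n)                     ∎

  ⊛-distribʳ : ∀ h f g → (f ⊞ g) ⊛ h ≋ (f ⊛ h) ⊞ (g ⊛ h)
  ⊛-distribʳ h f g zero    = distribʳ _ _ _
  ⊛-distribʳ h f g (suc n) = begin
    (f 0 + g 0) * h (suc n) + (((f ∘ suc) ⊞ (g ∘ suc)) ⊛ h) n
      ≈⟨ +-congˡ (⊛-distribʳ h (f ∘ suc) (g ∘ suc) n) ⟩
    (f 0 + g 0) * h (suc n) + (((f ∘ suc) ⊛ h) n + ((g ∘ suc) ⊛ h) n)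
      ≈⟨ solve 5 (λ a b x y z →
           (a :+ b) :* x :+ (y :+ z) := (a :* x :+ y) :+ (b :* x :+ z))
           ≈-refl (f 0) (g 0) (h (suc n)) _ _ ⟩
    (f ⊛ h) (suc n) + (g ⊛ h) (suc n) ∎

  ⊛-scale : ∀ a f g n → ((λ k → a * f k) ⊛ g) n ≈ a * (f ⊛ g) n
  ⊛-scale a f g zero    = *-assoc _ _ _
  ⊛-scale a f g (suc n) = begin
    (a * f 0) * g (suc n) + ((λ k → a * f (suc k)) ⊛ g) n
      ≈⟨ +-cong (*-assoc _ _ _) (⊛-scale a (f ∘ suc) g n) ⟩
    a * (f 0 * g (suc n)) + a * ((f ∘ suc) ⊛ g) n
      ≈⟨ distribˡ _ _ _ ⟨
    a * (f ⊛ g) (suc n) ∎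

  ⊛-assoc : ∀ f g h → (f ⊛ g) ⊛ h ≋ f ⊛ (g ⊛ h)
  ⊛-assoc f g h zero    = *-assoc _ _ _
  ⊛-assoc f g h (suc n) = begin
    (f 0 * g 0) * h (suc n) + (((λ k → f 0 * g (suc k)) ⊞ ((f ∘ suc) ⊛ g)) ⊛ h) n
      ≈⟨ +-congˡ (⊛-distribʳ h (λ k → f 0 * g (suc k)) ((f ∘ suc) ⊛ g) n) ⟩
    (f 0 * g 0) * h (suc n)
      + (((λ k → f 0 * g (suc k)) ⊛ h) n + (((f ∘ suc) ⊛ g) ⊛ h) n)
      ≈⟨ +-congˡ (+-cong (⊛-scale (f 0) (g ∘ suc) h n) (⊛-assoc (f ∘ suc) g h n)) ⟩
    (f 0 * g 0) * h (suc n)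
      + (f 0 * ((g ∘ suc) ⊛ h) n + ((f ∘ suc) ⊛ (g ⊛ h)) n)
      ≈⟨ solve 5 (λ a b x y z →
           (a :* b) :* x :+ (a :* y :+ z) := a :* (b :* x :+ y) :+ z)
           ≈-refl (f 0) (g 0) (h (suc n)) _ _ ⟩
    (f ⊛ (g ⊛ h)) (suc n) ∎

  ⊛-identityˡ : ∀ f → const 1# ⊛ f ≋ f
  ⊛-identityˡ f zero    = *-identityˡ _
  ⊛-identityˡ f (suc n) = trans
    (+-cong (*-identityˡ _) (⊛-zeroˡ (λ _ → 0#) f (λ _ → ≈-refl) n)) (+-identityʳ _)

  const0≈0 : ∀ n → const 0# n ≈ 0#
  const0≈0 zero    = ≈-refl
  const0≈0 (suc _) = ≈-refl

  seriesRing : CommutativeRing c ℓ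
  seriesRing = record
    { Carrier = Series
    ; _≈_     = _≋_
    ; _+_     = _⊞_
    ; _*_     = _⊛_
    ; -_      = ⊟_
    ; 0#      = const 0#
    ; 1#      = const 1#
    ; isCommutativeRing = record
      { isRing = record
        { +-isAbelianGroup = record
          { isGroup = record
            { isMonoid = record
              { isSemigroup = record
                { isMagma = record
                  { isEquivalence = record
                    { refl  = λ _ → ≈-refl
                    ; sym   = λ p n → sym (p n)
                    ; trans = λ p q n → trans (p n) (q n)
                    }
                  ; ∙-cong = λ p q n → +-cong (p n) (q n)
                  }
                ; assoc = λ f g h n → +-assoc _ _ _
                }
              ; identity = (λ f n → trans (+-congʳ (const0≈0 n)) (+-identityˡ _))
                         , (λ f n → trans (+-congˡ (const0≈0 n)) (+-identityʳ _))
              }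
            ; inverse = (λ f n → trans (-‿inverseˡ _) (sym (const0≈0 n)))
                      , (λ f n → trans (-‿inverseʳ _) (sym (const0≈0 n)))
            ; ⁻¹-cong = λ p n → -‿cong (p n)
            }
          ; comm = λ f g n → +-comm _ _
          }
        ; *-cong     = ⊛-cong
        ; *-assoc    = ⊛-assoc
        ; *-identity = ⊛-identityˡ
                     , (λ f n → trans (⊛-comm f (const 1#) n) (⊛-identityˡ f n))
        ; distrib    = (λ h f g n → trans (⊛-comm h (f ⊞ g) n)
                         (trans (⊛-distribʳ h f g n)
                           (+-cong (⊛-comm f h n) (⊛-comm g h n))))
                     , ⊛-distribʳ
        }
      ; *-comm = ⊛-comm
      }
    }

  open Exponentiation (CommutativeRing.semiring seriesRing) using (_^_)

  -- The composite f(g(x)) = Σₖ fₖ g(x)ᵏ, for g with constant term 0: then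
  -- gᵏ has no terms of degree below k, so only k ≤ n contribute in degree n.
  compose : Series → Series → Series
  compose f g n = sumUpTo n (λ k → f k * (g ^ k) n)

  record IsCompositionalInverse (f g : Series) : Set ℓ where
    field
      f₀≈0  : f 0 ≈ 0#
      g₀≈0  : g 0 ≈ 0#
      f∘g≋X : compose f g ≋ X
      g∘f≋X : compose g f ≋ X

record DecIntegralDomain c ℓ : Set (lsuc (c ⊔ ℓ)) where
  field
    commutativeRing : CommutativeRing c ℓ

  open CommutativeRing commutativeRing public

  field
    _≟_           : Decidable _≈_
    1≉0           : ¬ 1# ≈ 0#
    x*y≈0⇒x≈0∨y≈0 : ∀ {x y} → x * y ≈ 0# → x ≈ 0# ⊎ y ≈ 0#

ℚ-domain : DecIntegralDomain 0ℓ 0ℓ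
ℚ-domain = record
  { commutativeRing = ℚ.+-*-commutativeRing
  ; _≟_             = ℚ._≟_
  ; 1≉0             = λ ()
  ; x*y≈0⇒x≈0∨y≈0   = zeroDivisor _ _
  }
  where
  zeroDivisor : ∀ p q → p ℚ.* q ≡ ℚ.0ℚ → p ≡ ℚ.0ℚ ⊎ q ≡ ℚ.0ℚ
  zeroDivisor p q pq≡0 with p ℚ.≟ ℚ.0ℚ
  ... | yes p≡0 = inj₁ p≡0
  ... | no  p≢0 = inj₂ (begin
    q                     ≡⟨ ℚ.*-identityˡ q ⟨
    ℚ.1ℚ ℚ.* q            ≡⟨ ≡.cong (ℚ._* q) (ℚ.*-inverseˡ p) ⟨
    (ℚ.1/ p ℚ.* p) ℚ.* q  ≡⟨ ℚ.*-assoc (ℚ.1/ p) p q ⟩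
    ℚ.1/ p ℚ.* (p ℚ.* q)  ≡⟨ ≡.cong (ℚ.1/ p ℚ.*_) pq≡0 ⟩
    ℚ.1/ p ℚ.* ℚ.0ℚ       ≡⟨ ℚ.*-zeroʳ (ℚ.1/ p) ⟩
    ℚ.0ℚ                  ∎)
    where
    open ≡.≡-Reasoning
    instance _ = ℚ.≢-nonZero p≢0

-- A polynomial is a power series with finitely many nonzero coefficients.
module Polynomials {c ℓ} (D : DecIntegralDomain c ℓ) where

  open DecIntegralDomain D hiding (zero) renaming (refl to ≈-refl)
  open PowerSeries commutativeRing
  open RingProperties ring using (-0#≈0#)
  private
    module S = CommutativeRing seriesRing

  VanishesFrom : ℕ → Series → Set ℓ
  VanishesFrom N f = ∀ n → N ℕ.≤ n → f n ≈ 0#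

  record Polynomial : Set (c ⊔ ℓ) where
    constructor poly
    field
      coeff    : Series
      bound    : ℕ
      vanishes : VanishesFrom bound coeff

  open Polynomial

  private
    tailVanishes : ∀ {N f} → VanishesFrom (suc N) f → VanishesFrom N (f ∘ suc)
    tailVanishes v n N≤n = v (suc n) (s≤s N≤n)

    0*0 : ∀ {a b x} → a ≈ 0# ⊎ b ≈ 0# → x ≈ 0# → a * b + x ≈ 0#
    0*0 (inj₁ a≈0) x≈0 = trans (+-cong (trans (*-congʳ a≈0) (zeroˡ _)) x≈0) (+-identityˡ _)
    0*0 (inj₂ b≈0) x≈0 = trans (+-cong (trans (*-congˡ b≈0) (zeroʳ _)) x≈0) (+-identityˡ _)

    ⊛-vanishes : ∀ N M {f g} → VanishesFrom N f → VanishesFrom M g →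
                 VanishesFrom (N ℕ.+ M) (f ⊛ g)
    ⊛-vanishes zero    M {f} {g} v w n _ = ⊛-zeroˡ f g (λ k → v k z≤n) n
    ⊛-vanishes (suc N) M v w (suc n) (s≤s le) =
      0*0 (inj₂ (w (suc n) (ℕ.≤-trans (ℕ.m≤n+m M N) (ℕ.m≤n⇒m≤1+n le))))
          (⊛-vanishes N M (tailVanishes v) w n le)

    const-vanishes : ∀ a → VanishesFrom 1 (const a)
    const-vanishes a (suc n) _ = ≈-refl

    X-vanishes : VanishesFrom 2 X
    X-vanishes (suc (suc n)) _       = ≈-refl
    X-vanishes (suc zero)    (s≤s ())

    eventuallyEqual? : ∀ N f g → (∀ n → N ℕ.≤ n → f n ≈ g n) → Dec (f ≋ g)
    eventuallyEqual? zero    f g p = yes (λ n → p n z≤n)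
    eventuallyEqual? (suc N) f g p =
      map′ (λ { (p₀ , ps) zero → p₀ ; (p₀ , ps) (suc n) → ps n })
           (λ q → q 0 , q ∘ suc)
           ((f 0 ≟ g 0) ×-dec
            eventuallyEqual? N (f ∘ suc) (g ∘ suc) (λ n le → p (suc n) (s≤s le)))

    dropFirst : ∀ {a b x} → a ≈ 0# ⊎ b ≈ 0# → a * b + x ≈ 0# → x ≈ 0#
    dropFirst z p = trans (sym (trans (+-congʳ (ab≈0 z)) (+-identityˡ _))) p
      where
      ab≈0 : ∀ {a b} → a ≈ 0# ⊎ b ≈ 0# → a * b ≈ 0#
      ab≈0 (inj₁ a≈0) = trans (*-congʳ a≈0) (zeroˡ _)
      ab≈0 (inj₂ b≈0) = trans (*-congˡ b≈0) (zeroʳ _)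

    cons : ∀ {f : Series} → f 0 ≈ 0# → (∀ n → f (suc n) ≈ 0#) → ∀ n → f n ≈ 0#
    cons p ps zero    = p
    cons p ps (suc n) = ps n

    zeroDivisor : ∀ N M f g → VanishesFrom N f → VanishesFrom M g →
                  (∀ n → (f ⊛ g) n ≈ 0#) →
                  (∀ n → f n ≈ 0#) ⊎ (∀ n → g n ≈ 0#)
    zeroDivisor zero    M       f g v w p = inj₁ (λ n → v n z≤n)
    zeroDivisor (suc N) zero    f g v w p = inj₂ (λ n → w n z≤n)
    zeroDivisor (suc N) (suc M) f g v w p with x*y≈0⇒x≈0∨y≈0 (p 0)
    ... | inj₁ f₀≈0 = Sum.map₁ (cons f₀≈0)
          (zeroDivisor N (suc M) (f ∘ suc) g (tailVanishes v) w
            (λ n → dropFirst (inj₁ f₀≈0) (p (suc n))))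
    ... | inj₂ g₀≈0 = Sum.map₂ (cons g₀≈0)
          (zeroDivisor (suc N) M f (g ∘ suc) v (tailVanishes w)
            (λ n → dropFirst (inj₂ g₀≈0)
              (trans (+-comm _ _) (trans (sym (⊛-sucʳ f g n)) (p (suc n))))))

    to-const0 : ∀ {f} → (∀ n → f n ≈ 0#) → f ≋ const 0#
    to-const0 p zero    = p 0
    to-const0 p (suc n) = p (suc n)

    from-const0 : ∀ {f} → f ≋ const 0# → ∀ n → f n ≈ 0#
    from-const0 p zero    = p 0
    from-const0 p (suc n) = p (suc n)

  constant : Carrier → Polynomial
  constant a = poly (const a) 1 (const-vanishes a)

  indeterminate : Polynomial
  indeterminate = poly X 2 X-vanishes

  polynomialDomain : DecIntegralDomain (c ⊔ ℓ) ℓ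
  polynomialDomain = record
    { commutativeRing = record
      { Carrier = Polynomial
      ; _≈_     = λ p q → coeff p ≋ coeff q
      ; _+_     = λ (poly f N v) (poly g M w) → poly (f ⊞ g) (N ℕ.+ M) (λ n le →
                    trans (+-cong (v n (ℕ.m+n≤o⇒m≤o N le)) (w n (ℕ.m+n≤o⇒n≤o N le)))
                          (+-identityˡ 0#))
      ; _*_     = λ (poly f N v) (poly g M w) →
                    poly (f ⊛ g) (N ℕ.+ M) (⊛-vanishes N M v w)
      ; -_      = λ (poly f N v) →
                    poly (⊟ f) N (λ n le → trans (-‿cong (v n le)) -0#≈0#)
      ; 0#      = constant 0#
      ; 1#      = constant 1#
      ; isCommutativeRing = record
        { isRing = record
          { +-isAbelianGroup = record
            { isGroup = record
              { isMonoid = record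
                { isSemigroup = record
                  { isMagma = record
                    { isEquivalence = record
                      { refl  = λ _ → ≈-refl
                      ; sym   = λ p n → sym (p n)
                      ; trans = λ p q n → trans (p n) (q n)
                      }
                    ; ∙-cong = S.+-cong
                    }
                  ; assoc = λ _ _ _ → S.+-assoc _ _ _
                  }
                ; identity = (λ _ → S.+-identityˡ _) , (λ _ → S.+-identityʳ _)
                }
              ; inverse = (λ _ → S.-‿inverseˡ _) , (λ _ → S.-‿inverseʳ _)
              ; ⁻¹-cong = S.-‿cong
              }
            ; comm = λ _ _ → S.+-comm _ _
            }
          ; *-cong     = λ {p} {p′} {q} {q′} →
                           S.*-cong {coeff p} {coeff p′} {coeff q} {coeff q′}
          ; *-assoc    = λ p q r → S.*-assoc (coeff p) (coeff q) (coeff r)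
          ; *-identity = S.*-identityˡ ∘ coeff , S.*-identityʳ ∘ coeff
          ; distrib    = (λ p q r → S.distribˡ (coeff p) (coeff q) (coeff r))
                         , (λ p q r → S.distribʳ (coeff p) (coeff q) (coeff r))
          }
        ; *-comm = λ p q → S.*-comm (coeff p) (coeff q)
        }
      }
    ; _≟_ = λ (poly f N v) (poly g M w) → eventuallyEqual? (N ℕ.+ M) f g (λ n le →
              trans (v n (ℕ.m+n≤o⇒m≤o N le)) (sym (w n (ℕ.m+n≤o⇒n≤o N le))))
    ; 1≉0 = λ p → 1≉0 (p 0)
    ; x*y≈0⇒x≈0∨y≈0 = λ {(poly f N v)} {(poly g M w)} p →
        Sum.map to-const0 to-const0 (zeroDivisor N M f g v w (from-const0 p))
    }

module Fractions {c ℓ} (D : DecIntegralDomain c ℓ) where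

  open DecIntegralDomain D hiding (zero) renaming (refl to ≈-refl)
  open RingProperties ring using (-‿distribˡ-*)
  open GroupProperties +-group using (x∙y⁻¹≈ε⇒x≈y; x≈y⇒x∙y⁻¹≈ε)
  open SetoidReasoning setoid
  open SemiringSolver commutativeSemiring using (solve; _:+_; _:*_; _:=_; con)

  infixl 8 _/_[_]

  record Fraction : Set (c ⊔ ℓ) where
    constructor _/_[_]
    field
      num   : Carrier
      den   : Carrier
      den≉0 : ¬ den ≈ 0#

  open Fraction

  infix 4 _≃_

  _≃_ : Fraction → Fraction → Set ℓ
  p ≃ q = num p * den q ≈ num q * den p

  private
    *-nonzero : ∀ {x y} → ¬ x ≈ 0# → ¬ y ≈ 0# → ¬ x * y ≈ 0#
    *-nonzero x≉0 y≉0 xy≈0 with x*y≈0⇒x≈0∨y≈0 xy≈0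
    ... | inj₁ x≈0 = x≉0 x≈0
    ... | inj₂ y≈0 = y≉0 y≈0

    *-cancelʳ : ∀ {x y z} → ¬ z ≈ 0# → x * z ≈ y * z → x ≈ y
    *-cancelʳ {x} {y} {z} z≉0 p with x*y≈0⇒x≈0∨y≈0 {x - y} {z} (begin
        (x - y) * z         ≈⟨ distribʳ _ _ _ ⟩
        x * z + - y * z     ≈⟨ +-cong p (sym (-‿distribˡ-* y z)) ⟩
        y * z + - (y * z)   ≈⟨ -‿inverseʳ _ ⟩
        0#                  ∎)
    ... | inj₁ x-y≈0 = x∙y⁻¹≈ε⇒x≈y _ _ x-y≈0
    ... | inj₂ z≈0   = contradiction z≈0 z≉0

    ≃-trans : ∀ {p q r} → p ≃ q → q ≃ r → p ≃ r
    ≃-trans {a / b [ _ ]} {c / d [ d≉0 ]} {e / f [ _ ]} ad≈cb cf≈ed =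
      *-cancelʳ d≉0 (begin
        (a * f) * d ≈⟨ swapLast a f d ⟩
        (a * d) * f ≈⟨ *-congʳ ad≈cb ⟩
        (c * b) * f ≈⟨ swapLast c b f ⟩
        (c * f) * b ≈⟨ *-congʳ cf≈ed ⟩
        (e * d) * b ≈⟨ swapLast e d b ⟩
        (e * b) * d ∎)
      where
      swapLast : ∀ x y z → (x * y) * z ≈ (x * z) * y
      swapLast = solve 3 (λ x y z → (x :* y) :* z := (x :* z) :* y) ≈-refl

  infixl 7 _⊗_
  infixl 6 _⊕_

  _⊕_ : Fraction → Fraction → Fraction
  (a / b [ b≉0 ]) ⊕ (c / d [ d≉0 ]) = (a * d + c * b) / (b * d) [ *-nonzero b≉0 d≉0 ]

  _⊗_ : Fraction → Fraction → Fraction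
  (a / b [ b≉0 ]) ⊗ (c / d [ d≉0 ]) = (a * c) / (b * d) [ *-nonzero b≉0 d≉0 ]

  ⊖_ : Fraction → Fraction
  ⊖ (a / b [ b≉0 ]) = (- a) / b [ b≉0 ]

  fromDomain : Carrier → Fraction
  fromDomain a = a / 1# [ 1≉0 ]

  private
    ⊕-cong : ∀ {p p′ q q′} → p ≃ p′ → q ≃ q′ → p ⊕ q ≃ p′ ⊕ q′
    ⊕-cong {a / b [ _ ]} {a′ / b′ [ _ ]} {c / d [ _ ]} {c′ / d′ [ _ ]} p q = begin
      (a * d + c * b) * (b′ * d′)
        ≈⟨ solve 6 (λ a b c d b′ d′ → (a :* d :+ c :* b) :* (b′ :* d′)
             := (a :* b′) :* (d :* d′) :+ (c :* d′) :* (b :* b′)) ≈-refl a b c d b′ d′ ⟩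
      (a * b′) * (d * d′) + (c * d′) * (b * b′)
        ≈⟨ +-cong (*-congʳ p) (*-congʳ q) ⟩
      (a′ * b) * (d * d′) + (c′ * d) * (b * b′)
        ≈⟨ solve 6 (λ a′ b c′ d b′ d′ → (a′ :* b) :* (d :* d′) :+ (c′ :* d) :* (b :* b′)
             := (a′ :* d′ :+ c′ :* b′) :* (b :* d)) ≈-refl a′ b c′ d b′ d′ ⟩
      (a′ * d′ + c′ * b′) * (b * d) ∎

    ⊗-cong : ∀ {p p′ q q′} → p ≃ p′ → q ≃ q′ → p ⊗ q ≃ p′ ⊗ q′
    ⊗-cong {a / b [ _ ]} {a′ / b′ [ _ ]} {c / d [ _ ]} {c′ / d′ [ _ ]} p q = begin
      (a * c) * (b′ * d′) ≈⟨ interchange a c b′ d′ ⟩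
      (a * b′) * (c * d′) ≈⟨ *-cong p q ⟩
      (a′ * b) * (c′ * d) ≈⟨ interchange a′ b c′ d ⟩
      (a′ * c′) * (b * d) ∎
      where
      interchange : ∀ w x y z → (w * x) * (y * z) ≈ (w * y) * (x * z)
      interchange = solve 4 (λ w x y z → (w :* x) :* (y :* z) := (w :* y) :* (x :* z)) ≈-refl

    ⊖-cong : ∀ {p p′} → p ≃ p′ → ⊖ p ≃ ⊖ p′
    ⊖-cong p = trans (sym (-‿distribˡ-* _ _)) (trans (-‿cong p) (-‿distribˡ-* _ _))

    ⊕-assoc : ∀ p q r → (p ⊕ q) ⊕ r ≃ p ⊕ (q ⊕ r)
    ⊕-assoc (a / b [ _ ]) (c / d [ _ ]) (e / f [ _ ]) =
      solve 6 (λ a b c d e f →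
        ((a :* d :+ c :* b) :* f :+ e :* (b :* d)) :* (b :* (d :* f)) :=
        (a :* (d :* f) :+ (c :* f :+ e :* d) :* b) :* ((b :* d) :* f)) ≈-refl a b c d e f

    ⊕-comm : ∀ p q → p ⊕ q ≃ q ⊕ p
    ⊕-comm (a / b [ _ ]) (c / d [ _ ]) =
      solve 4 (λ a b c d → (a :* d :+ c :* b) :* (d :* b) :=
                           (c :* b :+ a :* d) :* (b :* d)) ≈-refl a b c d

    ⊕-identityˡ : ∀ p → fromDomain 0# ⊕ p ≃ p
    ⊕-identityˡ (a / b [ _ ]) =
      solve 2 (λ a b → (con 0 :* b :+ a :* con 1) :* b := a :* (con 1 :* b)) ≈-refl a b

    ⊕-inverseˡ : ∀ p → ⊖ p ⊕ p ≃ fromDomain 0#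
    ⊕-inverseˡ (a / b [ _ ]) = begin
      (- a * b + a * b) * 1#   ≈⟨ *-congʳ (+-congʳ (-‿distribˡ-* a b)) ⟨
      (- (a * b) + a * b) * 1# ≈⟨ *-congʳ (-‿inverseˡ _) ⟩
      0# * 1#                  ≈⟨ zeroˡ _ ⟩
      0#                       ≈⟨ zeroˡ _ ⟨
      0# * (b * b)             ∎

    ⊗-assoc : ∀ p q r → (p ⊗ q) ⊗ r ≃ p ⊗ (q ⊗ r)
    ⊗-assoc (a / b [ _ ]) (c / d [ _ ]) (e / f [ _ ]) =
      *-cong (*-assoc _ _ _) (sym (*-assoc _ _ _))

    ⊗-comm : ∀ p q → p ⊗ q ≃ q ⊗ p
    ⊗-comm (a / b [ _ ]) (c / d [ _ ]) = *-cong (*-comm _ _) (*-comm _ _)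

    ⊗-identityˡ : ∀ p → fromDomain 1# ⊗ p ≃ p
    ⊗-identityˡ (a / b [ _ ]) =
      solve 2 (λ a b → (con 1 :* a) :* b := a :* (con 1 :* b)) ≈-refl a b

    ⊗-distribˡ : ∀ p q r → p ⊗ (q ⊕ r) ≃ (p ⊗ q) ⊕ (p ⊗ r)
    ⊗-distribˡ (a / b [ _ ]) (c / d [ _ ]) (e / f [ _ ]) =
      solve 6 (λ a b c d e f →
        (a :* (c :* f :+ e :* d)) :* ((b :* d) :* (b :* f)) :=
        ((a :* c) :* (b :* f) :+ (a :* e) :* (b :* d)) :* (b :* (d :* f)))
        ≈-refl a b c d e f

    ⊗-distribʳ : ∀ p q r → (q ⊕ r) ⊗ p ≃ (q ⊗ p) ⊕ (r ⊗ p)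
    ⊗-distribʳ (a / b [ _ ]) (c / d [ _ ]) (e / f [ _ ]) =
      solve 6 (λ a b c d e f →
        ((c :* f :+ e :* d) :* a) :* ((d :* b) :* (f :* b)) :=
        ((c :* a) :* (f :* b) :+ (e :* a) :* (d :* b)) :* ((d :* f) :* b))
        ≈-refl a b c d e f

  fractionRing : CommutativeRing (c ⊔ ℓ) ℓ
  fractionRing = record
    { Carrier = Fraction
    ; _≈_     = _≃_
    ; _+_     = _⊕_
    ; _*_     = _⊗_
    ; -_      = ⊖_
    ; 0#      = fromDomain 0#
    ; 1#      = fromDomain 1#
    ; isCommutativeRing = record
      { isRing = record
        { +-isAbelianGroup = record
          { isGroup = record
            { isMonoid = record
              { isSemigroup = record
                { isMagma = record
                  { isEquivalence = record
                    { refl  = ≈-refl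
                    ; sym   = sym
                    ; trans = λ {p} {q} {r} → ≃-trans {p} {q} {r}
                    }
                  ; ∙-cong = λ {p} {p′} {q} {q′} → ⊕-cong {p} {p′} {q} {q′}
                  }
                ; assoc = ⊕-assoc
                }
              ; identity = ⊕-identityˡ
                         , (λ p → ≃-trans {p ⊕ fromDomain 0#} {fromDomain 0# ⊕ p} {p}
                                    (⊕-comm p (fromDomain 0#)) (⊕-identityˡ p))
              }
            ; inverse = ⊕-inverseˡ
                      , (λ p → ≃-trans {p ⊕ ⊖ p} {⊖ p ⊕ p} {fromDomain 0#}
                                 (⊕-comm p (⊖ p)) (⊕-inverseˡ p))
            ; ⁻¹-cong = λ {p} {p′} → ⊖-cong {p} {p′}
            }
          ; comm = ⊕-comm
          }
        ; *-cong     = λ {p} {p′} {q} {q′} → ⊗-cong {p} {p′} {q} {q′}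
        ; *-assoc    = ⊗-assoc
        ; *-identity = ⊗-identityˡ
                     , (λ p → ≃-trans {p ⊗ fromDomain 1#} {fromDomain 1# ⊗ p} {p}
                                (⊗-comm p (fromDomain 1#)) (⊗-identityˡ p))
        ; distrib    = ⊗-distribˡ , ⊗-distribʳ
        }
      ; *-comm = ⊗-comm
      }
    }

  private
    module F = CommutativeRing fractionRing
    module FG = GroupProperties F.+-group

    _≃?_ : Decidable _≃_
    p ≃? q = (num p * den q) ≟ (num q * den p)

    decSetoid : DecSetoid (c ⊔ ℓ) ℓ
    decSetoid = record
      { Carrier = Fraction
      ; _≈_ = _≃_
      ; isDecEquivalence = record { isEquivalence = F.isEquivalence ; _≟_ = _≃?_ }
      }

    num≉0 : ∀ {p} → ¬ p ≃ fromDomain 0# → ¬ num p ≈ 0#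
    num≉0 {a / b [ _ ]} p≄0 a≈0 =
      p≄0 (trans (*-congʳ a≈0) (trans (zeroˡ _) (sym (zeroˡ _))))

    inverse : ∀ {p} → ¬ p ≃ fromDomain 0# →
              ∃ λ q → q ⊗ p ≃ fromDomain 1# × p ⊗ q ≃ fromDomain 1#
    inverse {p@(a / b [ b≉0 ])} p≄0 =
      b / a [ num≉0 {p} p≄0 ] ,
      solve 2 (λ a b → (b :* a) :* con 1 := con 1 :* (a :* b)) ≈-refl a b ,
      solve 2 (λ a b → (a :* b) :* con 1 := con 1 :* (b :* a)) ≈-refl a b

    1≄0 : ¬ fromDomain 1# ≃ fromDomain 0#
    1≄0 p = 1≉0 (trans (sym (*-identityˡ 1#)) (trans p (zeroˡ 1#)))

  fractionField : HeytingField (c ⊔ ℓ) ℓ ℓ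
  fractionField = record
    { _#_ = λ p q → ¬ p ≃ q
    ; isHeytingField = record
      { isHeytingCommutativeRing = record
        { isCommutativeRing   = F.isCommutativeRing
        ; isApartnessRelation = DecSetoidProperties.≉-isApartnessRelation decSetoid
        ; #⇒invertible = λ {p} {q} p≄q → inverse {p F.- q} (p≄q ∘ FG.x∙y⁻¹≈ε⇒x≈y p q)
        ; invertible⇒# = λ {p} {q} (r , _ , [p-q]r≃1) p≃q →
            let x = p F.- q in
            1≄0 (F.trans {F.1#} {x ⊗ r} {F.0#} (F.sym {x ⊗ r} {F.1#} [p-q]r≃1)
              (F.trans {x ⊗ r} {F.0# ⊗ r} {F.0#}
                (F.*-congʳ {r} {x} {F.0#} (FG.x≈y⇒x∙y⁻¹≈ε {p} {q} p≃q)) (F.zeroˡ r)))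
        }
      ; tight = DecSetoidProperties.≉-tight decSetoid
      }
    }

-- ℚ(s,t) is the field of fractions of ℚ[s][t].
private
  module ℚ[s]     = Polynomials ℚ-domain
  module ℚ[s][t]  = Polynomials ℚ[s].polynomialDomain
  module ℚ[s,t]   = Fractions ℚ[s][t].polynomialDomain

ℚ⟨s,t⟩ : CommutativeRing 0ℓ 0ℓ
ℚ⟨s,t⟩ = ℚ[s,t].fractionRing

ℚ⟨s,t⟩-field : HeytingField 0ℓ 0ℓ 0ℓ
ℚ⟨s,t⟩-field = ℚ[s,t].fractionField

s t : CommutativeRing.Carrier ℚ⟨s,t⟩
s = ℚ[s,t].fromDomain (ℚ[s][t].constant ℚ[s].indeterminate)
t = ℚ[s,t].fromDomain ℚ[s][t].indeterminate

private
  variable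
    n : ℕ

permSetoid : ℕ → Setoid 0ℓ 0ℓ
permSetoid n = record
  { Carrier = Permutation′ n
  ; _≈_ = Perm._≈_
  ; isEquivalence = record
    { refl  = λ _ → refl
    ; sym   = λ p i → ≡.sym (p i)
    ; trans = λ p q i → ≡.trans (p i) (q i)
    }
  }

-- The elements of Sₙ, each listed exactly once (see permutations-complete and
-- permutations-unique): insert zero j π sends the first position to j and fills
-- the others as π does.
permutations : ∀ n → List (Permutation′ n)
permutations zero    = Perm.id ∷ []
permutations (suc n) =
  cartesianProductWith (insert zero) (allFin (suc n)) (permutations n)

private
  insert-cong : ∀ {j k : Fin (suc n)} {π ρ : Permutation′ n} → j ≡ k → π Perm.≈ ρ →
                insert zero j π Perm.≈ insert zero k ρ
  insert-cong refl p zero    = refl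
  insert-cong {j = j} refl p (suc i) = ≡.cong (punchIn j) (p i)

  insert-injective : ∀ {j k : Fin (suc n)} {π ρ : Permutation′ n} →
                     insert zero j π Perm.≈ insert zero k ρ → j ≡ k × π Perm.≈ ρ
  insert-injective {j = j} p with refl ← p zero =
    refl , λ i → Fin.punchIn-injective j _ _ (p (suc i))

permutations-complete : (π : Permutation′ n) →
                        SetoidMembership._∈_ (permSetoid n) π (permutations n)
permutations-complete {zero}  π = here (λ ())
permutations-complete {suc n} π =
  SetoidMembership.∈-resp-≈ (permSetoid (suc n))
    {x = insert zero (π ⟨$⟩ʳ zero) (remove zero π)} {y = π} (insert-remove zero π)
    (SetoidMembership.∈-cartesianProductWith⁺
      (≡.setoid _) (permSetoid n) (permSetoid (suc n))
      (λ {j} {k} {π} {ρ} → insert-cong {j = j} {k} {π} {ρ})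
      (∈-allFin (π ⟨$⟩ʳ zero))
      (permutations-complete (remove zero π)))

permutations-unique : ∀ n → SetoidUnique.Unique (permSetoid n) (permutations n)
permutations-unique zero    = [] ∷ []
permutations-unique (suc n) =
  SetoidUnique.cartesianProductWith⁺
    (≡.setoid _) (permSetoid n) (permSetoid (suc n)) (insert zero)
    (λ {j} {k} {π} {ρ} → insert-injective {j = j} {k} {π} {ρ})
    (allFin⁺ (suc n)) (permutations-unique n)

des : Permutation′ n → ℕ
des {zero}  π = 0
des {suc m} π =
  length (filter (λ i → π ⟨$⟩ʳ suc i Fin.<? π ⟨$⟩ʳ inject₁ i) (allFin m))

ides : Permutation′ n → ℕ
ides π = des (flip π)

-- A block is given by its first and last positions i ≤ j; its set of values must
-- be exactly the integer interval from lo to hi.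
OccupiesInterval : Permutation′ n → (i j lo hi : Fin n) → Set
OccupiesInterval π i j lo hi =
  ∀ v → (lo Fin.≤ v × v Fin.≤ hi) ⇔ (∃ λ k → i Fin.≤ k × k Fin.≤ j × π ⟨$⟩ʳ k ≡ v)

IsBlock : Permutation′ n → (i j : Fin n) → Set
IsBlock π i j = i Fin.≤ j × ∃₂ λ lo hi → OccupiesInterval π i j lo hi

-- Positions are counted from 0, so the whole permutation runs from 0 to n - 1.
IsTrivial : ∀ {n} (i j : Fin n) → Set
IsTrivial {n} i j = i ≡ j ⊎ (toℕ i ≡ 0 × suc (toℕ j) ≡ n)

IsProperBlock : Permutation′ n → (i j : Fin n) → Set
IsProperBlock π i j = IsBlock π i j × ¬ IsTrivial i j

IsSimple : Permutation′ n → Set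
IsSimple π = ¬ (∃₂ λ i j → IsProperBlock π i j)

isSimple? : Unary.Decidable (IsSimple {n})
isSimple? {n} π =
  ¬? (Fin.any? λ i → Fin.any? λ j → block? i j ×-dec ¬? (trivial? i j))
  where
  _⇔?_ : ∀ {A B : Set} → Dec A → Dec B → Dec (A ⇔ B)
  a? ⇔? b? = map′ (λ (f , g) → mk⇔ f g) (λ e → Equivalence.to e , Equivalence.from e)
                  ((a? →-dec b?) ×-dec (b? →-dec a?))

  trivial? : ∀ i j → Dec (IsTrivial i j)
  trivial? i j = (i Fin.≟ j) ⊎-dec ((toℕ i ℕ.≟ 0) ×-dec (suc (toℕ j) ℕ.≟ n))

  block? : ∀ i j → Dec (IsBlock π i j)
  block? i j = (i Fin.≤? j) ×-dec Fin.any? λ lo → Fin.any? λ hi → Fin.all? λ v →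
    ((lo Fin.≤? v) ×-dec (v Fin.≤? hi)) ⇔?
    (Fin.any? λ k → (i Fin.≤? k) ×-dec (k Fin.≤? j) ×-dec (π ⟨$⟩ʳ k Fin.≟ v))

simplePermutations : ∀ n → List (Permutation′ n)
simplePermutations n = filter isSimple? (permutations n)

private
  module K = CommutativeRing ℚ⟨s,t⟩

open PowerSeries ℚ⟨s,t⟩ public using (Series; IsCompositionalInverse)
open Exponentiation K.semiring public using (_^_)

desIdesSum : List (Permutation′ n) → K.Carrier
desIdesSum πs = foldr K._+_ K.0# (map (λ π → s ^ des π K.* t ^ ides π) πs)

simp : ℕ → K.Carrier
simp n = desIdesSum (simplePermutations n)

F : Series
F zero      = K.0#
F n@(suc _) = desIdesSum (permutations n)

open K public using (_≈_; _+_; _*_; -_; 1#)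

-- Summing over the partitions P of π into consecutive blocks the weight of the quotient π/P under a
-- function μ amounts to composing with F: inflation adds both descents and inverse descents, so
--   Σ_k (Σ_{τ ∈ S_k} μ(τ) s^des(τ) t^ides(τ)) F(x)^k = Σ_π s^des(π) t^ides(π) (Σ_P μ(π/P)) x^|π|.
-- Let μ be 1 on the permutation of length 1, (-1)^(k-1) on the two monotone permutations of length k,
-- -1 on the simple permutations of length at least 4, and 0 elsewhere.  Then Σ_P μ(π/P) = 0 for |π| ≥ 2,
-- so the series with coefficients Σ_{τ ∈ S_k} μ(τ) s^des(τ) t^ides(τ) is the left inverse of F, and its
-- n-th coefficient for n ≥ 4 is (-1)^(n-1) (1 + (st)^(n-1)) - simp_n.
-- The vanishing is a statement about the system of blocks of π.  If some c splits π into two blocks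
-- [0, c⟩ and [c, n⟩, the partitions that count are those cut only at such c, with sign (-1)^(number of
-- cuts); otherwise they are the trivial one and the one into maximal proper blocks.

module Submission where

open import Algebra.Bundles using (CommutativeRing)
import Algebra.Properties.CommutativeSemigroup as CommutativeSemigroupProperties
import Algebra.Properties.CommutativeSemiring.Exp as CommutativeExponentiation
import Algebra.Properties.Group as GroupProperties
import Algebra.Properties.Ring as RingProperties
import Algebra.Properties.Semiring.Exp as Exponentiation
open import Data.Bool.Base using (Bool; true; false; not; if_then_else_)
import Data.Bool.Properties as Bool
open import Data.Empty using (⊥; ⊥-elim)
open import Data.Fin.Base as Fin using (Fin; zero; suc; toℕ; fromℕ<; inject₁; punchOut)
open import Data.Fin.Permutation as Perm
  using (Permutation′; permutation; _⟨$⟩ʳ_; _⟨$⟩ˡ_; flip)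
import Data.Fin.Properties as Fin
open import Data.List.Base
  using (List; []; _∷_; _++_; map; foldr; filter; length; cartesianProductWith)
import Data.List.Base as List
import Data.List.Membership.Setoid as SetoidMembership
import Data.List.Membership.Setoid.Properties as Membership
open import Data.List.Relation.Unary.All using (All; []; _∷_)
open import Data.List.Relation.Unary.AllPairs using ([]; _∷_)
open import Data.List.Relation.Unary.Any using (here; there; _─_)
import Data.List.Relation.Unary.Unique.Setoid as SetoidUnique
import Data.List.Relation.Unary.Unique.Setoid.Properties as Unique
open import Data.Nat.Base as ℕ using (ℕ; zero; suc; _≤_; _<_; _∸_; z≤n; s≤s; s≤s⁻¹)
import Data.Nat.Properties as ℕ
open import Data.Product.Base using (∃; _×_; _,_; proj₁; proj₂)
open import Data.Sum.Base using (_⊎_; inj₁; inj₂)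
open import Data.Vec.Base using (Vec; []; _∷_; lookup; tabulate; replicate)
import Data.Vec.Properties as Vec
open import Function.Base using (_∘_; id; case_of_)
open import Function.Bundles using (_⇔_; mk⇔; Equivalence)
open import Function.Definitions using (Injective)
open import Level using (Level)
open import Relation.Binary.Bundles using (Setoid)
open import Relation.Binary.Definitions using (tri<; tri≈; tri>)
open import Relation.Binary.PropositionalEquality as ≡ using (_≡_; _≢_; refl)
import Relation.Binary.Reasoning.Setoid as SetoidReasoning
open import Relation.Nullary.Decidable
  using (Dec; yes; no; does; does-⇔; dec-true; dec-false; ¬?; _×-dec_; _⊎-dec_; _→-dec_)
open import Relation.Nullary.Negation using (¬_; contradiction)
open import Relation.Unary using (Decidable)
open import Defs
  using (module PowerSeries; des; ides; permutations; permutations-complete;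
         permutations-unique; permSetoid; IsBlock; IsSimple; isSimple?)

-- The k-th power of F suggests inflating all k points of τ at once, by a family of permutations of
-- varying lengths. Instead, only one point is ever inflated: a partition is read from left to
-- right, and a part is collapsed to a point as soon as it is complete. Each step is then the
-- bijection between the permutations with a block at given positions and pairs of permutations, and
-- it matches the recursion that splits one factor F off F^k. A permutation is handled through its
-- comparisons of the values at two positions: these determine it, descents and blocks are read off
-- from them, and inflation acts on them fibre by fibre. The vanishing is proved for any family of
-- intervals with the closure properties of blocks. With splits, the sum is the product over all
-- splits c of 1 - 1, by the choice of cutting at c or not. Without splits it is 1 - 1 from two
-- partitions, which are distinct once the length is at least 2; the second has at least three
-- parts, since two parts would make a split. The left inverse is unique because F starts with x, so
-- coefficients can be compared from the lowest degree upwards.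

module Combinatorics where

  open import Data.Nat.Base
  open import Data.Nat.Properties
  open ≡

  private
    variable
      n N : ℕ

  -- Collapsing a block of consecutive positions

  -- `κ i m` sends the positions i, ..., i + m to i and lowers the later ones by m. `ε i m` takes
  -- the first position of each fibre; it also serves as the map on boundaries between positions,
  -- with i + 1 going to i + m + 1.
  κ : (i m : ℕ) → ℕ → ℕ
  κ zero    m p       = p ∸ m
  κ (suc i) m zero    = zero
  κ (suc i) m (suc p) = suc (κ i m p)

  ε : (i m : ℕ) → ℕ → ℕ
  ε zero    m zero    = zero
  ε zero    m (suc x) = suc (m + x)
  ε (suc i) m zero    = zero
  ε (suc i) m (suc x) = suc (ε i m x)

  κ-zero : ∀ i m → κ i m 0 ≡ 0
  κ-zero zero    m = 0∸n≡0 m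
  κ-zero (suc i) m = refl

  κ∘ε : ∀ i m x → κ i m (ε i m x) ≡ x
  κ∘ε zero    m zero    = 0∸n≡0 m
  κ∘ε zero    m (suc x) = trans (cong (_∸ m) (sym (+-suc m x))) (m+n∸m≡n m (suc x))
  κ∘ε (suc i) m zero    = refl
  κ∘ε (suc i) m (suc x) = cong suc (κ∘ε i m x)

  κ-mono : ∀ i m {p q} → p ≤ q → κ i m p ≤ κ i m q
  κ-mono zero    m p≤q       = ∸-monoˡ-≤ m p≤q
  κ-mono (suc i) m z≤n       = z≤n
  κ-mono (suc i) m (s≤s p≤q) = s≤s (κ-mono i m p≤q)

  κ-reflects-< : ∀ i m {p q} → κ i m p < κ i m q → p < q
  κ-reflects-< i m κp<κq = ≰⇒> λ q≤p → <⇒≱ κp<κq (κ-mono i m q≤p)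

  ε-mono-< : ∀ i m {x y} → x < y → ε i m x < ε i m y
  ε-mono-< i m {x} {y} x<y =
    κ-reflects-< i m (subst₂ _<_ (sym (κ∘ε i m x)) (sym (κ∘ε i m y)) x<y)

  ε-injective : ∀ i m {x y} → ε i m x ≡ ε i m y → x ≡ y
  ε-injective i m {x} {y} e = trans (sym (κ∘ε i m x)) (trans (cong (κ i m) e) (κ∘ε i m y))

  ε-fix : ∀ i m {x} → x ≤ i → ε i m x ≡ x
  ε-fix zero    m z≤n       = refl
  ε-fix (suc i) m z≤n       = refl
  ε-fix (suc i) m (s≤s x≤i) = cong suc (ε-fix i m x≤i)

  ε-shift : ∀ i m x → ε i m (i + suc x) ≡ i + (suc m + x)
  ε-shift zero    m x = refl
  ε-shift (suc i) m x = cong suc (ε-shift i m x)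

  ε-next : ∀ i m → ε i m (suc i) ≡ i + suc m
  ε-next i m = trans (cong (ε i m) (sym (trans (+-suc i 0) (cong suc (+-identityʳ i)))))
    (trans (ε-shift i m 0) (cong (λ z → i + suc z) (+-identityʳ m)))

  κ-block : ∀ i {m y} → y ≤ m → κ i m (i + y) ≡ i
  κ-block zero    y≤m = m≤n⇒m∸n≡0 y≤m
  κ-block (suc i) y≤m = cong suc (κ-block i y≤m)

  -- Every fibre of `κ i m` other than the one over i is a single position, so away from the block
  -- `ε i m` and `κ i m` are mutually inverse.
  data Position (i m : ℕ) : ℕ → Set where
    inside  : ∀ {y} → y ≤ m → Position i m (i + y)
    outside : ∀ {x} → x ≢ i → Position i m (ε i m x)

  position : ∀ i m p → Position i m p
  position zero    m p with p ≤? m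
  ... | yes p≤m = inside p≤m
  ... | no  p≰m with m≤n⇒∃[o]m+o≡n (≰⇒> p≰m)
  ...   | x , refl = outside {x = suc x} λ ()
  position (suc i) m zero = outside {x = zero} λ ()
  position (suc i) m (suc p) with position i m p
  ... | inside  y≤m = inside y≤m
  ... | outside {x} x≢i = outside {x = suc x} (x≢i ∘ suc-injective)

  ε∘κ : ∀ i m {p} → κ i m p ≢ i → ε i m (κ i m p) ≡ p
  ε∘κ i m {p} κp≢i with position i m p
  ... | inside  y≤m = contradiction (κ-block i y≤m) κp≢i
  ... | outside {x} _ = cong (ε i m) (κ∘ε i m x)

  κ≡i⇒inside : ∀ i m {p} → κ i m p ≡ i → ∃ λ y → y ≤ m × p ≡ i + y
  κ≡i⇒inside i m {p} κp≡i with position i m p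
  ... | inside  y≤m     = _ , y≤m , refl
  ... | outside {x} x≢i = contradiction (trans (sym (κ∘ε i m x)) κp≡i) x≢i

  ε∘κ-≤ : ∀ i m p → ε i m (κ i m p) ≤ p
  ε∘κ-≤ i m p with position i m p
  ... | inside {y} y≤m = subst (_≤ i + y)
          (sym (trans (cong (ε i m) (κ-block i y≤m)) (ε-fix i m ≤-refl))) (m≤m+n i y)
  ... | outside {x} _  = ≤-reflexive (cong (ε i m) (κ∘ε i m x))

  -- `ε i m` is lower adjoint to `κ i m`. The four forms of the adjunction turn membership of p in
  -- [ε x, ε y⟩ into membership of its image `κ i m p` in [x, y⟩.
  ε≤⇒≤κ : ∀ i m {x p} → ε i m x ≤ p → x ≤ κ i m p
  ε≤⇒≤κ i m {x} {p} le = subst (_≤ κ i m p) (κ∘ε i m x) (κ-mono i m le)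

  ≤κ⇒ε≤ : ∀ i m {x p} → x ≤ κ i m p → ε i m x ≤ p
  ≤κ⇒ε≤ i m {x} {p} le with m≤n⇒m<n∨m≡n le
  ... | inj₁ x<κp = ≤-trans (<⇒≤ (ε-mono-< i m x<κp)) (ε∘κ-≤ i m p)
  ... | inj₂ refl = ε∘κ-≤ i m p

  <ε⇒κ< : ∀ i m {x p} → p < ε i m x → κ i m p < x
  <ε⇒κ< i m lt = ≰⇒> λ le → <⇒≱ lt (≤κ⇒ε≤ i m le)

  κ<⇒<ε : ∀ i m {x p} → κ i m p < x → p < ε i m x
  κ<⇒<ε i m lt = ≰⇒> λ le → <⇒≱ lt (ε≤⇒≤κ i m le)

  -- Permutations as functions on ℕ, and their descents

  does-true⁻ : ∀ {a} {A : Set a} (a? : Dec A) → does a? ≡ true → A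
  does-true⁻ (yes a) _ = a

  data Located (n : ℕ) : ℕ → Set where
    below : (i : Fin n) → Located n (toℕ i)
    above : ∀ {p} → n ≤ p → Located n p

  locate : ∀ n p → Located n p
  locate n p with p <? n
  ... | yes p<n = subst (Located n) (Fin.toℕ-fromℕ< p<n) (below (fromℕ< p<n))
  ... | no  p≮n = above (≮⇒≥ p≮n)

  opaque
    -- The extension of π to ℕ by the identity.
    ⟦_⟧ : Permutation′ n → ℕ → ℕ
    ⟦_⟧ {n} π p with p <? n
    ... | yes p<n = toℕ (π ⟨$⟩ʳ fromℕ< p<n)
    ... | no  _   = p

    ⟦⟧-toℕ : (π : Permutation′ n) (i : Fin n) → ⟦ π ⟧ (toℕ i) ≡ toℕ (π ⟨$⟩ʳ i)
    ⟦⟧-toℕ {n} π i with toℕ i <? n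
    ... | yes i<n = cong (toℕ ∘ (π ⟨$⟩ʳ_)) (Fin.fromℕ<-toℕ i i<n)
    ... | no  i≮n = contradiction (Fin.toℕ<n i) i≮n

    ⟦⟧-fix : (π : Permutation′ n) → ∀ {p} → n ≤ p → ⟦ π ⟧ p ≡ p
    ⟦⟧-fix {n} π {p} n≤p with p <? n
    ... | yes p<n = contradiction n≤p (<⇒≱ p<n)
    ... | no  _   = refl

    ⟦⟧-< : (π : Permutation′ n) → ∀ {p} → p < n → ⟦ π ⟧ p < n
    ⟦⟧-< {n} π {p} p<n with p <? n
    ... | yes p<n′ = Fin.toℕ<n _
    ... | no  p≮n  = contradiction p<n p≮n

    ⟦⟧-cong : {π ρ : Permutation′ n} → π Perm.≈ ρ → ∀ p → ⟦ π ⟧ p ≡ ⟦ ρ ⟧ p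
    ⟦⟧-cong {n} π≈ρ p with p <? n
    ... | yes p<n = cong toℕ (π≈ρ (fromℕ< p<n))
    ... | no  _   = refl

  ⟦⟧-flipˡ : (π : Permutation′ n) → ∀ p → ⟦ flip π ⟧ (⟦ π ⟧ p) ≡ p
  ⟦⟧-flipˡ {n} π p with locate n p
  ... | below i = begin
    ⟦ flip π ⟧ (⟦ π ⟧ (toℕ i))   ≡⟨ cong ⟦ flip π ⟧ (⟦⟧-toℕ π i) ⟩
    ⟦ flip π ⟧ (toℕ (π ⟨$⟩ʳ i))  ≡⟨ ⟦⟧-toℕ (flip π) (π ⟨$⟩ʳ i) ⟩
    toℕ (π ⟨$⟩ˡ (π ⟨$⟩ʳ i))      ≡⟨ cong toℕ (Perm.inverseˡ π) ⟩
    toℕ i                        ∎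
    where open ≡-Reasoning
  ... | above n≤p = trans (cong ⟦ flip π ⟧ (⟦⟧-fix π n≤p)) (⟦⟧-fix (flip π) n≤p)

  ⟦⟧-flipʳ : (π : Permutation′ n) → ∀ p → ⟦ π ⟧ (⟦ flip π ⟧ p) ≡ p
  ⟦⟧-flipʳ π = ⟦⟧-flipˡ (flip π)

  ⟦⟧-injective : (π : Permutation′ n) → ∀ {p q} → ⟦ π ⟧ p ≡ ⟦ π ⟧ q → p ≡ q
  ⟦⟧-injective π {p} {q} e =
    trans (sym (⟦⟧-flipˡ π p)) (trans (cong ⟦ flip π ⟧ e) (⟦⟧-flipˡ π q))

  ≈-from-⟦⟧ : (π ρ : Permutation′ n) → (∀ {p} → p < n → ⟦ π ⟧ p ≡ ⟦ ρ ⟧ p) → π Perm.≈ ρ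
  ≈-from-⟦⟧ π ρ e i = Fin.toℕ-injective
    (trans (sym (⟦⟧-toℕ π i)) (trans (e (Fin.toℕ<n i)) (⟦⟧-toℕ ρ i)))

  module Restrict {n : ℕ} (f g : ℕ → ℕ) (g∘f : ∀ p → g (f p) ≡ p) (f∘g : ∀ p → f (g p) ≡ p)
                  (fix : ∀ {p} → n ≤ p → f p ≡ p) where

    g-fix : ∀ {p} → n ≤ p → g p ≡ p
    g-fix {p} n≤p = trans (cong g (sym (fix n≤p))) (g∘f p)

    private
      bounded : ∀ {f g : ℕ → ℕ} → (∀ p → g (f p) ≡ p) → (∀ {p} → n ≤ p → f p ≡ p) →
                ∀ i → f (toℕ i) < n
      bounded {f} {g} g∘f fix i = ≰⇒> λ n≤fi →
        <⇒≱ (Fin.toℕ<n i)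
          (subst (n ≤_) (trans (sym (g∘f _)) (trans (cong g (fix n≤fi)) (g∘f _))) n≤fi)

      cancel : ∀ {f g : ℕ → ℕ} → (∀ p → g (f p) ≡ p) → ∀ {i : Fin n} .(lt : f (toℕ i) < n)
               .(lt′ : g (toℕ (fromℕ< lt)) < n) → fromℕ< lt′ ≡ i
      cancel {f} {g} g∘f lt lt′ = Fin.toℕ-injective
        (trans (Fin.toℕ-fromℕ< lt′) (trans (cong g (Fin.toℕ-fromℕ< lt)) (g∘f _)))

    restrict : Permutation′ n
    restrict = permutation
      (λ i → fromℕ< (bounded {f} {g} g∘f fix i)) (λ i → fromℕ< (bounded {g} {f} f∘g g-fix i))
      (λ i → cancel {g} {f} f∘g {i} _ _) (λ i → cancel {f} {g} g∘f {i} _ _)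

    ⟦restrict⟧ : ∀ p → ⟦ restrict ⟧ p ≡ f p
    ⟦restrict⟧ p with locate n p
    ... | below i   = trans (⟦⟧-toℕ restrict i) (Fin.toℕ-fromℕ< _)
    ... | above n≤p = trans (⟦⟧-fix restrict n≤p) (sym (fix n≤p))

    ⟦flip-restrict⟧ : ∀ p → ⟦ flip restrict ⟧ p ≡ g p
    ⟦flip-restrict⟧ p with locate n p
    ... | below i   = trans (⟦⟧-toℕ (flip restrict) i) (Fin.toℕ-fromℕ< _)
    ... | above n≤p = trans (⟦⟧-fix (flip restrict) n≤p) (sym (g-fix n≤p))

  -- Descents and blocks depend only on which of two positions holds the smaller value. Unlike the
  -- values themselves, these comparisons need no renumbering when positions are restricted or
  -- collapsed.
  Order : Set
  Order = ℕ → ℕ → Bool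

  byValue : (ℕ → ℕ) → Order
  byValue f p q = does (f p <? f q)

  ord : Permutation′ n → Order
  ord π = byValue ⟦ π ⟧

  descents : ℕ → Order → ℕ
  descents zero    R = 0
  descents (suc n) R = (if R 1 0 then suc else id) (descents n (λ p q → R (suc p) (suc q)))

  descents-cong : ∀ n {R S : Order} → (∀ p → R (suc p) p ≡ S (suc p) p) →
                  descents n R ≡ descents n S
  descents-cong zero    e = refl
  descents-cong (suc n) {R} {S} e
    rewrite e 0
          | descents-cong n {λ p q → R (suc p) (suc q)} {λ p q → S (suc p) (suc q)} (e ∘ suc) = refl

  length-filter-tabulate : ∀ {k} {P : Fin k → Set} (P? : Decidable P) m (f : Fin m → Fin k) R →
    (∀ i → does (P? (f i)) ≡ R (suc (toℕ i)) (toℕ i)) →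
    length (filter P? (List.tabulate f)) ≡ descents m R
  length-filter-tabulate P? zero    f R e = refl
  length-filter-tabulate P? (suc m) f R e with does (P? (f zero)) | e zero
  ... | true  | e₀ rewrite sym e₀ = cong suc (length-filter-tabulate P? m (f ∘ suc) _ (e ∘ suc))
  ... | false | e₀ rewrite sym e₀ = length-filter-tabulate P? m (f ∘ suc) _ (e ∘ suc)

  des-descents : (π : Permutation′ (suc n)) → des π ≡ descents n (ord π)
  des-descents {n} π = length-filter-tabulate _ n id (ord π) λ i →
    cong₂ (λ a b → does (a <? b)) (sym (⟦⟧-toℕ π (suc i)))
      (trans (sym (⟦⟧-toℕ π (inject₁ i))) (cong ⟦ π ⟧ (Fin.toℕ-inject₁ i)))

  -- An adjacent pair of positions lies either inside the block, where it is one of the m pairs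
  -- compared by `S`, or in two different fibres, and then collapsing makes it one of the r pairs
  -- compared by `T`.
  descents-contract : ∀ i m {r} (R S T : Order) → i ≤ r →
    (∀ p q → κ i m p ≢ κ i m q → R p q ≡ T (κ i m p) (κ i m q)) →
    (∀ {y y′} → y ≤ m → y′ ≤ m → R (i + y) (i + y′) ≡ S y y′) →
    descents (m + r) R ≡ descents m S + descents r T
  descents-contract zero zero {r} R S T _ out inn = descents-cong r (λ p → out (suc p) p λ ())
  descents-contract zero (suc m) {r} R S T _ out inn
    rewrite inn {1} {0} (s≤s z≤n) z≤n with S 1 0
  ... | true  = cong suc (descents-contract zero m _ (λ p q → S (suc p) (suc q)) T z≤n
                  (λ p q → out (suc p) (suc q)) (λ y≤m y′≤m → inn (s≤s y≤m) (s≤s y′≤m)))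
  ... | false = descents-contract zero m _ (λ p q → S (suc p) (suc q)) T z≤n
                  (λ p q → out (suc p) (suc q)) (λ y≤m y′≤m → inn (s≤s y≤m) (s≤s y′≤m))
  descents-contract (suc i) m {suc r} R S T (s≤s i≤r) out inn
    rewrite +-suc m r | out 1 0 (λ ()) | κ-zero i m with T 1 0
  ... | true  = trans (cong suc shifted) (sym (+-suc _ _))
    where
    shifted = descents-contract i m (λ p q → R (suc p) (suc q)) S (λ p q → T (suc p) (suc q)) i≤r
      (λ p q κ≢ → out (suc p) (suc q) (κ≢ ∘ suc-injective)) inn
  ... | false =
    descents-contract i m (λ p q → R (suc p) (suc q)) S (λ p q → T (suc p) (suc q)) i≤r
      (λ p q κ≢ → out (suc p) (suc q) (κ≢ ∘ suc-injective)) inn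

  -- Inflation of a point to a block

  -- Here l is meant to be σ i, and ρ to permute {0, …, m}.
  inflateMap : (i m l : ℕ) (σ ρ : ℕ → ℕ) → ℕ → ℕ
  inflateMap i m l σ ρ p with κ i m p ≟ i
  ... | yes _ = l + ρ (p ∸ i)
  ... | no  _ = ε l m (σ (κ i m p))

  inflateMap-inside : ∀ i m l σ ρ {y} → y ≤ m → inflateMap i m l σ ρ (i + y) ≡ l + ρ y
  inflateMap-inside i m l σ ρ {y} y≤m with κ i m (i + y) ≟ i
  ... | yes _ = cong (λ z → l + ρ z) (m+n∸m≡n i y)
  ... | no  κ≢i = contradiction (κ-block i y≤m) κ≢i

  inflateMap-outside : ∀ i m l σ ρ {x} → x ≢ i → inflateMap i m l σ ρ (ε i m x) ≡ ε l m (σ x)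
  inflateMap-outside i m l σ ρ {x} x≢i with κ i m (ε i m x) ≟ i
  ... | yes κ≡i = contradiction (trans (sym (κ∘ε i m x)) κ≡i) x≢i
  ... | no  _   = cong (ε l m ∘ σ) (κ∘ε i m x)

  module _ (i m : ℕ) (σ σ⁻¹ ρ ρ⁻¹ : ℕ → ℕ)
           (σ⁻¹∘σ : ∀ x → σ⁻¹ (σ x) ≡ x) (ρ⁻¹∘ρ : ∀ y → ρ⁻¹ (ρ y) ≡ y)
           (ρ-≤ : ∀ {y} → y ≤ m → ρ y ≤ m) where

    private
      f = inflateMap i m (σ i) σ ρ

      σ-injective : ∀ {x y} → σ x ≡ σ y → x ≡ y
      σ-injective e = trans (sym (σ⁻¹∘σ _)) (trans (cong σ⁻¹ e) (σ⁻¹∘σ _))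

    -- Positions and values play symmetric roles: the inverse of an inflation inflates σ⁻¹ by ρ⁻¹ at
    -- the value σ i. Hence inverse descents are counted by the same lemma as descents.
    inflateMap-inverse : ∀ p → inflateMap (σ i) m i σ⁻¹ ρ⁻¹ (f p) ≡ p
    inflateMap-inverse p with position i m p
    ... | inside {y} y≤m = begin
      g (f (i + y))      ≡⟨ cong g (inflateMap-inside i m (σ i) σ ρ y≤m) ⟩
      g (σ i + ρ y)      ≡⟨ inflateMap-inside (σ i) m i σ⁻¹ ρ⁻¹ (ρ-≤ y≤m) ⟩
      i + ρ⁻¹ (ρ y)      ≡⟨ cong (i +_) (ρ⁻¹∘ρ y) ⟩
      i + y              ∎
      where
      open ≡-Reasoning
      g = inflateMap (σ i) m i σ⁻¹ ρ⁻¹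
    ... | outside {x} x≢i = begin
      g (f (ε i m x))    ≡⟨ cong g (inflateMap-outside i m (σ i) σ ρ x≢i) ⟩
      g (ε (σ i) m (σ x)) ≡⟨ inflateMap-outside (σ i) m i σ⁻¹ ρ⁻¹ (x≢i ∘ σ-injective) ⟩
      ε i m (σ⁻¹ (σ x))  ≡⟨ cong (ε i m) (σ⁻¹∘σ x) ⟩
      ε i m x            ∎
      where
      open ≡-Reasoning
      g = inflateMap (σ i) m i σ⁻¹ ρ⁻¹

    -- Fibres of positions go to fibres of values as `σ` prescribes, so positions in different
    -- fibres are compared as under `σ`.
    κ-inflateMap : ∀ p → κ (σ i) m (f p) ≡ σ (κ i m p)
    κ-inflateMap p with position i m p
    ... | inside {y} y≤m = trans
      (cong (κ (σ i) m) (inflateMap-inside i m (σ i) σ ρ y≤m))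
      (trans (κ-block (σ i) (ρ-≤ y≤m)) (cong σ (sym (κ-block i y≤m))))
    ... | outside {x} x≢i = trans
      (cong (κ (σ i) m) (inflateMap-outside i m (σ i) σ ρ x≢i))
      (trans (κ∘ε (σ i) m (σ x)) (cong σ (sym (κ∘ε i m x))))

    byValue-outside : ∀ p q → κ i m p ≢ κ i m q →
                      byValue f p q ≡ byValue σ (κ i m p) (κ i m q)
    byValue-outside p q κp≢κq = does-⇔ (mk⇔ to from) (f p <? f q) (σ (κ i m p) <? σ (κ i m q))
      where
      to : f p < f q → σ (κ i m p) < σ (κ i m q)
      to lt = ≤∧≢⇒< (subst₂ _≤_ (κ-inflateMap p) (κ-inflateMap q) (κ-mono (σ i) m (<⇒≤ lt)))
                    (κp≢κq ∘ σ-injective)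
      from : σ (κ i m p) < σ (κ i m q) → f p < f q
      from lt = κ-reflects-< (σ i) m (subst₂ _<_ (sym (κ-inflateMap p)) (sym (κ-inflateMap q)) lt)

    byValue-inside : ∀ {y y′} → y ≤ m → y′ ≤ m → byValue f (i + y) (i + y′) ≡ byValue ρ y y′
    byValue-inside {y} {y′} y≤m y′≤m
      rewrite inflateMap-inside i m (σ i) σ ρ y≤m | inflateMap-inside i m (σ i) σ ρ y′≤m =
      does-⇔ (mk⇔ (+-cancelˡ-< (σ i) _ _) (+-monoʳ-< (σ i))) (σ i + ρ y <? σ i + ρ y′) (ρ y <? ρ y′)

  ε-large : ∀ {i} m {x} → i < x → ε i m x ≡ m + x
  ε-large {zero}  m {suc x} _         = sym (+-suc m x)
  ε-large {suc i} m {suc x} (s≤s i<x) = trans (cong suc (ε-large m i<x)) (sym (+-suc m x))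

  ε-size : ∀ {i} m {r} → i ≤ r → ε i m (suc r) ≡ suc (m + r)
  ε-size m {r} i≤r = trans (ε-large m (s≤s i≤r)) (+-suc m r)

  module Inflation {m r : ℕ} (τ : Permutation′ (suc r)) (ρ : Permutation′ (suc m)) (i : ℕ) (i≤r : i ≤ r) where

    private
      l = ⟦ τ ⟧ i

      l≤r : l ≤ r
      l≤r = s≤s⁻¹ (⟦⟧-< τ (s≤s i≤r))

      ρ-≤ : ∀ (ρ : Permutation′ (suc m)) {y} → y ≤ m → ⟦ ρ ⟧ y ≤ m
      ρ-≤ ρ y≤m = s≤s⁻¹ (⟦⟧-< ρ (s≤s y≤m))

      flip-l : ⟦ flip τ ⟧ l ≡ i
      flip-l = ⟦⟧-flipˡ τ i

      f g : ℕ → ℕ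
      f = inflateMap i m l ⟦ τ ⟧ ⟦ ρ ⟧
      -- With `⟦ flip τ ⟧ l` in place of i, `g` has literally the same shape as `f`, and the lemmas
      -- on inflation apply to it with positions and values exchanged.
      g = inflateMap l m (⟦ flip τ ⟧ l) ⟦ flip τ ⟧ ⟦ flip ρ ⟧

      g∘f : ∀ p → g (f p) ≡ p
      g∘f p = subst (λ z → inflateMap l m z ⟦ flip τ ⟧ ⟦ flip ρ ⟧ (f p) ≡ p) (sym flip-l)
        (inflateMap-inverse i m ⟦ τ ⟧ ⟦ flip τ ⟧ ⟦ ρ ⟧ ⟦ flip ρ ⟧ (⟦⟧-flipˡ τ) (⟦⟧-flipˡ ρ) (ρ-≤ ρ) p)

      f∘g : ∀ p → f (g p) ≡ p
      f∘g p = subst (λ z → inflateMap z m l ⟦ τ ⟧ ⟦ ρ ⟧ (g p) ≡ p) flip-l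
        (inflateMap-inverse l m ⟦ flip τ ⟧ ⟦ τ ⟧ ⟦ flip ρ ⟧ ⟦ ρ ⟧ (⟦⟧-flipʳ τ) (⟦⟧-flipʳ ρ)
          (ρ-≤ (flip ρ)) p)

      fix : ∀ {p} → suc (m + r) ≤ p → f p ≡ p
      fix {p} n≤p with position i m p
      ... | inside {y} y≤m = contradiction n≤p
        (<⇒≱ (s≤s (subst (i + y ≤_) (+-comm r m) (+-mono-≤ i≤r y≤m))))
      ... | outside {x} x≢i = begin
        f (ε i m x)      ≡⟨ inflateMap-outside i m l ⟦ τ ⟧ ⟦ ρ ⟧ x≢i ⟩
        ε l m (⟦ τ ⟧ x)  ≡⟨ cong (ε l m) (⟦⟧-fix τ r<x) ⟩
        ε l m x          ≡⟨ ε-large m (≤-<-trans l≤r r<x) ⟩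
        m + x            ≡⟨ ε-large m (≤-<-trans i≤r r<x) ⟨
        ε i m x          ∎
        where
        open ≡-Reasoning
        r<x : r < x
        r<x = subst (suc r ≤_) (κ∘ε i m x)
          (ε≤⇒≤κ i m (subst (_≤ ε i m x) (sym (ε-size m i≤r)) n≤p))

      module Map = Restrict {suc (m + r)} f g g∘f f∘g fix

    opaque
      inflate : Permutation′ (suc (m + r))
      inflate = Map.restrict

    private opaque
      unfolding inflate
      ord-f : ∀ p q → ord inflate p q ≡ byValue f p q
      ord-f p q = cong₂ (λ a b → does (a <? b)) (Map.⟦restrict⟧ p) (Map.⟦restrict⟧ q)

    ord-outside : ∀ p q → κ i m p ≢ κ i m q → ord inflate p q ≡ ord τ (κ i m p) (κ i m q)
    ord-outside p q κ≢ = trans (ord-f p q)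
      (byValue-outside i m ⟦ τ ⟧ ⟦ flip τ ⟧ ⟦ ρ ⟧ ⟦ flip ρ ⟧ (⟦⟧-flipˡ τ) (⟦⟧-flipˡ ρ) (ρ-≤ ρ) p q κ≢)

    ord-inside : ∀ {y y′} → y ≤ m → y′ ≤ m → ord inflate (i + y) (i + y′) ≡ ord ρ y y′
    ord-inside y≤m y′≤m = trans (ord-f _ _)
      (byValue-inside i m ⟦ τ ⟧ ⟦ flip τ ⟧ ⟦ ρ ⟧ ⟦ flip ρ ⟧ (⟦⟧-flipˡ τ) (⟦⟧-flipˡ ρ) (ρ-≤ ρ) y≤m y′≤m)

    des-inflate : des inflate ≡ des ρ + des τ
    des-inflate = begin
      des inflate                                   ≡⟨ des-descents inflate ⟩
      descents (m + r) (ord inflate)                ≡⟨ descents-contract i m (ord inflate) (ord ρ) (ord τ)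
                                                         i≤r ord-outside ord-inside ⟩
      descents m (ord ρ) + descents r (ord τ)       ≡⟨ cong₂ _+_ (des-descents ρ) (des-descents τ) ⟨
      des ρ + des τ                                 ∎
      where open ≡-Reasoning

    private opaque
      unfolding inflate
      ord-g : ∀ p q → ord (flip inflate) p q ≡ byValue g p q
      ord-g p q = cong₂ (λ a b → does (a <? b)) (Map.⟦flip-restrict⟧ p) (Map.⟦flip-restrict⟧ q)

    ides-inflate : ides inflate ≡ ides ρ + ides τ
    ides-inflate = begin
      des (flip inflate)
        ≡⟨ des-descents (flip inflate) ⟩
      descents (m + r) (ord (flip inflate))
        ≡⟨ descents-cong (m + r) {ord (flip inflate)} {byValue g} (λ p → ord-g (suc p) p) ⟩
      descents (m + r) (byValue g)
        ≡⟨ descents-contract l m (byValue g) (ord (flip ρ)) (ord (flip τ)) l≤r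
             (byValue-outside l m ⟦ flip τ ⟧ ⟦ τ ⟧ ⟦ flip ρ ⟧ ⟦ ρ ⟧
               (⟦⟧-flipʳ τ) (⟦⟧-flipʳ ρ) (ρ-≤ (flip ρ)))
             (byValue-inside l m ⟦ flip τ ⟧ ⟦ τ ⟧ ⟦ flip ρ ⟧ ⟦ ρ ⟧
               (⟦⟧-flipʳ τ) (⟦⟧-flipʳ ρ) (ρ-≤ (flip ρ))) ⟩
      descents m (ord (flip ρ)) + descents r (ord (flip τ))
        ≡⟨ cong₂ _+_ (des-descents (flip ρ)) (des-descents (flip τ)) ⟨
      des (flip ρ) + des (flip τ) ∎
      where open ≡-Reasoning

  open Inflation public using (inflate; des-inflate; ides-inflate)

  -- Permutations recovered from their comparisons; standardization

  monotone⇒≥ : ∀ (h : ℕ → ℕ) → (∀ {u v} → u < v → v < n → h u < h v) →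
               ∀ {u} → u < n → u ≤ h u
  monotone⇒≥ h mono {zero}  _   = z≤n
  monotone⇒≥ h mono {suc u} u<n =
    ≤-<-trans (monotone⇒≥ h mono (<-trans (n<1+n u) u<n)) (mono (n<1+n u) u<n)

  -- `⟦ ρ ⟧ ∘ ⟦ flip π ⟧` is strictly increasing on the values below n, hence nowhere below the
  -- identity; exchanging π and ρ gives the opposite inequality.
  ord-determines : (π ρ : Permutation′ n) →
                   (∀ {p q} → p < n → q < n → ord π p q ≡ ord ρ p q) → π Perm.≈ ρ
  ord-determines {n} π ρ e = ≈-from-⟦⟧ π ρ λ p<n →
    ≤-antisym (below-by π ρ e p<n) (below-by ρ π (λ p<n q<n → sym (e p<n q<n)) p<n)
    where
    below-by : (π ρ : Permutation′ n) →
               (∀ {p q} → p < n → q < n → ord π p q ≡ ord ρ p q) →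
               ∀ {p} → p < n → ⟦ π ⟧ p ≤ ⟦ ρ ⟧ p
    below-by π ρ e {p} p<n = subst (λ z → ⟦ π ⟧ p ≤ ⟦ ρ ⟧ z) (⟦⟧-flipˡ π p)
      (monotone⇒≥ (⟦ ρ ⟧ ∘ ⟦ flip π ⟧) mono (⟦⟧-< π p<n))
      where
      mono : ∀ {u v} → u < v → v < n → ⟦ ρ ⟧ (⟦ flip π ⟧ u) < ⟦ ρ ⟧ (⟦ flip π ⟧ v)
      mono {u} {v} u<v v<n = does-true⁻ (_ <? _)
        (trans (sym (e (⟦⟧-< (flip π) (<-trans u<v v<n)) (⟦⟧-< (flip π) v<n)))
          (dec-true (_ <? _) (subst₂ _<_ (sym (⟦⟧-flipʳ π u)) (sym (⟦⟧-flipʳ π v)) u<v)))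

  injective⇒surjective : ∀ {k} (g : Fin k → Fin k) → Injective _≡_ _≡_ g → ∀ v → ∃ λ x → g x ≡ v
  injective⇒surjective {suc k} g g-injective v with Fin.any? (λ x → g x Fin.≟ v)
  ... | yes hit  = hit
  ... | no  miss = contradiction
    (Fin.injective⇒≤ {f = λ x → punchOut {i = v} {g x} (λ v≡gx → miss (x , sym v≡gx))}
      (λ {x} {y} e → g-injective (Fin.punchOut-injective {i = v} {g x} {g y} _ _ e)))
    1+n≰n

  injective⇒permutation : ∀ {k} (g : Fin k → Fin k) → Injective _≡_ _≡_ g → Permutation′ k
  injective⇒permutation g g-injective = permutation g (proj₁ ∘ surjective)
    (proj₂ ∘ surjective) (λ x → g-injective (proj₂ (surjective (g x))))
    where surjective = injective⇒surjective g g-injective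

  count : ℕ → (ℕ → Bool) → ℕ
  count zero    P = 0
  count (suc k) P = (if P k then suc else id) (count k P)

  count-mono : ∀ k {P Q : ℕ → Bool} → (∀ {y} → y < k → P y ≡ true → Q y ≡ true) →
               count k P ≤ count k Q
  count-mono zero    P⊆Q = z≤n
  count-mono (suc k) {P} {Q} P⊆Q with P k in Pk | Q k in Qk
  ... | false | false = count-mono k (P⊆Q ∘ m<n⇒m<1+n)
  ... | false | true  = m≤n⇒m≤1+n (count-mono k (P⊆Q ∘ m<n⇒m<1+n))
  ... | true  | true  = s≤s (count-mono k (P⊆Q ∘ m<n⇒m<1+n))
  ... | true  | false = contradiction (trans (sym Qk) (P⊆Q (n<1+n k) Pk)) λ ()

  count-mono-< : ∀ k {P Q : ℕ → Bool} {z} → (∀ {y} → y < k → P y ≡ true → Q y ≡ true) →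
                 z < k → P z ≡ false → Q z ≡ true → count k P < count k Q
  count-mono-< (suc k) {P} {Q} {z} P⊆Q z<1+k Pz Qz with m≤n⇒m<n∨m≡n (s≤s⁻¹ z<1+k)
  ... | inj₂ refl rewrite Pz | Qz = s≤s (count-mono k (P⊆Q ∘ m<n⇒m<1+n))
  ... | inj₁ z<k with P k in Pk | Q k in Qk
  ...   | false | false = count-mono-< k (P⊆Q ∘ m<n⇒m<1+n) z<k Pz Qz
  ...   | false | true  = m<n⇒m<1+n (count-mono-< k (P⊆Q ∘ m<n⇒m<1+n) z<k Pz Qz)
  ...   | true  | true  = s≤s (count-mono-< k (P⊆Q ∘ m<n⇒m<1+n) z<k Pz Qz)
  ...   | true  | false = contradiction (trans (sym Qk) (P⊆Q (n<1+n k) Pk)) λ ()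

  count-all : ∀ k → count k (λ _ → true) ≡ k
  count-all zero    = refl
  count-all (suc k) = cong suc (count-all k)

  module Standardize {k : ℕ} (f : ℕ → ℕ) (f-injective : ∀ {p q} → f p ≡ f q → p ≡ q) where

    private
      rank : ℕ → ℕ
      rank p = count k (λ y → byValue f y p)

      rank-< : ∀ {p} → p < k → rank p < k
      rank-< {p} p<k = subst (rank p <_) (count-all k)
        (count-mono-< k (λ _ _ → refl) p<k (dec-false (f p <? f p) (<-irrefl refl)) refl)

      rank-mono : ∀ {p q} → p < k → f p < f q → rank p < rank q
      rank-mono {p} {q} p<k fp<fq = count-mono-< k
        (λ {y} _ e → dec-true (f y <? f q) (<-trans (does-true⁻ (f y <? f p) e) fp<fq))
        p<k (dec-false (f p <? f p) (<-irrefl refl)) (dec-true (f p <? f q) fp<fq)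

      rank-injective : ∀ {p q} → p < k → q < k → rank p ≡ rank q → p ≡ q
      rank-injective {p} {q} p<k q<k e with <-cmp (f p) (f q)
      ... | tri< lt _ _ = contradiction e (<⇒≢ (rank-mono p<k lt))
      ... | tri≈ _ eq _ = f-injective eq
      ... | tri> _ _ gt = contradiction (sym e) (<⇒≢ (rank-mono q<k gt))

    opaque
      standardize : Permutation′ k
      standardize = injective⇒permutation (λ i → fromℕ< (rank-< (Fin.toℕ<n i))) λ {i} {j} e →
        Fin.toℕ-injective (rank-injective (Fin.toℕ<n i) (Fin.toℕ<n j)
          (trans (sym (Fin.toℕ-fromℕ< _)) (trans (cong toℕ e) (Fin.toℕ-fromℕ< _))))

    private
      opaque
        unfolding standardize
        standardize-toℕ : ∀ i → toℕ (standardize ⟨$⟩ʳ i) ≡ rank (toℕ i)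
        standardize-toℕ i = Fin.toℕ-fromℕ< _

      ⟦standardize⟧ : ∀ {p} → p < k → ⟦ standardize ⟧ p ≡ rank p
      ⟦standardize⟧ {p} p<k = subst (λ z → ⟦ standardize ⟧ z ≡ rank z) (Fin.toℕ-fromℕ< p<k)
        (trans (⟦⟧-toℕ standardize (fromℕ< p<k)) (standardize-toℕ (fromℕ< p<k)))

    ord-standardize : ∀ {p q} → p < k → q < k → ord standardize p q ≡ byValue f p q
    ord-standardize {p} {q} p<k q<k = does-⇔ (mk⇔ to from) (_ <? _) (f p <? f q)
      where
      from : f p < f q → ⟦ standardize ⟧ p < ⟦ standardize ⟧ q
      from lt = subst₂ _<_ (sym (⟦standardize⟧ p<k)) (sym (⟦standardize⟧ q<k)) (rank-mono p<k lt)
      to : ⟦ standardize ⟧ p < ⟦ standardize ⟧ q → f p < f q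
      to lt with <-cmp (f p) (f q)
      ... | tri< fp<fq _ _ = fp<fq
      ... | tri≈ _ eq _    = contradiction (cong ⟦ standardize ⟧ (f-injective eq)) (<⇒≢ lt)
      ... | tri> _ _ gt    = contradiction lt (<⇒≯
              (subst₂ _<_ (sym (⟦standardize⟧ q<k)) (sym (⟦standardize⟧ p<k)) (rank-mono q<k gt)))

  open Standardize public using (standardize; ord-standardize)

  -- Blocks in terms of comparisons, and their behaviour under inflation

  infix 4 _∈[_,_⟩ _∈?[_,_⟩
  _∈[_,_⟩ : ℕ → ℕ → ℕ → Set
  p ∈[ a , b ⟩ = a ≤ p × p < b

  _∈?[_,_⟩ : ∀ p a b → Dec (p ∈[ a , b ⟩)
  p ∈?[ a , b ⟩ = (a ≤? p) ×-dec (p <? b)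

  -- The positions a, …, b - 1 form a block exactly when every other position compares
  -- in the same way with all of them.
  Module : ℕ → Order → ℕ → ℕ → Set
  Module n R a b = ∀ {p} → p < n → ∀ {p′} → p′ < n → ∀ {q} → q < n →
    p ∈[ a , b ⟩ → p′ ∈[ a , b ⟩ → ¬ q ∈[ a , b ⟩ → R q p ≡ R q p′

  module? : ∀ n R a b → Dec (Module n R a b)
  module? n R a b =
    allUpTo? (λ p → allUpTo? (λ p′ → allUpTo? (λ q →
      (p ∈?[ a , b ⟩) →-dec (p′ ∈?[ a , b ⟩) →-dec ¬? (q ∈?[ a , b ⟩) →-dec (R q p Bool.≟ R q p′))
      n) n) n

  opaque
    blocks : ℕ → Order → ℕ → ℕ → Bool
    blocks n R a b = does (module? n R a b)

    blocks-does : ∀ n R a b → blocks n R a b ≡ does (module? n R a b)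
    blocks-does n R a b = refl

  blocks-sound : ∀ n R {a b} → blocks n R a b ≡ true → Module n R a b
  blocks-sound n R {a} {b} e = does-true⁻ (module? n R a b) (trans (sym (blocks-does n R a b)) e)

  blocks-complete : ∀ n R {a b} → Module n R a b → blocks n R a b ≡ true
  blocks-complete n R {a} {b} M = trans (blocks-does n R a b) (dec-true (module? n R a b) M)

  blocks-⇔ : ∀ {n n′ R R′ a a′ b b′} → Module n R a b ⇔ Module n′ R′ a′ b′ →
             blocks n R a b ≡ blocks n′ R′ a′ b′
  blocks-⇔ {n} {n′} {R} {R′} {a} {a′} {b} {b′} M⇔M′ = trans (blocks-does n R a b)
    (trans (does-⇔ M⇔M′ (module? n R a b) (module? n′ R′ a′ b′)) (sym (blocks-does n′ R′ a′ b′)))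

  module-cong : ∀ n {R S : Order} → (∀ {p q} → p < n → q < n → R p q ≡ S p q) →
                ∀ {a b} → Module n R a b → Module n S a b
  module-cong n e M p<n p′<n q<n p∈ p′∈ q∉ =
    trans (sym (e q<n p<n)) (trans (M p<n p′<n q<n p∈ p′∈ q∉) (e q<n p′<n))

  blocks-cong : ∀ n {R S : Order} → (∀ {p q} → p < n → q < n → R p q ≡ S p q) →
                ∀ a b → blocks n R a b ≡ blocks n S a b
  blocks-cong n e a b = blocks-⇔ (mk⇔ (module-cong n e) (module-cong n (λ p<n q<n → sym (e p<n q<n))))

  ord-cong : {π ρ : Permutation′ n} → π Perm.≈ ρ → ∀ p q → ord π p q ≡ ord ρ p q
  ord-cong π≈ρ p q = cong₂ (λ a b → does (a <? b)) (⟦⟧-cong π≈ρ p) (⟦⟧-cong π≈ρ q)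

  ord-irrefl : (π : Permutation′ n) → ∀ p → ord π p p ≡ false
  ord-irrefl π p = dec-false (⟦ π ⟧ p <? ⟦ π ⟧ p) (<-irrefl refl)

  ord-antisym : (π : Permutation′ n) → ∀ {p q} → p ≢ q → ord π p q ≡ not (ord π q p)
  ord-antisym π {p} {q} p≢q with <-cmp (⟦ π ⟧ p) (⟦ π ⟧ q)
  ... | tri< lt _ gt = trans (dec-true (_ <? _) lt) (cong not (sym (dec-false (⟦ π ⟧ q <? ⟦ π ⟧ p) gt)))
  ... | tri≈ _ eq _  = contradiction (⟦⟧-injective π eq) p≢q
  ... | tri> lt _ gt = trans (dec-false (_ <? _) lt) (cong not (sym (dec-true (⟦ π ⟧ q <? ⟦ π ⟧ p) gt)))

  module _ {m r : ℕ} {i : ℕ} (i≤r : i ≤ r) where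

    private
      κ-< : ∀ {p} → p < suc (m + r) → κ i m p < suc r
      κ-< {p} p<n = <ε⇒κ< i m (subst (p <_) (sym (ε-size m i≤r)) p<n)

      ε-< : ∀ {x} → x < suc r → ε i m x < suc (m + r)
      ε-< {x} x<k = subst (ε i m x <_) (ε-size m i≤r) (ε-mono-< i m x<k)

      κ-inside : ∀ {p} → p ∈[ i , i + suc m ⟩ → κ i m p ≡ i
      κ-inside {p} (i≤p , p<) with m≤n⇒∃[o]m+o≡n i≤p
      ... | y , refl = κ-block i (s≤s⁻¹ (+-cancelˡ-< i y (suc m) p<))

      κ-inside⁻ : ∀ {p} → κ i m p ≡ i → p ∈[ i , i + suc m ⟩
      κ-inside⁻ κ≡i with κ≡i⇒inside i m κ≡i
      ... | y , y≤m , refl = m≤m+n i y , +-monoʳ-< i (s≤s y≤m)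

    module _ (τ : Permutation′ (suc r)) (ρ : Permutation′ (suc m)) where

      open Inflation τ ρ i i≤r using (ord-outside; ord-inside)

      inflate-module : Module (suc (m + r)) (ord (inflate τ ρ i i≤r)) i (i + suc m)
      inflate-module {p} _ {p′} _ {q} _ p∈ p′∈ q∉ = trans
        (ord-outside q p (q∉ ∘ κ-inside⁻ ∘ λ e → trans e (κ-inside p∈)))
        (trans (cong (ord τ (κ i m q)) (trans (κ-inside p∈) (sym (κ-inside p′∈))))
          (sym (ord-outside q p′ (q∉ ∘ κ-inside⁻ ∘ λ e → trans e (κ-inside p′∈)))))

      -- The interval from `ε i m x` to `ε i m y` is a union of fibres, so a position inside and one
      -- outside always lie in different fibres, where the inflation compares as τ does.
      blocks-inflate : ∀ x y → blocks (suc (m + r)) (ord (inflate τ ρ i i≤r)) (ε i m x) (ε i m y)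
                               ≡ blocks (suc r) (ord τ) x y
      blocks-inflate x y = blocks-⇔ (mk⇔ to from)
        where
        R = ord (inflate τ ρ i i≤r)

        ∈-κ : ∀ {p} → p ∈[ ε i m x , ε i m y ⟩ → κ i m p ∈[ x , y ⟩
        ∈-κ (l , u) = ε≤⇒≤κ i m l , <ε⇒κ< i m u
        ∈-κ⁻ : ∀ {p} → κ i m p ∈[ x , y ⟩ → p ∈[ ε i m x , ε i m y ⟩
        ∈-κ⁻ (l , u) = ≤κ⇒ε≤ i m l , κ<⇒<ε i m u
        ∈-ε : ∀ {v} → v ∈[ x , y ⟩ → ε i m v ∈[ ε i m x , ε i m y ⟩
        ∈-ε {v} = ∈-κ⁻ ∘ subst (_∈[ x , y ⟩) (sym (κ∘ε i m v))
        ∈-ε⁻ : ∀ {v} → ε i m v ∈[ ε i m x , ε i m y ⟩ → v ∈[ x , y ⟩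
        ∈-ε⁻ {v} = subst (_∈[ x , y ⟩) (κ∘ε i m v) ∘ ∈-κ

        ord-ε : ∀ {u v} → u ≢ v → R (ε i m u) (ε i m v) ≡ ord τ u v
        ord-ε {u} {v} u≢v = trans
          (ord-outside _ _ (u≢v ∘ subst₂ _≡_ (κ∘ε i m u) (κ∘ε i m v)))
          (cong₂ (ord τ) (κ∘ε i m u) (κ∘ε i m v))

        to : Module (suc (m + r)) R (ε i m x) (ε i m y) → Module (suc r) (ord τ) x y
        to M u<k u′<k v<k u∈ u′∈ v∉ = trans
          (sym (ord-ε λ { refl → v∉ u∈ }))
          (trans (M (ε-< u<k) (ε-< u′<k) (ε-< v<k) (∈-ε u∈) (∈-ε u′∈) (v∉ ∘ ∈-ε⁻))
            (ord-ε λ { refl → v∉ u′∈ }))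

        from : Module (suc r) (ord τ) x y → Module (suc (m + r)) R (ε i m x) (ε i m y)
        from M {p} p<n {p′} p′<n {q} q<n p∈ p′∈ q∉ = trans
          (ord-outside q p (λ e → q∉ (∈-κ⁻ (subst (_∈[ x , y ⟩) (sym e) (∈-κ p∈)))))
          (trans (M (κ-< p<n) (κ-< p′<n) (κ-< q<n) (∈-κ p∈) (∈-κ p′∈) (q∉ ∘ ∈-κ⁻))
            (sym (ord-outside q p′ (λ e → q∉ (∈-κ⁻ (subst (_∈[ x , y ⟩) (sym e) (∈-κ p′∈)))))))

    -- Three cases exhaust the pairs of positions: different fibres are compared by τ, two positions
    -- of the block by ρ, and every other fibre is a single position.
    inflate-cong : ∀ {τ τ′ : Permutation′ (suc r)} {ρ ρ′ : Permutation′ (suc m)} →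
      ρ Perm.≈ ρ′ → τ Perm.≈ τ′ → inflate τ ρ i i≤r Perm.≈ inflate τ′ ρ′ i i≤r
    inflate-cong {τ} {τ′} {ρ} {ρ′} ρ≈ρ′ τ≈τ′ = ord-determines _ _ λ {p} {q} _ _ → same p q
      where
      module I = Inflation τ ρ i i≤r
      module I′ = Inflation τ′ ρ′ i i≤r
      same : ∀ p q → ord I.inflate p q ≡ ord I′.inflate p q
      same p q with κ i m p ≟ κ i m q
      ... | no κp≢κq = trans (I.ord-outside p q κp≢κq)
            (trans (ord-cong τ≈τ′ _ _) (sym (I′.ord-outside p q κp≢κq)))
      ... | yes κp≡κq with κ i m p ≟ i
      ...   | no  κp≢i = subst (λ z → ord I.inflate p z ≡ ord I′.inflate p z)
                (trans (sym (ε∘κ i m κp≢i)) (trans (cong (ε i m) κp≡κq) (ε∘κ i m (κp≢i ∘ trans κp≡κq))))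
                (trans (ord-irrefl I.inflate p) (sym (ord-irrefl I′.inflate p)))
      ...   | yes κp≡i with κ≡i⇒inside i m κp≡i | κ≡i⇒inside i m (trans (sym κp≡κq) κp≡i)
      ...     | y , y≤m , refl | y′ , y′≤m , refl =
                trans (I.ord-inside y≤m y′≤m) (trans (ord-cong ρ≈ρ′ y y′) (sym (I′.ord-inside y≤m y′≤m)))

    inflate-injective : ∀ {τ τ′ : Permutation′ (suc r)} {ρ ρ′ : Permutation′ (suc m)} →
      inflate τ ρ i i≤r Perm.≈ inflate τ′ ρ′ i i≤r → ρ Perm.≈ ρ′ × τ Perm.≈ τ′
    inflate-injective {τ} {τ′} {ρ} {ρ′} e = ρ≈ρ′ , τ≈τ′
      where
      module I = Inflation τ ρ i i≤r
      module I′ = Inflation τ′ ρ′ i i≤r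

      ρ≈ρ′ : ρ Perm.≈ ρ′
      ρ≈ρ′ = ord-determines ρ ρ′ λ y<k y′<k →
        trans (sym (I.ord-inside (s≤s⁻¹ y<k) (s≤s⁻¹ y′<k)))
          (trans (ord-cong e _ _) (I′.ord-inside (s≤s⁻¹ y<k) (s≤s⁻¹ y′<k)))

      τ≈τ′ : τ Perm.≈ τ′
      τ≈τ′ = ord-determines τ τ′ λ {u} {v} _ _ → same u v
        where
        same : ∀ u v → ord τ u v ≡ ord τ′ u v
        same u v with u ≟ v
        ... | yes refl = trans (ord-irrefl τ u) (sym (ord-irrefl τ′ u))
        ... | no u≢v = subst₂ (λ a b → ord τ a b ≡ ord τ′ a b) (κ∘ε i m u) (κ∘ε i m v)
              (trans (sym (I.ord-outside _ _ κ≢)) (trans (ord-cong e _ _) (I′.ord-outside _ _ κ≢)))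
          where
          κ≢ : κ i m (ε i m u) ≢ κ i m (ε i m v)
          κ≢ = u≢v ∘ subst₂ _≡_ (κ∘ε i m u) (κ∘ε i m v)

    module _ (π : Permutation′ (suc (m + r))) (M : Module (suc (m + r)) (ord π) i (i + suc m)) where

      private
        quotient : Permutation′ (suc r)
        quotient = standardize (⟦ π ⟧ ∘ ε i m) (ε-injective i m ∘ ⟦⟧-injective π)

        restriction : Permutation′ (suc m)
        restriction = standardize (⟦ π ⟧ ∘ (i +_)) (+-cancelˡ-≡ i _ _ ∘ ⟦⟧-injective π)

        module I = Inflation quotient restriction i i≤r

        n′ : ℕ
        n′ = suc (m + r)

        representativeʳ : ∀ {p q} → p < n′ → q < n′ → κ i m q ≢ κ i m p →
                          ord π q p ≡ ord π q (ε i m (κ i m p))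
        representativeʳ {p} {q} p<n′ q<n′ κq≢κp with κ i m p ≟ i
        ... | no  κp≢i = cong (ord π q) (sym (ε∘κ i m κp≢i))
        ... | yes κp≡i = M p<n′ (≤-<-trans (ε∘κ-≤ i m p) p<n′) q<n′ (κ-inside⁻ κp≡i)
                (κ-inside⁻ (trans (κ∘ε i m (κ i m p)) κp≡i))
                (λ q∈ → κq≢κp (trans (κ-inside q∈) (sym κp≡i)))

        -- `Module` speaks only of comparisons with the outside position on the left; antisymmetry
        -- supplies the other side.
        representativeˡ : ∀ {p q} → p < n′ → q < n′ → κ i m p ≢ κ i m q →
                          ord π p q ≡ ord π (ε i m (κ i m p)) q
        representativeˡ {p} {q} p<n′ q<n′ κp≢κq = trans
          (ord-antisym π (κp≢κq ∘ cong (κ i m)))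
          (trans (cong not (representativeʳ p<n′ q<n′ (κp≢κq ∘ sym)))
            (sym (ord-antisym π λ e → κp≢κq
              (trans (sym (κ∘ε i m (κ i m p))) (cong (κ i m) e)))))

        ε∘κ-< : ∀ {p} → p < n′ → ε i m (κ i m p) < n′
        ε∘κ-< {p} p<n′ = ≤-<-trans (ε∘κ-≤ i m p) p<n′

        same : ∀ {p q} → p < n′ → q < n′ → ord π p q ≡ ord I.inflate p q
        same {p} {q} p<n′ q<n′ with κ i m p ≟ κ i m q
        ... | no κp≢κq = begin
          ord π p q                                ≡⟨ representativeˡ p<n′ q<n′ κp≢κq ⟩
          ord π (ε i m (κ i m p)) q                ≡⟨ representativeʳ q<n′ (ε∘κ-< p<n′)
                                                        (κp≢κq ∘ trans (sym (κ∘ε i m _))) ⟩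
          ord π (ε i m (κ i m p)) (ε i m (κ i m q)) ≡⟨ ord-standardize _ _ (κ-< p<n′) (κ-< q<n′) ⟨
          ord quotient (κ i m p) (κ i m q)         ≡⟨ I.ord-outside p q κp≢κq ⟨
          ord I.inflate p q                        ∎
          where open ≡-Reasoning
        ... | yes κp≡κq with κ i m p ≟ i
        ...   | no  κp≢i = subst (λ z → ord π p z ≡ ord I.inflate p z)
                (trans (sym (ε∘κ i m κp≢i)) (trans (cong (ε i m) κp≡κq) (ε∘κ i m (κp≢i ∘ trans κp≡κq))))
                (trans (ord-irrefl π p) (sym (ord-irrefl I.inflate p)))
        ...   | yes κp≡i with κ≡i⇒inside i m κp≡i | κ≡i⇒inside i m (trans (sym κp≡κq) κp≡i)
        ...     | y , y≤m , refl | y′ , y′≤m , refl =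
                  trans (sym (ord-standardize _ _ (s≤s y≤m) (s≤s y′≤m))) (sym (I.ord-inside y≤m y′≤m))

      -- The factors are the standardizations of π on the block and on the first positions of the
      -- fibres. That they inflate back to π is checked on comparisons: since the block is a module,
      -- a position may be replaced by the first one of its fibre when it is compared with another
      -- fibre.
      module-inflate : ∃ λ ρ → ∃ λ τ → π Perm.≈ inflate τ ρ i i≤r
      module-inflate = restriction , quotient , ord-determines π I.inflate same

  -- Systems of blocks

  Blocks : Set
  Blocks = ℕ → ℕ → Bool

  -- These are the properties of blocks from which the vanishing follows. In `crossing`, two blocks
  -- that overlap without containment yield, in this order, their union, their intersection, the
  -- left and the right difference.
  record IsBlockSystem (n : ℕ) (B : Blocks) : Set where
    field
      unit  : ∀ {a} → a < n → B a (suc a) ≡ true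
      whole : B 0 n ≡ true
      crossing : ∀ {a b c d} → a < b → b < c → c < d → d ≤ n → B a c ≡ true → B b d ≡ true →
                B a d ≡ true × B b c ≡ true × B a b ≡ true × B c d ≡ true

  -- For the blocks of a permutation this singles out the identity and the reversal.
  IsMono : ℕ → Blocks → Set
  IsMono k B = ∀ {y} → y < suc k → ∀ {x} → x < y → B x y ≡ true

  isMono? : ∀ k B → Dec (IsMono k B)
  isMono? k B = allUpTo? (λ y → allUpTo? (λ x → B x y Bool.≟ true) y) (suc k)

  trivial? : ∀ k x y → Dec (y ≡ suc x ⊎ (x ≡ 0 × y ≡ k))
  trivial? k x y = (y ≟ suc x) ⊎-dec ((x ≟ 0) ×-dec (y ≟ k))

  -- For the blocks of a permutation of length k this is simplicity. A block system on one or two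
  -- positions satisfies both this and `IsMono`.
  HasOnlyTrivial : ℕ → Blocks → Set
  HasOnlyTrivial k B = ∀ {y} → y < suc k → ∀ {x} → x < y → B x y ≡ does (trivial? k x y)

  hasOnlyTrivial? : ∀ k B → Dec (HasOnlyTrivial k B)
  hasOnlyTrivial? k B =
    allUpTo? (λ y → allUpTo? (λ x → B x y Bool.≟ does (trivial? k x y)) y) (suc k)

  module _ (n : ℕ) (B : Blocks) where

    IsSplit : ℕ → Set
    IsSplit c = 0 < c × B 0 c ≡ true × B c n ≡ true

    isSplit? : ∀ c → Dec (IsSplit c)
    isSplit? c = (0 <? c) ×-dec (B 0 c Bool.≟ true) ×-dec (B c n Bool.≟ true)

    -- The boundary c lies strictly inside a block other than the whole. In the absence of splits,
    -- the boundaries that are not covered are the cuts of the partition into maximal proper blocks.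
    Covered : ℕ → Set
    Covered c = ∃ λ a → a < c × ∃ λ b → b < suc n × c < b × B a b ≡ true × ¬ (a ≡ 0 × b ≡ n)

    covered? : ∀ c → Dec (Covered c)
    covered? c = anyUpTo? (λ a → anyUpTo? (λ b →
      (c <? b) ×-dec (B a b Bool.≟ true) ×-dec ¬? ((a ≟ 0) ×-dec (b ≟ n))) (suc n)) c

  -- A partition of n positions into k consecutive parts, given by its boundaries: part x is [e x, e
  -- (suc x)⟩. Monotonicity holds beyond k as well, so that `e` reflects the order without side
  -- conditions.
  record Enumerates (n k : ℕ) (e : ℕ → ℕ) : Set where
    field
      mono  : ∀ {x y} → x < y → e x < e y
      first : e 0 ≡ 0
      last  : e k ≡ n

  bracket : ∀ (e : ℕ → ℕ) k {c} → e 0 ≤ c → c < e k → ∃ λ x → x < k × e x ≤ c × c < e (suc x)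
  bracket e zero    e0≤c c<e0 = contradiction e0≤c (<⇒≱ c<e0)
  bracket e (suc k) {c} e0≤c c<ek with c <? e k
  ... | yes c<e = let x , x<k , rest = bracket e k e0≤c c<e in x , m<n⇒m<1+n x<k , rest
  ... | no  c≮e = k , n<1+n k , ≮⇒≥ c≮e , c<ek

  module Quotient {n k : ℕ} {B : Blocks} {e : ℕ → ℕ} (S : IsBlockSystem n B) (E : Enumerates n k e) where
    open IsBlockSystem S
    open Enumerates E

    B/ : Blocks
    B/ x y = B (e x) (e y)

    mono-≤ : ∀ {x y} → x ≤ y → e x ≤ e y
    mono-≤ x≤y with m≤n⇒m<n∨m≡n x≤y
    ... | inj₁ x<y  = <⇒≤ (mono x<y)
    ... | inj₂ refl = ≤-refl

    reflects-< : ∀ {x y} → e x < e y → x < y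
    reflects-< ex<ey = ≰⇒> λ y≤x → <⇒≱ ex<ey (mono-≤ y≤x)

    ≤n : ∀ {x} → x ≤ k → e x ≤ n
    ≤n {x} x≤k = subst (e x ≤_) last (mono-≤ x≤k)

    <n : ∀ {x} → x < k → e x < n
    <n {x} x<k = subst (e x <_) last (mono x<k)

    0< : ∀ {x} → 0 < x → 0 < e x
    0< {x} 0<x = subst (_< e x) first (mono 0<x)

    part : ∀ {c} → c < n → ∃ λ x → x < k × e x ≤ c × c < e (suc x)
    part {c} c<n = bracket e k (subst (_≤ c) (sym first) z≤n) (subst (c <_) (sym last) c<n)

    whole/ : B/ 0 k ≡ true
    whole/ = subst₂ (λ a b → B a b ≡ true) (sym first) (sym last) whole

    -- An inner interval of parts is the intersection of the initial block that ends at one split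
    -- with the final block that starts at another.
    splits⇒isMono : (∀ {x} → 0 < x → x < k → IsSplit n B (e x)) → IsMono k B/
    splits⇒isMono split {y} y<1+k {x} x<y with x ≟ 0 | m≤n⇒m<n∨m≡n (s≤s⁻¹ y<1+k)
    ... | yes refl | inj₂ refl = whole/
    ... | yes refl | inj₁ y<k  =
      subst (λ z → B z (e y) ≡ true) (sym first) (proj₁ (proj₂ (split x<y y<k)))
    ... | no x≢0   | inj₂ refl =
      subst (λ z → B (e x) z ≡ true) (sym last) (proj₂ (proj₂ (split (n≢0⇒n>0 x≢0) x<y)))
    ... | no x≢0   | inj₁ y<k  = proj₁ (proj₂ (crossing (0< 0<x) (mono x<y) (<n y<k) ≤-refl
      (proj₁ (proj₂ (split (<-trans 0<x x<y) y<k)))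
      (proj₂ (proj₂ (split 0<x (<-trans x<y y<k))))))
      where 0<x = n≢0⇒n>0 x≢0

    isMono⇒splits : IsMono k B/ → ∀ {x} → 0 < x → x < k → IsSplit n B (e x)
    isMono⇒splits m {x} 0<x x<k = 0< 0<x ,
      subst (λ z → B z (e x) ≡ true) first (m (m<n⇒m<1+n x<k) 0<x) ,
      subst (λ z → B (e x) z ≡ true) last (m (n<1+n k) x<k)

    module _ (only : HasOnlyTrivial k B/) where

      unit/ : ∀ {x} → x < k → B/ x (suc x) ≡ true
      unit/ {x} x<k = trans (only (s≤s x<k) (n<1+n x)) (dec-true (trivial? k x (suc x)) (inj₁ refl))

      trivial/ : ∀ {x y} → x < y → y ≤ k → B/ x y ≡ true → y ≡ suc x ⊎ (x ≡ 0 × y ≡ k)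
      trivial/ {x} {y} x<y y≤k b = does-true⁻ (trivial? k x y) (trans (sym (only (s≤s y≤k) x<y)) b)

      -- The parts are the maximal blocks other than the whole: a block meeting several of them
      -- could be enlarged to, or subtracted from the whole to leave, a union of at least two parts.
      proper-in-part : 3 ≤ k → ∀ {a b} → a < b → b ≤ n → B a b ≡ true → ¬ (a ≡ 0 × b ≡ n) →
                       ∃ λ x → x < k × e x ≤ a × b ≤ e (suc x)
      proper-in-part 3≤k {a} {suc b} a<b b≤n Bab proper
        with part (≤-trans a<b b≤n) | part b≤n
      ... | x , x<k , ex≤a , a<e | y , y<k , ey≤b , b<e with suc y ≤? suc x
      ... | yes y≤x = x , x<k , ex≤a , ≤-trans b<e (mono-≤ y≤x)
      ... | no y≰x = contradiction union (λ u → impossible (trivial/ (<-trans x<y (n<1+n y)) y<k u))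
        where
        x<y : x < y
        x<y = s≤s⁻¹ (≰⇒> y≰x)

        e[1+x]≤ey : e (suc x) ≤ e y
        e[1+x]≤ey = mono-≤ x<y

        left : B (e x) (suc b) ≡ true
        left with m≤n⇒m<n∨m≡n ex≤a
        ... | inj₂ refl = Bab
        ... | inj₁ ex<a = proj₁ (crossing ex<a a<e (s≤s (≤-trans e[1+x]≤ey ey≤b)) b≤n (unit/ x<k) Bab)

        union : B/ x (suc y) ≡ true
        union with m≤n⇒m<n∨m≡n b<e
        ... | inj₂ eq = subst (λ z → B (e x) z ≡ true) eq left
        ... | inj₁ b<e = proj₁ (crossing (mono x<y) (s≤s ey≤b) b<e (≤n y<k) left (unit/ y<k))

        impossible : suc y ≡ suc x ⊎ (x ≡ 0 × suc y ≡ k) → ⊥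
        impossible (inj₁ eq) = <-irrefl (sym (suc-injective eq)) x<y
        -- The union of the parts met is the whole, so the block meets the first and the last part
        -- but misses a position at one end. Removing the first part, or else the last, and
        -- completing the other end leaves a block of k - 1 ≥ 2 parts, which is neither a part nor
        -- the whole.
        impossible (inj₂ (refl , refl)) with m≤n⇒m<n∨m≡n ex≤a
        ... | inj₁ e0<a = contradiction (trivial/ (s≤s (≤-trans (s≤s z≤n) 2≤y)) ≤-refl rest) λ
              { (inj₁ eq) → <-irrefl (sym (suc-injective eq)) 2≤y
              ; (inj₂ (() , _)) }
          where
          2≤y : 2 ≤ y
          2≤y = s≤s⁻¹ 3≤k
          right : B (e 1) (suc b) ≡ true
          right = proj₂ (proj₂ (proj₂ (crossing e0<a a<e (s≤s (≤-trans e[1+x]≤ey ey≤b)) b≤n (unit/ x<k) Bab)))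
          rest : B/ 1 (suc y) ≡ true
          rest with m≤n⇒m<n∨m≡n b<e
          ... | inj₂ eq = subst (λ z → B (e 1) z ≡ true) eq right
          ... | inj₁ b<e = proj₁ (crossing (mono 2≤y) (s≤s ey≤b) b<e (≤n y<k) right (unit/ y<k))
        ... | inj₂ refl = contradiction (trivial/ x<y (<⇒≤ y<k) rest) λ
              { (inj₁ refl) → contradiction 3≤k λ { (s≤s (s≤s ())) }
              ; (inj₂ (_ , y≡k)) → <-irrefl y≡k y<k }
          where
          b<n : suc b < e (suc y)
          b<n = ≤∧≢⇒< b<e λ eq → proper (first , trans eq last)
          rest : B/ 0 y ≡ true
          rest = proj₁ (proj₂ (proj₂ (crossing (mono x<y) (s≤s ey≤b) b<n (≤n y<k) Bab (unit/ y<k))))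

      -- With three or more parts, the proper blocks [0, c⟩ and [c, n⟩ would each fit into one part,
      -- leaving room for only two. With at most two parts, the parts themselves are initial and
      -- final blocks, so an inner cut is a split.
      split⇒isMono : ∀ {c} → c < n → IsSplit n B c → IsMono k B/
      split⇒isMono {c} c<n (0<c , l , r) with k ≤? 2
      ... | no k≰2 with proper-in-part (≰⇒> k≰2) 0<c (<⇒≤ c<n) l (λ (_ , c≡n) → <-irrefl c≡n c<n)
                      | proper-in-part (≰⇒> k≰2) c<n ≤-refl r (λ (c≡0 , _) → <-irrefl (sym c≡0) 0<c)
      ...   | x , _ , ex≤0 , c≤e | y , y<k , ey≤c , n≤e = contradiction (≰⇒> k≰2) (≤⇒≯ k≤2)
        where
        x≤0 : x ≤ 0
        x≤0 = ≮⇒≥ λ 0<x → <⇒≱ (0< 0<x) ex≤0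
        y≤1 : y ≤ suc x
        y≤1 = ≮⇒≥ λ lt → <⇒≱ (mono lt) (≤-trans ey≤c c≤e)
        k≤2 : k ≤ 2
        k≤2 = ≤-trans (≮⇒≥ λ lt → <⇒≱ (subst (e (suc y) <_) last (mono lt)) n≤e)
                (s≤s (≤-trans y≤1 (s≤s x≤0)))
      split⇒isMono {c} c<n (0<c , l , r) | yes k≤2 = splits⇒isMono λ {x} 0<x x<k →
        let x≡1 : x ≡ 1
            x≡1 = ≤-antisym (s≤s⁻¹ (≤-trans x<k k≤2)) 0<x
        in 0< 0<x ,
           subst₂ (λ u v → B u v ≡ true) first (cong e (sym x≡1)) (unit/ {0} (<-trans 0<x x<k)) ,
           subst (λ v → B (e x) v ≡ true)
             (trans (cong e (≤-antisym x<k (subst (λ z → k ≤ suc z) (sym x≡1) k≤2))) last) (unit/ x<k)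

      -- Together with `¬cut⇒covered` this gives uniqueness: the cuts are exactly the uncovered
      -- boundaries, so the partition is determined by `B`.
      cut⇒¬covered : 3 ≤ k → ∀ {x} → ¬ Covered n B (e x)
      cut⇒¬covered 3≤k {x} (a , a<c , b , b<1+n , c<b , Bab , proper)
        with proper-in-part 3≤k (<-trans a<c c<b) (s≤s⁻¹ b<1+n) Bab proper
      ... | y , _ , ey≤a , b≤e = <⇒≱ (reflects-< (≤-<-trans ey≤a a<c))
        (s≤s⁻¹ (reflects-< (<-≤-trans c<b b≤e)))

      ¬cut⇒covered : 3 ≤ k → ∀ {c} → c < n → (∀ x → e x ≢ c) → Covered n B c
      ¬cut⇒covered 3≤k {c} c<n ¬cut with part c<n
      ... | x , x<k , ex≤c , c<e = e x , ≤∧≢⇒< ex≤c (¬cut x) , e (suc x) , s≤s (≤n x<k) , c<e , unit/ x<k ,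
        λ (ex≡0 , e≡n) → <-irrefl refl (≤-trans 3≤k (≤-trans
          (≮⇒≥ λ lt → <-irrefl (trans e≡n (sym last)) (mono lt))
          (s≤s (≤-trans (≮⇒≥ λ 0<x → <-irrefl (sym ex≡0) (0< 0<x)) z≤n))))

    module _ (¬split : ∀ {c} → c < n → ¬ IsSplit n B c) where

      isMono⇒k≤1 : IsMono k B/ → k ≤ 1
      isMono⇒k≤1 m = ≮⇒≥ λ 1<k → ¬split (<n 1<k) (isMono⇒splits m (s≤s z≤n) 1<k)

      onlyTrivial⇒k≢2 : HasOnlyTrivial k B/ → k ≢ 2
      onlyTrivial⇒k≢2 only refl = ¬split (<n {1} (s≤s (s≤s z≤n)))
        (0< (s≤s z≤n) , subst (λ z → B z (e 1) ≡ true) first (unit/ only (s≤s z≤n)) ,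
         subst (λ z → B (e 1) z ≡ true) last (unit/ only (s≤s (s≤s z≤n))))

      module _ (2≤n : 2 ≤ n)
               (cut⇒ : ∀ {x} → 0 < x → x < k → ¬ Covered n B (e x))
               (¬cut⇒ : ∀ {c} → 0 < c → c < n → (∀ x → e x ≢ c) → Covered n B c) where

        private
          -- A boundary c inside part x is no cut, so some proper block covers it. That block
          -- crosses no cut and so stays inside the part, and its union with [e x, c⟩ is a longer
          -- block. `fuel` bounds the distance left to the end of the part.
          grow : ∀ fuel {x c} → x < k → e x < c → c ≤ e (suc x) → e (suc x) ≤ fuel + c →
                 B (e x) c ≡ true → B/ x (suc x) ≡ true
          grow fuel {x} {c} x<k ex<c c≤e e≤ b with m≤n⇒m<n∨m≡n c≤e
          ... | inj₂ refl = b
          grow zero       x<k ex<c c≤e e≤ b | inj₁ c<e = contradiction e≤ (<⇒≱ c<e)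
          grow (suc fuel) {x} {c} x<k ex<c c≤e e≤ b | inj₁ c<e
            with ¬cut⇒ (≤-<-trans z≤n ex<c) (<-≤-trans c<e (≤n x<k))
                   (λ y ey≡c → <⇒≱ (reflects-< (subst (e x <_) (sym ey≡c) ex<c))
                     (s≤s⁻¹ (reflects-< (subst (_< e (suc x)) (sym ey≡c) c<e))))
          ... | a′ , a′<c , b′ , b′<1+n , c<b′ , B′ , proper =
            grow fuel x<k (<-trans ex<c c<b′) b′≤e
              (≤-trans e≤ (≤-trans (≤-reflexive (sym (+-suc fuel c))) (+-monoʳ-≤ fuel c<b′))) union
            where
            ex≤a′ : e x ≤ a′
            ex≤a′ with x ≟ 0
            ... | yes refl = subst (_≤ a′) (sym first) z≤n
            ... | no  x≢0  = ≮⇒≥ λ a′<ex → cut⇒ (n≢0⇒n>0 x≢0) x<k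
                    (a′ , a′<ex , b′ , b′<1+n , <-trans ex<c c<b′ , B′ , proper)
            b′≤e : b′ ≤ e (suc x)
            b′≤e with m≤n⇒m<n∨m≡n x<k
            ... | inj₂ refl = subst (b′ ≤_) (sym last) (s≤s⁻¹ b′<1+n)
            ... | inj₁ 1+x<k = ≮⇒≥ λ e<b′ → cut⇒ (s≤s z≤n) 1+x<k
                    (a′ , <-trans a′<c c<e , b′ , b′<1+n , e<b′ , B′ , proper)
            union : B (e x) b′ ≡ true
            union with m≤n⇒m<n∨m≡n ex≤a′
            ... | inj₂ refl = B′
            ... | inj₁ ex<a′ = proj₁ (crossing ex<a′ a′<c c<b′ (s≤s⁻¹ b′<1+n) b B′)

          unit′ : ∀ {x} → x < k → B/ x (suc x) ≡ true
          unit′ {x} x<k = grow (e (suc x)) x<k (n<1+n (e x)) (mono (n<1+n x))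
            (m≤m+n (e (suc x)) (suc (e x))) (unit (<n x<k))

          -- If there were no cuts, then growing a proper block [0, c⟩ would yield a split.
          escape : ∀ fuel {c} → k ≤ 1 → 0 < c → c < n → n ≤ fuel + c → B 0 c ≡ true → ⊥
          escape zero        k≤1 0<c c<n n≤ b = <⇒≱ c<n n≤
          escape (suc fuel) {c} k≤1 0<c c<n n≤ b
            with ¬cut⇒ 0<c c<n (λ y ey≡c → <⇒≱ (reflects-< (subst₂ _<_ (sym first) (sym ey≡c) 0<c))
                   (s≤s⁻¹ (≤-trans (reflects-< (subst₂ _<_ (sym ey≡c) (sym last) c<n)) k≤1)))
          ... | a′ , a′<c , b′ , b′<1+n , c<b′ , B′ , proper with m≤n⇒m<n∨m≡n (s≤s⁻¹ b′<1+n) | a′ ≟ 0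
          ...   | inj₁ b′<n | yes refl = escape fuel k≤1 (≤-<-trans z≤n c<b′) b′<n
                  (≤-trans n≤ (≤-trans (≤-reflexive (sym (+-suc fuel c))) (+-monoʳ-≤ fuel c<b′))) B′
          ...   | inj₁ b′<n | no a′≢0 = escape fuel k≤1 (≤-<-trans z≤n c<b′) b′<n
                  (≤-trans n≤ (≤-trans (≤-reflexive (sym (+-suc fuel c))) (+-monoʳ-≤ fuel c<b′)))
                  (proj₁ (crossing (n≢0⇒n>0 a′≢0) a′<c c<b′ (<⇒≤ b′<n) b B′))
          ...   | inj₂ refl | yes refl = proper (refl , refl)
          ...   | inj₂ refl | no a′≢0 = ¬split (<-trans a′<c c<n) (n≢0⇒n>0 a′≢0 ,
                  proj₁ (proj₂ (proj₂ (crossing (n≢0⇒n>0 a′≢0) a′<c c<n ≤-refl b B′))) , B′)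

        2≤k : 2 ≤ k
        2≤k = ≰⇒> λ k≤1 → escape n k≤1 (s≤s z≤n) 2≤n (m≤m+n n 1) (unit (<-trans (n<1+n 0) 2≤n))

        -- A nontrivial block of the quotient starting at part x would cover the cut after part x.
        onlyTrivial : HasOnlyTrivial k B/
        onlyTrivial {y} y<1+k {x} x<y = decide (trivial? k x y)
          where
          y≤k : y ≤ k
          y≤k = s≤s⁻¹ y<1+k

          decide : (d : Dec (y ≡ suc x ⊎ (x ≡ 0 × y ≡ k))) → B/ x y ≡ does d
          decide (yes (inj₁ refl))          = unit′ y≤k
          decide (yes (inj₂ (refl , refl))) = whole/
          decide (no nontrivial) with B/ x y in b
          ... | false = refl
          ... | true  = contradiction
            (e x , mono (n<1+n x) , e y , s≤s (≤n y≤k) , mono 1+x<y , b ,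
             λ (ex≡0 , ey≡n) → nontrivial (inj₂
               (n≤0⇒n≡0 (≮⇒≥ λ 0<x → <-irrefl (sym ex≡0) (0< 0<x)) ,
                ≤-antisym y≤k (≮⇒≥ λ y<k → <-irrefl (trans ey≡n (sym last)) (mono y<k)))))
            (cut⇒ (s≤s z≤n) (≤-trans 1+x<y y≤k))
            where
            1+x<y : suc x < y
            1+x<y = ≤∧≢⇒< x<y (λ eq → nontrivial (inj₁ (sym eq)))

  -- Partitions into consecutive parts

  -- A partition into consecutive parts is given by i, m and bs: positions below i are parts of their
  -- own, the next suc m positions lie in one part, and bs tells after which of these and the remaining
  -- positions a part ends.  Then size i m bs is the number of parts, and cut i m bs enumerates their
  -- boundaries.
  size : ℕ → ℕ → Vec Bool N → ℕ
  size i m []           = suc i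
  size i m (false ∷ bs) = size i (suc m) bs
  size i m (true  ∷ bs) = size (suc i) 0 bs

  cut : ℕ → ℕ → Vec Bool N → ℕ → ℕ
  cut i m []           = ε i m
  cut i m (false ∷ bs) = cut i (suc m) bs
  cut i m (true  ∷ bs) = ε i m ∘ cut (suc i) 0 bs

  cut-mono : ∀ i m (bs : Vec Bool N) {x y} → x < y → cut i m bs x < cut i m bs y
  cut-mono i m []           x<y = ε-mono-< i m x<y
  cut-mono i m (false ∷ bs) x<y = cut-mono i (suc m) bs x<y
  cut-mono i m (true  ∷ bs) x<y = ε-mono-< i m (cut-mono (suc i) 0 bs x<y)

  cut-fix : ∀ i m (bs : Vec Bool N) {x} → x ≤ i → cut i m bs x ≡ x
  cut-fix i m []           x≤i = ε-fix i m x≤i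
  cut-fix i m (false ∷ bs) x≤i = cut-fix i (suc m) bs x≤i
  cut-fix i m (true  ∷ bs) x≤i =
    trans (cong (ε i m) (cut-fix (suc i) 0 bs (m≤n⇒m≤1+n x≤i))) (ε-fix i m x≤i)

  cut-size : ∀ i m (bs : Vec Bool N) → cut i m bs (size i m bs) ≡ i + (suc m + N)
  cut-size i m []           = trans (ε-next i m) (cong (λ z → i + suc z) (sym (+-identityʳ m)))
  cut-size {suc N} i m (false ∷ bs) =
    trans (cut-size i (suc m) bs) (cong (λ z → i + suc z) (sym (+-suc m N)))
  cut-size {suc N} i m (true ∷ bs) = trans
    (cong (ε i m) (trans (cut-size (suc i) 0 bs) (sym (+-suc i (suc N)))))
    (ε-shift i m (suc N))

  cut-next : ∀ i m (bs : Vec Bool N) → i + suc m ≤ cut i m bs (suc i)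
  cut-next i m []           = ≤-reflexive (sym (ε-next i m))
  cut-next i m (false ∷ bs) = ≤-trans (+-monoʳ-≤ i (n≤1+n (suc m))) (cut-next i (suc m) bs)
  cut-next i m (true  ∷ bs) = ≤-reflexive
    (sym (trans (cong (ε i m) (cut-fix (suc i) 0 bs ≤-refl)) (ε-next i m)))

  private
    shift-false : ∀ i m p → i + (suc (suc m) + p) ≡ i + (suc m + suc p)
    shift-false i m p = cong (λ z → i + suc z) (sym (+-suc m p))

    shift-true : ∀ i m p → ε i m (suc i + suc p) ≡ i + (suc m + suc p)
    shift-true i m p = trans (cong (ε i m) (sym (+-suc i (suc p)))) (ε-shift i m (suc p))

  -- Bit p stands for the boundary i + m + 1 + p; the boundaries up to i + m are already decided,
  -- being before the current part or inside it.
  lookup-true : ∀ i m (bs : Vec Bool N) p → lookup bs p ≡ true →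
                ∃ λ x → cut i m bs x ≡ i + (suc m + toℕ p)
  lookup-true i m (true ∷ bs) zero _ = suc i ,
    trans (cong (ε i m) (cut-fix (suc i) 0 bs ≤-refl))
      (trans (ε-next i m) (cong (λ z → i + suc z) (sym (+-identityʳ m))))
  lookup-true i m (false ∷ bs) (suc p) e with lookup-true i (suc m) bs p e
  ... | x , eq = x , trans eq (shift-false i m (toℕ p))
  lookup-true i m (true ∷ bs) (suc p) e with lookup-true (suc i) 0 bs p e
  ... | x , eq = x , trans (cong (ε i m) eq) (shift-true i m (toℕ p))

  lookup-false : ∀ i m (bs : Vec Bool N) p → lookup bs p ≡ false →
                 ∀ x → cut i m bs x ≢ i + (suc m + toℕ p)
  lookup-false i m (false ∷ bs) zero _ x eq with x ≤? i
  ... | yes x≤i = <⇒≢ (≤-<-trans x≤i (subst (i <_) (sym (+-suc i (m + 0))) (s≤s (m≤m+n i (m + 0)))))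
                    (trans (sym (cut-fix i (suc m) bs x≤i)) eq)
  ... | no  x≰i = <⇒≢ (<-≤-trans (+-monoʳ-< i (s≤s (s≤s (≤-reflexive (+-identityʳ m)))))
                    (≤-trans (cut-next i (suc m) bs) mono≤)) (sym eq)
    where
    mono≤ : cut i (suc m) bs (suc i) ≤ cut i (suc m) bs x
    mono≤ with m≤n⇒m<n∨m≡n (≰⇒> x≰i)
    ... | inj₁ lt   = <⇒≤ (cut-mono i (suc m) bs lt)
    ... | inj₂ refl = ≤-refl
  lookup-false i m (false ∷ bs) (suc p) e x eq =
    lookup-false i (suc m) bs p e x (trans eq (sym (shift-false i m (toℕ p))))
  lookup-false i m (true ∷ bs) (suc p) e x eq =
    lookup-false (suc i) 0 bs p e x (ε-injective i m (trans eq (sym (shift-true i m (toℕ p)))))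

  cuts-enumerate : (bs : Vec Bool N) → Enumerates (suc N) (size 0 0 bs) (cut 0 0 bs)
  cuts-enumerate bs = record
    { mono  = cut-mono 0 0 bs
    ; first = cut-fix 0 0 bs z≤n
    ; last  = cut-size 0 0 bs
    }

  -- The blocks of a permutation form a block system

  module _ (π : Permutation′ n) where

    private
      R = ord π

      flipped : ∀ {p q q′} → p ≢ q → p ≢ q′ → R p q ≡ R p q′ → R q p ≡ R q′ p
      flipped p≢q p≢q′ e =
        trans (ord-antisym π (p≢q ∘ sym)) (trans (cong not e) (sym (ord-antisym π (p≢q′ ∘ sym))))

    -- Position b lies in both blocks, so an outside position compares with every position of either
    -- block as it does with b.
    module-union : ∀ {a b c d} → a < b → b < c → c < d → d ≤ n →
                   Module n R a c → Module n R b d → Module n R a d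
    module-union {a} {b} {c} {d} a<b b<c c<d d≤n M M′ p<n p′<n {q} q<n p∈ p′∈ q∉ =
      trans (sym (via-b p<n p∈)) (via-b p′<n p′∈)
      where
      via-b : ∀ {p} → p < n → p ∈[ a , d ⟩ → R q b ≡ R q p
      via-b {p} p<n (a≤p , p<d) with p <? c
      ... | yes p<c = M (<-≤-trans b<c (≤-trans (<⇒≤ c<d) d≤n)) p<n q<n (<⇒≤ a<b , b<c) (a≤p , p<c)
                        λ (a≤q , q<c) → q∉ (a≤q , <-trans q<c c<d)
      ... | no  p≮c = M′ (<-≤-trans b<c (≤-trans (<⇒≤ c<d) d≤n)) p<n q<n
                        (≤-refl , <-trans b<c c<d) (≤-trans (<⇒≤ b<c) (≮⇒≥ p≮c) , p<d)
                        λ (b≤q , q<d) → q∉ (≤-trans (<⇒≤ a<b) b≤q , q<d)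

    module-∩ : ∀ {a b c d} → a < b → c < d →
               Module n R a c → Module n R b d → Module n R b c
    module-∩ {a} {b} {c} {d} a<b c<d M M′ p<n p′<n {q} q<n (b≤p , p<c) (b≤p′ , p′<c) q∉
      with q ∈?[ a , c ⟩
    ... | no  q∉ac = M p<n p′<n q<n (≤-trans (<⇒≤ a<b) b≤p , p<c) (≤-trans (<⇒≤ a<b) b≤p′ , p′<c) q∉ac
    ... | yes (_ , q<c) = M′ p<n p′<n q<n (b≤p , <-trans p<c c<d) (b≤p′ , <-trans p′<c c<d)
                            λ (b≤q , _) → q∉ (b≤q , q<c)

    -- The new outside positions q are those of the overlap [b, c⟩. Such a q compares with p < b as
    -- c does, because q and c lie in the block [b, d⟩ and p does not; and c is outside [a, c⟩,
    -- which settles its comparisons. The right difference uses a in place of c.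
    module-∖ˡ : ∀ {a b c d} → b < c → c < d → d ≤ n →
                Module n R a c → Module n R b d → Module n R a b
    module-∖ˡ {a} {b} {c} {d} b<c c<d d≤n M M′ {p} p<n {p′} p′<n {q} q<n (a≤p , p<b) (a≤p′ , p′<b) q∉
      with q ∈?[ a , c ⟩
    ... | no  q∉ac = M p<n p′<n q<n (a≤p , <-trans p<b b<c) (a≤p′ , <-trans p′<b b<c) q∉ac
    ... | yes (a≤q , q<c) = trans (via-c p<n p<b)
            (trans (M p<n p′<n c<n (a≤p , <-trans p<b b<c) (a≤p′ , <-trans p′<b b<c) λ (_ , c<c) → <-irrefl refl c<c)
              (sym (via-c p′<n p′<b)))
      where
      c<n = <-≤-trans c<d d≤n
      b≤q : b ≤ q
      b≤q = ≮⇒≥ λ q<b → q∉ (a≤q , q<b)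
      via-c : ∀ {p} → p < n → p < b → R q p ≡ R c p
      via-c p<n p<b = flipped (<⇒≢ (<-≤-trans p<b b≤q)) (<⇒≢ (<-trans p<b b<c))
        (M′ q<n c<n p<n (b≤q , <-trans q<c c<d) (<⇒≤ b<c , c<d) λ (b≤p , _) → <⇒≱ p<b b≤p)

    module-∖ʳ : ∀ {a b c d} → a < b → b < c → c < d → d ≤ n →
                Module n R a c → Module n R b d → Module n R c d
    module-∖ʳ {a} {b} {c} {d} a<b b<c c<d d≤n M M′ {p} p<n {p′} p′<n {q} q<n (c≤p , p<d) (c≤p′ , p′<d) q∉
      with q ∈?[ b , d ⟩
    ... | no  q∉bd = M′ p<n p′<n q<n (≤-trans (<⇒≤ b<c) c≤p , p<d) (≤-trans (<⇒≤ b<c) c≤p′ , p′<d) q∉bd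
    ... | yes (b≤q , q<d) = trans (via-a p<n c≤p)
            (trans (M′ p<n p′<n a<n (≤-trans (<⇒≤ b<c) c≤p , p<d) (≤-trans (<⇒≤ b<c) c≤p′ , p′<d)
                     λ (b≤a , _) → <⇒≱ a<b b≤a)
              (sym (via-a p′<n c≤p′)))
      where
      a<c = <-trans a<b b<c
      a<n = <-≤-trans (<-trans a<c c<d) d≤n
      q<c : q < c
      q<c = ≰⇒> λ c≤q → q∉ (c≤q , q<d)
      via-a : ∀ {p} → p < n → c ≤ p → R q p ≡ R a p
      via-a p<n c≤p = flipped (≢-sym (<⇒≢ (<-≤-trans q<c c≤p))) (≢-sym (<⇒≢ (<-≤-trans a<c c≤p)))
        (M q<n a<n p<n (≤-trans (<⇒≤ a<b) b≤q , q<c) (≤-refl , a<c) λ (_ , p<c) → <⇒≱ p<c c≤p)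

    isBlockSystem : IsBlockSystem n (blocks n (ord π))
    isBlockSystem = record
      { unit     = λ {a} _ → complete λ {p} _ {p′} _ {q} _ (a≤p , p≤a) (a≤p′ , p′≤a) _ →
          cong (ord π q) (trans (≤-antisym (s≤s⁻¹ p≤a) a≤p) (≤-antisym a≤p′ (s≤s⁻¹ p′≤a)))
      ; whole    = complete λ _ _ q<n _ _ q∉ → contradiction (z≤n , q<n) q∉
      ; crossing = λ a<b b<c c<d d≤n M M′ →
          complete (module-union a<b b<c c<d d≤n (sound M) (sound M′)) ,
          complete (module-∩ a<b c<d (sound M) (sound M′)) ,
          complete (module-∖ˡ b<c c<d d≤n (sound M) (sound M′)) ,
          complete (module-∖ʳ a<b b<c c<d d≤n (sound M) (sound M′))
      }
      where
      sound : ∀ {a b} → blocks n (ord π) a b ≡ true → Module n (ord π) a b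
      sound = blocks-sound n (ord π)
      complete : ∀ {a b} → Module n (ord π) a b → blocks n (ord π) a b ≡ true
      complete = blocks-complete n (ord π)

  -- Simple and monotone permutations

  des-cong : {π ρ : Permutation′ n} → π Perm.≈ ρ → des π ≡ des ρ
  des-cong {zero}          _   = refl
  des-cong {suc m} {π} {ρ} π≈ρ = trans (des-descents π)
    (trans (descents-cong m {ord π} {ord ρ} (λ p → ord-cong π≈ρ (suc p) p)) (sym (des-descents ρ)))

  flip-cong : {π ρ : Permutation′ n} → π Perm.≈ ρ → flip π Perm.≈ flip ρ
  flip-cong {π = π} {ρ} π≈ρ i = begin
    π ⟨$⟩ˡ i                     ≡⟨ Perm.inverseˡ ρ ⟨
    ρ ⟨$⟩ˡ (ρ ⟨$⟩ʳ (π ⟨$⟩ˡ i))   ≡⟨ cong (ρ ⟨$⟩ˡ_) (π≈ρ (π ⟨$⟩ˡ i)) ⟨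
    ρ ⟨$⟩ˡ (π ⟨$⟩ʳ (π ⟨$⟩ˡ i))   ≡⟨ cong (ρ ⟨$⟩ˡ_) (Perm.inverseʳ π) ⟩
    ρ ⟨$⟩ˡ i                     ∎
    where open ≡-Reasoning

  ides-cong : {π ρ : Permutation′ n} → π Perm.≈ ρ → ides π ≡ ides ρ
  ides-cong {π = π} {ρ} π≈ρ = des-cong {π = flip π} {flip ρ} (flip-cong {π = π} {ρ} π≈ρ)

  descents-none : ∀ m {R : Order} → (∀ {p} → p < m → R (suc p) p ≡ false) → descents m R ≡ 0
  descents-none zero    e = refl
  descents-none (suc m) e rewrite e {0} (s≤s z≤n) = descents-none m (e ∘ s≤s)

  descents-all : ∀ m {R : Order} → (∀ {p} → p < m → R (suc p) p ≡ true) → descents m R ≡ m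
  descents-all zero    e = refl
  descents-all (suc m) e rewrite e {0} (s≤s z≤n) = cong suc (descents-all m (e ∘ s≤s))

  ⟦id⟧ : ∀ p → ⟦ Perm.id {n} ⟧ p ≡ p
  ⟦id⟧ {n} p with locate n p
  ... | below i   = ⟦⟧-toℕ Perm.id i
  ... | above n≤p = ⟦⟧-fix Perm.id n≤p

  ⟦reverse⟧ : ∀ {p} → p < n → ⟦ Perm.reverse {n} ⟧ p ≡ n ∸ suc p
  ⟦reverse⟧ {n} {p} p<n with locate n p
  ... | below i   = trans (⟦⟧-toℕ Perm.reverse i) (Fin.opposite-prop i)
  ... | above n≤p = contradiction p<n (≤⇒≯ n≤p)

  ord-id : ∀ p q → ord (Perm.id {n}) p q ≡ does (p <? q)
  ord-id p q = cong₂ (λ a b → does (a <? b)) (⟦id⟧ p) (⟦id⟧ q)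

  ord-reverse : ∀ {p q} → p < n → q < n → ord (Perm.reverse {n}) p q ≡ does (q <? p)
  ord-reverse {n} {p} {q} p<n q<n = trans
    (cong₂ (λ a b → does (a <? b)) (⟦reverse⟧ p<n) (⟦reverse⟧ q<n))
    (does-⇔ (mk⇔ (λ lt → ≰⇒> λ p≤q → <⇒≱ lt (∸-monoʳ-≤ n (s≤s p≤q)))
                  (λ q<p → ∸-monoʳ-< (s≤s q<p) p<n))
      (n ∸ suc p <? n ∸ suc q) (q <? p))

  module _ (m : ℕ) where
    private
      n′ = suc m

    des-id : des (Perm.id {n′}) ≡ 0
    des-id = trans (des-descents (Perm.id {n′})) (descents-none m {ord (Perm.id {n′})} λ {p} _ →
      trans (ord-id {n′} (suc p) p) (dec-false (suc p <? p) (≤⇒≯ (n≤1+n p))))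

    des-reverse : des (Perm.reverse {n′}) ≡ m
    des-reverse = trans (des-descents (Perm.reverse {n′})) (descents-all m {ord (Perm.reverse {n′})} λ {p} p<m →
      trans (ord-reverse {n′} {suc p} {p} (s≤s p<m) (m<n⇒m<1+n p<m)) (dec-true (p <? suc p) (n<1+n p)))

    ides-id : ides (Perm.id {n′}) ≡ 0
    ides-id = trans (des-cong {n′} {flip Perm.id} {Perm.id} (λ _ → refl)) des-id

    ides-reverse : ides (Perm.reverse {n′}) ≡ m
    ides-reverse = trans (des-cong {n′} {flip Perm.reverse} {Perm.reverse} (λ _ → refl)) des-reverse

  isMono-cong : ∀ {k B B′} → (∀ x y → B x y ≡ B′ x y) → IsMono k B → IsMono k B′
  isMono-cong e m y<1+k x<y = trans (sym (e _ _)) (m y<1+k x<y)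

  hasOnlyTrivial-cong : ∀ {k B B′} → (∀ x y → B x y ≡ B′ x y) → HasOnlyTrivial k B → HasOnlyTrivial k B′
  hasOnlyTrivial-cong e m y<1+k x<y = trans (sym (e _ _)) (m y<1+k x<y)

  isMono-id : IsMono n (blocks n (ord (Perm.id {n})))
  isMono-id {n} _ _ = blocks-complete n (ord (Perm.id {n})) (module-cong n (λ {p} {q} _ _ → sym (ord-id p q))
    λ {p} _ {p′} _ {q} _ p∈ p′∈ q∉ → does-⇔ (mk⇔ (before p∈ p′∈ q∉) (before p′∈ p∈ q∉)) (q <? p) (q <? p′))
    where
    before : ∀ {a b p p′ q} → p ∈[ a , b ⟩ → p′ ∈[ a , b ⟩ → ¬ q ∈[ a , b ⟩ → q < p → q < p′
    before (_ , p<b) (a≤p′ , _) q∉ q<p = ≰⇒> λ p′≤q → q∉ (≤-trans a≤p′ p′≤q , <-trans q<p p<b)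

  isMono-reverse : IsMono n (blocks n (ord (Perm.reverse {n})))
  isMono-reverse {n} _ _ = blocks-complete n (ord (Perm.reverse {n})) (module-cong n (λ p<n q<n → sym (ord-reverse p<n q<n))
    λ {p} _ {p′} _ {q} _ p∈ p′∈ q∉ → does-⇔ (mk⇔ (after p∈ p′∈ q∉) (after p′∈ p∈ q∉)) (p <? q) (p′ <? q))
    where
    after : ∀ {a b p p′ q} → p ∈[ a , b ⟩ → p′ ∈[ a , b ⟩ → ¬ q ∈[ a , b ⟩ → p < q → p′ < q
    after (a≤p , _) (_ , p′<b) q∉ p<q = ≰⇒> λ q≤p′ → q∉ (≤-trans a≤p (<⇒≤ p<q) , ≤-<-trans q≤p′ p′<b)

  ord-increasing⇒id : (π : Permutation′ n) → (∀ {p q} → p < q → q < n → ord π p q ≡ true) →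
                      π Perm.≈ Perm.id
  ord-increasing⇒id π inc = ord-determines π Perm.id λ {p} {q} p<n q<n →
    trans (agree p<n q<n) (sym (ord-id p q))
    where
    agree : ∀ {p q} → p < _ → q < _ → ord π p q ≡ does (p <? q)
    agree {p} {q} p<n q<n with <-cmp p q
    ... | tri< lt _ _   = trans (inc lt q<n) (sym (dec-true (p <? q) lt))
    ... | tri≈ _ refl _ = trans (ord-irrefl π p) (sym (dec-false (p <? p) (<-irrefl refl)))
    ... | tri> ≮ ≢ gt   = trans (ord-antisym π ≢) (trans (cong not (inc gt p<n)) (sym (dec-false (p <? q) ≮)))

  ord-decreasing⇒reverse : (π : Permutation′ n) → (∀ {p q} → p < q → q < n → ord π p q ≡ false) →
                           π Perm.≈ Perm.reverse
  ord-decreasing⇒reverse π dec = ord-determines π Perm.reverse λ {p} {q} p<n q<n →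
    trans (agree p<n q<n) (sym (ord-reverse p<n q<n))
    where
    agree : ∀ {p q} → p < _ → q < _ → ord π p q ≡ does (q <? p)
    agree {p} {q} p<n q<n with <-cmp p q
    ... | tri< lt _ ≯   = trans (dec lt q<n) (sym (dec-false (q <? p) ≯))
    ... | tri≈ _ refl _ = trans (ord-irrefl π p) (sym (dec-false (p <? p) (<-irrefl refl)))
    ... | tri> ≮ ≢ gt   = trans (ord-antisym π ≢) (trans (cong not (dec gt p<n)) (sym (dec-true (q <? p) gt)))

  -- Comparing through the blocks [0, q⟩ and [1, n⟩, all pairs of positions are ordered like 0 and 1.
  isMono⇒constant : (π : Permutation′ n) → IsMono n (blocks n (ord π)) →
                    ∀ {p q} → p < q → q < n → ord π p q ≡ ord π 0 1
  isMono⇒constant {n} π mono {p} {q} p<q q<n = begin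
    ord π p q        ≡⟨ ord-antisym π (<⇒≢ p<q) ⟩
    not (ord π q p)  ≡⟨ cong not (blocks-sound n (ord π) (mono (m<n⇒m<1+n q<n) 0<q)
                          p<n 0<n q<n (z≤n , p<q) (z≤n , 0<q) (<-irrefl refl ∘ proj₂)) ⟩
    not (ord π q 0)  ≡⟨ ord-antisym π (<⇒≢ 0<q) ⟨
    ord π 0 q        ≡⟨ blocks-sound n (ord π) (mono (n<1+n n) 1<n)
                          q<n 1<n 0<n (0<q , q<n) (≤-refl , 1<n) (λ ()) ⟩
    ord π 0 1        ∎
    where
    open ≡-Reasoning
    0<q : 0 < q
    0<q = ≤-<-trans z≤n p<q
    1<n : 1 < n
    1<n = ≤-<-trans 0<q q<n
    p<n : p < n
    p<n = <-trans p<q q<n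
    0<n : 0 < n
    0<n = <-trans 0<q q<n

  isMono⇒id⊎reverse : (π : Permutation′ n) → IsMono n (blocks n (ord π)) →
                      π Perm.≈ Perm.id ⊎ π Perm.≈ Perm.reverse
  isMono⇒id⊎reverse π mono with ord π 0 1 | isMono⇒constant π mono
  ... | true  | constant = inj₁ (ord-increasing⇒id π constant)
  ... | false | constant = inj₂ (ord-decreasing⇒reverse π constant)

  id≉reverse : ∀ {k} → 2 ≤ k → ¬ Perm.id {suc k} Perm.≈ Perm.reverse
  id≉reverse (s≤s _) id≈reverse = contradiction (id≈reverse zero) λ ()

  isMono⇒¬hasOnlyTrivial : ∀ {k B} → 3 ≤ k → IsMono k B → ¬ HasOnlyTrivial k B
  isMono⇒¬hasOnlyTrivial {k} 3≤k mono only = contradiction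
    (trans (sym (mono (≤-trans 3≤k (n≤1+n k)) (s≤s z≤n)))
      (trans (only (≤-trans 3≤k (n≤1+n k)) (s≤s z≤n)) (dec-false (trivial? k 0 2) λ
        { (inj₂ (_ , refl)) → contradiction 3≤k λ { (s≤s (s≤s ())) } })))
    λ ()

  -- Blocks as intervals of values, and simplicity

  module _ (f : ℕ → ℕ) {_≼_ : ℕ → ℕ → Set} (total : ∀ x y → x ≼ y ⊎ y ≼ x)
           (≼-trans : ∀ {x y z} → x ≼ y → y ≼ z → x ≼ z) where

    -- Taken with ≤ and with ≥, this yields the two ends of the interval of values of a block.
    extremum : ∀ a d → ∃ λ p → p ∈[ a , suc (a + d) ⟩ × (∀ {p′} → p′ ∈[ a , suc (a + d) ⟩ → f p ≼ f p′)
    extremum a zero = a , (≤-refl , s≤s (m≤m+n a 0)) , λ (a≤p′ , p′<) →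
      subst (λ z → f a ≼ f z) (≤-antisym a≤p′ (subst (_ ≤_) (+-identityʳ a) (s≤s⁻¹ p′<))) (reflexive (f a))
      where
      reflexive : ∀ x → x ≼ x
      reflexive x with total x x
      ... | inj₁ x≼x = x≼x
      ... | inj₂ x≼x = x≼x
    extremum a (suc d) rewrite +-suc a d with extremum a d
    ... | p , (a≤p , p<) , least with total (f p) (f (suc (a + d)))
    ...   | inj₁ ≼new = p , (a≤p , m<n⇒m<1+n p<) , λ {p′} (a≤p′ , p′<) → case (m≤n⇒m<n∨m≡n (s≤s⁻¹ p′<)) of λ
              { (inj₁ lt) → least (a≤p′ , lt) ; (inj₂ refl) → ≼new }
    ...   | inj₂ new≼ = suc (a + d) , (m≤n⇒m≤1+n (m≤m+n a d) , ≤-refl) , λ {p′} (a≤p′ , p′<) →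
            case (m≤n⇒m<n∨m≡n (s≤s⁻¹ p′<)) of λ
              { (inj₁ lt)   → ≼-trans new≼ (least (a≤p′ , lt))
              ; (inj₂ refl) → case total (f p′) (f p′) of λ { (inj₁ r) → r ; (inj₂ r) → r } }

  module _ (π : Permutation′ n) where

    private
      fromPosition : ∀ {p} → p < n → ∃ λ (k : Fin n) → toℕ k ≡ p
      fromPosition p<n = fromℕ< p<n , Fin.toℕ-fromℕ< p<n

    -- The value at q misses the interval of values of the block, so it lies below all of them or
    -- above all of them.
    isBlock⇒module : ∀ {i j} → IsBlock π i j → Module n (ord π) (toℕ i) (suc (toℕ j))
    isBlock⇒module {i} {j} (i≤j , lo , hi , occupies) p<n p′<n q<n p∈ p′∈ q∉
      with fromPosition p<n | fromPosition p′<n | fromPosition q<n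
    ... | p , refl | p′ , refl | q , refl =
      does-⇔ (mk⇔ (lower p∈ p′∈) (lower p′∈ p∈)) (⟦ π ⟧ (toℕ q) <? ⟦ π ⟧ (toℕ p)) (⟦ π ⟧ (toℕ q) <? ⟦ π ⟧ (toℕ p′))
      where
      value : ∀ {k} → toℕ k ∈[ toℕ i , suc (toℕ j) ⟩ → lo Fin.≤ π ⟨$⟩ʳ k × π ⟨$⟩ʳ k Fin.≤ hi
      value {k} (i≤k , k≤j) = Equivalence.from (occupies (π ⟨$⟩ʳ k)) (k , i≤k , s≤s⁻¹ k≤j , refl)

      q-misses : ¬ (lo Fin.≤ π ⟨$⟩ʳ q × π ⟨$⟩ʳ q Fin.≤ hi)
      q-misses v∈ with Equivalence.to (occupies (π ⟨$⟩ʳ q)) v∈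
      ... | k , i≤k , k≤j , πk≡πq = q∉ (subst (λ z → toℕ z ∈[ toℕ i , suc (toℕ j) ⟩)
        (trans (sym (Perm.inverseˡ π)) (trans (cong (π ⟨$⟩ˡ_) πk≡πq) (Perm.inverseˡ π))) (i≤k , s≤s k≤j))

      lower : ∀ {p p′} → toℕ p ∈[ toℕ i , suc (toℕ j) ⟩ → toℕ p′ ∈[ toℕ i , suc (toℕ j) ⟩ →
              ⟦ π ⟧ (toℕ q) < ⟦ π ⟧ (toℕ p) → ⟦ π ⟧ (toℕ q) < ⟦ π ⟧ (toℕ p′)
      lower {p} {p′} p∈ p′∈ lt = subst₂ _<_ (sym (⟦⟧-toℕ π q)) (sym (⟦⟧-toℕ π p′))
        (≰⇒> λ πp′≤πq → q-misses (≤-trans (proj₁ (value p′∈)) πp′≤πq ,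
          ≤-trans (<⇒≤ (subst₂ _<_ (⟦⟧-toℕ π q) (⟦⟧-toℕ π p) lt)) (proj₂ (value p∈))))

    -- Let a and b hold the least and the greatest value of the block. A value between these that is
    -- taken at an outside position k would be below the value at b, hence, by the module property,
    -- also below the value at a.
    module⇒isBlock : ∀ {i j : Fin n} → i Fin.≤ j → Module n (ord π) (toℕ i) (suc (toℕ j)) → IsBlock π i j
    module⇒isBlock {i} {j} i≤j M with m≤n⇒∃[o]m+o≡n i≤j
    ... | d , i+d≡j with extremum ⟦ π ⟧ ≤-total ≤-trans (toℕ i) d
                       | extremum ⟦ π ⟧ {_≥_} (λ x y → ≤-total y x) (λ x≥y y≥z → ≤-trans y≥z x≥y) (toℕ i) d
    ... | a , a∈ , least | b , b∈ , greatest rewrite i+d≡j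
      with fromPosition (≤-trans (proj₂ a∈) (Fin.toℕ<n j)) | fromPosition (≤-trans (proj₂ b∈) (Fin.toℕ<n j))
    ... | a , refl | b , refl = i≤j , π ⟨$⟩ʳ a , π ⟨$⟩ʳ b , λ v → mk⇔ (to v) (λ { (k , i≤k , k≤j , refl) →
        subst₂ _≤_ (⟦⟧-toℕ π a) (⟦⟧-toℕ π k) (least (i≤k , s≤s k≤j)) ,
        subst₂ _≤_ (⟦⟧-toℕ π k) (⟦⟧-toℕ π b) (greatest (i≤k , s≤s k≤j)) })
      where
      to : ∀ v → π ⟨$⟩ʳ a Fin.≤ v × v Fin.≤ π ⟨$⟩ʳ b → ∃ λ k → i Fin.≤ k × k Fin.≤ j × π ⟨$⟩ʳ k ≡ v
      to v (πa≤v , v≤πb) with toℕ (π ⟨$⟩ˡ v) ∈?[ toℕ i , suc (toℕ j) ⟩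
      ... | yes (i≤k , k≤j) = π ⟨$⟩ˡ v , i≤k , s≤s⁻¹ k≤j , Perm.inverseʳ π
      ... | no  k∉ = contradiction below-a λ lt → <⇒≱ lt (subst₂ _≤_ (sym (⟦⟧-toℕ π a)) (sym value-k) πa≤v)
        where
        k = π ⟨$⟩ˡ v
        value-k : ⟦ π ⟧ (toℕ k) ≡ toℕ v
        value-k = trans (⟦⟧-toℕ π k) (cong toℕ (Perm.inverseʳ π))
        k≢b : toℕ k ≢ toℕ b
        k≢b e = k∉ (subst (_∈[ toℕ i , suc (toℕ j) ⟩) (sym e) b∈)
        below-b : ⟦ π ⟧ (toℕ k) < ⟦ π ⟧ (toℕ b)
        below-b = ≤∧≢⇒< (subst₂ _≤_ (sym value-k) (sym (⟦⟧-toℕ π b)) v≤πb) (k≢b ∘ ⟦⟧-injective π)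
        below-a : ⟦ π ⟧ (toℕ k) < ⟦ π ⟧ (toℕ a)
        below-a = does-true⁻ (⟦ π ⟧ (toℕ k) <? ⟦ π ⟧ (toℕ a)) (trans
          (M (Fin.toℕ<n a) (Fin.toℕ<n b) (Fin.toℕ<n k) a∈ b∈ k∉)
          (dec-true (⟦ π ⟧ (toℕ k) <? ⟦ π ⟧ (toℕ b)) below-b))

    isSimple⇒hasOnlyTrivial : IsSimple π → HasOnlyTrivial n (blocks n (ord π))
    isSimple⇒hasOnlyTrivial simple {suc y} y<1+n {x} x<y = decide (trivial? n x (suc y))
      where
      open IsBlockSystem (isBlockSystem π)
      decide : (d : Dec (suc y ≡ suc x ⊎ (x ≡ 0 × suc y ≡ n))) → blocks n (ord π) x (suc y) ≡ does d
      decide (yes (inj₁ refl))          = unit (s≤s⁻¹ y<1+n)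
      decide (yes (inj₂ (refl , refl))) = whole
      decide (no nontrivial) = trans (blocks-does n (ord π) x (suc y)) (dec-false (module? n (ord π) x (suc y)) λ M →
        let i , i≡x = fromPosition (<-≤-trans x<y (s≤s⁻¹ y<1+n))
            j , j≡y = fromPosition (s≤s⁻¹ y<1+n)
        in simple (i , j ,
          module⇒isBlock (subst₂ _≤_ (sym i≡x) (sym j≡y) (s≤s⁻¹ x<y))
            (subst₂ (λ a b → Module n (ord π) a (suc b)) (sym i≡x) (sym j≡y) M) ,
          λ { (inj₁ i≡j)         → nontrivial (inj₁ (cong suc (trans (sym j≡y) (trans (cong toℕ (sym i≡j)) i≡x))))
            ; (inj₂ (i≡0 , j≡n)) → nontrivial (inj₂ (trans (sym i≡x) i≡0 , trans (cong suc (sym j≡y)) j≡n)) }))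

    hasOnlyTrivial⇒isSimple : HasOnlyTrivial n (blocks n (ord π)) → IsSimple π
    hasOnlyTrivial⇒isSimple only (i , j , block@(i≤j , _) , nontrivial) with
      does-true⁻ (trivial? n (toℕ i) (suc (toℕ j))) (trans (sym (only (s≤s (Fin.toℕ<n j)) (s≤s i≤j)))
        (blocks-complete n (ord π) (isBlock⇒module block)))
    ... | inj₁ eq = nontrivial (inj₁ (Fin.toℕ-injective (sym (suc-injective eq))))
    ... | inj₂ eq = nontrivial (inj₂ eq)

open Combinatorics

-- Finite sums over lists

module Sums {c ℓ} (R : CommutativeRing c ℓ) where

  open CommutativeRing R hiding (zero) renaming (refl to ≈-refl)
  open SetoidReasoning setoid
  open CommutativeSemigroupProperties +-commutativeSemigroup using (interchange)

  private
    variable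
      a b p : Level
      A : Set a
      B : Set b

  ∑ : List A → (A → Carrier) → Carrier
  ∑ xs w = foldr _+_ 0# (map w xs)

  [_]? : Bool → Carrier
  [ true  ]? = 1#
  [ false ]? = 0#

  ∑-cong : (xs : List A) {v w : A → Carrier} → (∀ x → v x ≈ w x) → ∑ xs v ≈ ∑ xs w
  ∑-cong []       e = ≈-refl
  ∑-cong (x ∷ xs) e = +-cong (e x) (∑-cong xs e)

  ∑-zero : (xs : List A) → ∑ xs (λ _ → 0#) ≈ 0#
  ∑-zero []       = ≈-refl
  ∑-zero (x ∷ xs) = trans (+-identityˡ _) (∑-zero xs)

  ∑-+ : (xs : List A) (v w : A → Carrier) → ∑ xs (λ x → v x + w x) ≈ ∑ xs v + ∑ xs w
  ∑-+ []       v w = sym (+-identityˡ 0#)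
  ∑-+ (x ∷ xs) v w = trans (+-congˡ (∑-+ xs v w)) (interchange _ _ _ _)

  ∑-*ˡ : (xs : List A) (y : Carrier) (w : A → Carrier) → ∑ xs (λ x → y * w x) ≈ y * ∑ xs w
  ∑-*ˡ []       y w = sym (zeroʳ y)
  ∑-*ˡ (x ∷ xs) y w = trans (+-congˡ (∑-*ˡ xs y w)) (sym (distribˡ _ _ _))

  ∑-*ʳ : (xs : List A) (w : A → Carrier) (y : Carrier) → ∑ xs (λ x → w x * y) ≈ ∑ xs w * y
  ∑-*ʳ xs w y = trans (∑-cong xs (λ x → *-comm (w x) y)) (trans (∑-*ˡ xs y w) (*-comm y _))

  ∑-filter : ∀ {P : A → Set p} (P? : Decidable P) xs (w : A → Carrier) →
             ∑ (filter P? xs) w ≈ ∑ xs (λ x → [ does (P? x) ]? * w x)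
  ∑-filter P? []       w = ≈-refl
  ∑-filter P? (x ∷ xs) w with does (P? x)
  ... | true  = +-cong (sym (*-identityˡ _)) (∑-filter P? xs w)
  ... | false = trans (∑-filter P? xs w) (sym (trans (+-congʳ (zeroˡ _)) (+-identityˡ _)))

  ∑-++ : (xs ys : List A) (w : A → Carrier) → ∑ (xs ++ ys) w ≈ ∑ xs w + ∑ ys w
  ∑-++ []       ys w = sym (+-identityˡ _)
  ∑-++ (x ∷ xs) ys w = trans (+-congˡ (∑-++ xs ys w)) (sym (+-assoc _ _ _))

  ∑-map : (f : A → B) (xs : List A) (w : B → Carrier) → ∑ (map f xs) w ≈ ∑ xs (w ∘ f)
  ∑-map f []       w = ≈-refl
  ∑-map f (x ∷ xs) w = +-congˡ (∑-map f xs w)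

  ∑-cartesianProductWith : ∀ {d} {D : Set d} (f : A → B → D) xs ys (w : D → Carrier) →
    ∑ (cartesianProductWith f xs ys) w ≈ ∑ xs (λ x → ∑ ys (λ y → w (f x y)))
  ∑-cartesianProductWith f []       ys w = ≈-refl
  ∑-cartesianProductWith f (x ∷ xs) ys w = trans (∑-++ (map (f x) ys) _ w)
    (+-cong (∑-map (f x) ys w) (∑-cartesianProductWith f xs ys w))

  module _ {a r} (S : Setoid a r) where

    private
      module S = Setoid S
    open SetoidMembership S using (_∈_)
    open SetoidUnique S using (Unique)

    private
      ∑-remove : ∀ {w : S.Carrier → Carrier} → (∀ {x y} → x S.≈ y → w x ≈ w y) →
                 ∀ {x} ys (p : x ∈ ys) → ∑ ys w ≈ w x + ∑ (ys ─ p) w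
      ∑-remove cong (y ∷ ys) (here x≈y) = +-congʳ (cong (S.sym x≈y))
      ∑-remove cong (y ∷ ys) (there p)  = trans (+-congˡ (∑-remove cong ys p))
        (trans (sym (+-assoc _ _ _)) (trans (+-congʳ (+-comm _ _)) (+-assoc _ _ _)))

      ∈-remove⁺ : ∀ {x z} ys (p : x ∈ ys) → z ∈ ys → ¬ z S.≈ x → z ∈ (ys ─ p)
      ∈-remove⁺ (y ∷ ys) (here x≈y) (here z≈y)  z≉x = contradiction (S.trans z≈y (S.sym x≈y)) z≉x
      ∈-remove⁺ (y ∷ ys) (here x≈y) (there z∈)  z≉x = z∈
      ∈-remove⁺ (y ∷ ys) (there p)  (here z≈y)  z≉x = here z≈y
      ∈-remove⁺ (y ∷ ys) (there p)  (there z∈)  z≉x = there (∈-remove⁺ ys p z∈ z≉x)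

      ∈-remove⁻ : ∀ {x z} ys (p : x ∈ ys) → z ∈ (ys ─ p) → z ∈ ys
      ∈-remove⁻ (y ∷ ys) (here _)  z∈         = there z∈
      ∈-remove⁻ (y ∷ ys) (there p) (here z≈y) = here z≈y
      ∈-remove⁻ (y ∷ ys) (there p) (there z∈) = there (∈-remove⁻ ys p z∈)

      All-remove : ∀ {q} {Q : S.Carrier → Set q} {x} ys (p : x ∈ ys) → All Q ys → All Q (ys ─ p)
      All-remove (y ∷ ys) (here _)  (_ ∷ qs) = qs
      All-remove (y ∷ ys) (there p) (q ∷ qs) = q ∷ All-remove ys p qs

      unique-remove : ∀ {x} ys (p : x ∈ ys) → Unique ys → Unique (ys ─ p)
      unique-remove (y ∷ ys) (here _)  (_ ∷ u)  = u
      unique-remove (y ∷ ys) (there p) (y∉ ∷ u) = All-remove ys p y∉ ∷ unique-remove ys p u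

      remove-≉ : ∀ {x z} ys (p : x ∈ ys) → Unique ys → z ∈ (ys ─ p) → ¬ z S.≈ x
      remove-≉ (y ∷ ys) (here x≈y) (y∉ ∷ _) z∈ z≈x =
        Membership.All[≉]⇒∉ S y∉
          (Membership.∈-resp-≈ S (S.trans z≈x x≈y) z∈)
      remove-≉ (y ∷ ys) (there p) (y∉ ∷ _) (here z≈y) z≈x =
        Membership.All[≉]⇒∉ S y∉
          (Membership.∈-resp-≈ S (S.trans (S.sym z≈x) z≈y) p)
      remove-≉ (y ∷ ys) (there p) (_ ∷ u) (there z∈) z≈x = remove-≉ ys p u z∈ z≈x

    -- This is the change of summation index along a bijection. The lists agree only up to order and
    -- up to the equality of the setoid, so each head of one list is located in the other and
    -- removed there.
    ∑-same : ∀ {w : S.Carrier → Carrier} → (∀ {x y} → x S.≈ y → w x ≈ w y) →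
             ∀ xs ys → Unique xs → Unique ys →
             (∀ {z} → z ∈ xs → z ∈ ys) → (∀ {z} → z ∈ ys → z ∈ xs) → ∑ xs w ≈ ∑ ys w
    ∑-same cong []       []       _ _ _ _ = ≈-refl
    ∑-same cong []       (y ∷ ys) _ _ _ ⊇ with () ← ⊇ (here S.refl)
    ∑-same {w} cong (x ∷ xs) ys (x∉ ∷ u) u′ ⊆ ⊇ = begin
      w x + ∑ xs w         ≈⟨ +-congˡ (∑-same cong xs (ys ─ x∈ys) u (unique-remove ys x∈ys u′)
                               (λ {z} z∈ → ∈-remove⁺ ys x∈ys (⊆ (there z∈)) λ z≈x →
                                 Membership.All[≉]⇒∉ S x∉ (Membership.∈-resp-≈ S z≈x z∈))
                               (λ {z} z∈ → case ⊇ (∈-remove⁻ ys x∈ys z∈) of λ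
                                 { (here z≈x)  → contradiction z≈x (remove-≉ ys x∈ys u′ z∈)
                                 ; (there z∈xs) → z∈xs })) ⟩
      w x + ∑ (ys ─ x∈ys) w   ≈⟨ ∑-remove cong ys x∈ys ⟨
      ∑ ys w               ∎
      where x∈ys = ⊆ (here S.refl)

lookup-ext : ∀ {a N} {A : Set a} (xs ys : Vec A N) → (∀ p → lookup xs p ≡ lookup ys p) → xs ≡ ys
lookup-ext []       []       e = refl
lookup-ext (x ∷ xs) (y ∷ ys) e = ≡.cong₂ _∷_ (e zero) (lookup-ext xs ys (e ∘ suc))

-- The function μ and the vanishing of its sum over partitions

module Möbius {c ℓ} (R : CommutativeRing c ℓ) where

  open CommutativeRing R hiding (zero) renaming (refl to ≈-refl)
  open RingProperties ring using (-1*x≈-x; -0#≈0#; -‿distribˡ-*)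
  open Exponentiation semiring using (_^_)
  open SetoidReasoning setoid
  open CommutativeSemigroupProperties +-commutativeSemigroup using (interchange)
  open Sums R

  opaque
    -- The order of the tests matters at length 1, where a block system passes both and the value
    -- has to be 1; at length 2 both tests give -1. The value 0 at length 0 makes the constant term
    -- of the left inverse vanish.
    μ : ℕ → Blocks → Carrier
    μ zero      B = 0#
    μ (suc k) B = if does (isMono? (suc k) B) then (- 1#) ^ k
                  else if does (hasOnlyTrivial? (suc k) B) then - 1# else 0#

    μ-mono : ∀ {k B} → IsMono (suc k) B → μ (suc k) B ≈ (- 1#) ^ k
    μ-mono {k} {B} m rewrite dec-true (isMono? (suc k) B) m = ≈-refl

    μ-trivial : ∀ {k B} → ¬ IsMono (suc k) B → HasOnlyTrivial (suc k) B → μ (suc k) B ≈ - 1#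
    μ-trivial {k} {B} ¬m o
      rewrite dec-false (isMono? (suc k) B) ¬m | dec-true (hasOnlyTrivial? (suc k) B) o = ≈-refl

    μ₀ : ∀ B → μ 0 B ≈ 0#
    μ₀ B = ≈-refl

    μ-zero : ∀ {k B} → ¬ IsMono k B → ¬ HasOnlyTrivial k B → μ k B ≈ 0#
    μ-zero {zero}  ¬m ¬o = ≈-refl
    μ-zero {suc k} {B} ¬m ¬o
      rewrite dec-false (isMono? (suc k) B) ¬m | dec-false (hasOnlyTrivial? (suc k) B) ¬o = ≈-refl

    μ-cong : ∀ k {B B′} → (∀ x y → B x y ≡ B′ x y) → μ k B ≈ μ k B′
    μ-cong zero    e = ≈-refl
    μ-cong (suc k) {B} {B′} e
      rewrite does-⇔
                (mk⇔ (isMono-cong {suc k} {B} {B′} e)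
                     (isMono-cong {suc k} {B′} {B} λ x y → ≡.sym (e x y)))
                (isMono? (suc k) B) (isMono? (suc k) B′)
            | does-⇔
                (mk⇔ (hasOnlyTrivial-cong {suc k} {B} {B′} e)
                     (hasOnlyTrivial-cong {suc k} {B′} {B} λ x y → ≡.sym (e x y)))
                (hasOnlyTrivial? (suc k) B) (hasOnlyTrivial? (suc k) B′) = ≈-refl

  -- Both conditions under which `μ` can be nonzero make each single part a block. So the sum may
  -- run over all partitions into consecutive parts, whether or not the parts are blocks.
  μ-no-unit : ∀ {k B x} → x < k → B x (suc x) ≡ false → μ k B ≈ 0#
  μ-no-unit {k} {B} {x} x<k e = μ-zero
    (λ m → contradiction (≡.trans (≡.sym e) (m (s≤s x<k) (ℕ.n<1+n x))) λ ())
    (λ o → contradiction (≡.trans (≡.sym e) (≡.trans (o (s≤s x<k) (ℕ.n<1+n x))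
      (dec-true (trivial? k x (suc x)) (inj₁ refl)))) λ ())

  bitSum : ∀ N → (Vec Bool N → Carrier) → Carrier
  bitSum zero    w = w []
  bitSum (suc N) w = bitSum N (w ∘ (false ∷_)) + bitSum N (w ∘ (true ∷_))

  bitSum-cong : ∀ N {v w : Vec Bool N → Carrier} → (∀ bs → v bs ≈ w bs) → bitSum N v ≈ bitSum N w
  bitSum-cong zero    e = e []
  bitSum-cong (suc N) e = +-cong (bitSum-cong N (e ∘ (false ∷_))) (bitSum-cong N (e ∘ (true ∷_)))

  bitSum-*ˡ : ∀ N y (w : Vec Bool N → Carrier) → bitSum N (λ bs → y * w bs) ≈ y * bitSum N w
  bitSum-*ˡ zero    y w = ≈-refl
  bitSum-*ˡ (suc N) y w =
    trans (+-cong (bitSum-*ˡ N y _) (bitSum-*ˡ N y _)) (sym (distribˡ _ _ _))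

  bitSum-+ : ∀ N (v w : Vec Bool N → Carrier) → bitSum N (λ bs → v bs + w bs) ≈ bitSum N v + bitSum N w
  bitSum-+ zero    v w = ≈-refl
  bitSum-+ (suc N) v w = trans (+-cong (bitSum-+ N _ _) (bitSum-+ N _ _)) (interchange _ _ _ _)

  -- μ of the quotient if all parts are blocks, and 0 otherwise.
  value : ∀ {N} → ℕ → ℕ → Vec Bool N → Blocks → Carrier
  value i m []           B = [ B i (i ℕ.+ suc m) ]? * μ (suc i) (λ x y → B (ε i m x) (ε i m y))
  value i m (false ∷ bs) B = value i (suc m) bs B
  value i m (true  ∷ bs) B =
    [ B i (i ℕ.+ suc m) ]? * value (suc i) 0 bs (λ x y → B (ε i m x) (ε i m y))

  value-cong : ∀ {N} i m (bs : Vec Bool N) {B B′} → (∀ x y → B x y ≡ B′ x y) →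
               value i m bs B ≈ value i m bs B′
  value-cong i m []           e =
    *-cong (reflexive (≡.cong [_]? (e _ _))) (μ-cong (suc i) λ x y → e _ _)
  value-cong i m (false ∷ bs) e = value-cong i (suc m) bs e
  value-cong i m (true  ∷ bs) e =
    *-cong (reflexive (≡.cong [_]? (e _ _))) (value-cong (suc i) 0 bs λ x y → e _ _)

  i<size : ∀ {N} i m (bs : Vec Bool N) → i < size i m bs
  i<size i m []           = ℕ.n<1+n i
  i<size i m (false ∷ bs) = i<size i (suc m) bs
  i<size i m (true  ∷ bs) = ℕ.<-trans (ℕ.n<1+n i) (i<size (suc i) 0 bs)

  -- If some part is not a block, then `μ` of the quotient is already 0, in agreement with the
  -- bracket in `value`. The recursive form suits the summation over permutations, the form with `μ`
  -- the summation over partitions.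
  value≈μ : ∀ {N} i m (bs : Vec Bool N) B →
            value i m bs B ≈ μ (size i m bs) (λ x y → B (cut i m bs x) (cut i m bs y))
  value≈μ i m [] B with B i (i ℕ.+ suc m) in b
  ... | true  = *-identityˡ _
  ... | false = trans (zeroˡ _) (sym (μ-no-unit {x = i} (ℕ.n<1+n i)
        (≡.trans (≡.cong₂ B (ε-fix i m ℕ.≤-refl) (ε-next i m)) b)))
  value≈μ i m (false ∷ bs) B = value≈μ i (suc m) bs B
  value≈μ i m (true ∷ bs) B with B i (i ℕ.+ suc m) in b
  ... | true  = trans (*-identityˡ _) (value≈μ (suc i) 0 bs _)
  ... | false = trans (zeroˡ _) (sym (μ-no-unit {x = i} (i<size i m (true ∷ bs))
        (≡.trans (≡.cong₂ B (cut-fix i m (true ∷ bs) ℕ.≤-refl)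
          (≡.trans (≡.cong (ε i m) (cut-fix (suc i) 0 bs ℕ.≤-refl)) (ε-next i m))) b)))

  -- With Γ marking the splits, this is (-1)^(number of cuts) if every cut is a split, and 0
  -- otherwise.
  splitWeight : ∀ {N} → (ℕ → Bool) → Vec Bool N → Carrier
  splitWeight Γ []           = 1#
  splitWeight Γ (false ∷ bs) = splitWeight (Γ ∘ suc) bs
  splitWeight Γ (true  ∷ bs) = - [ Γ 0 ]? * splitWeight (Γ ∘ suc) bs

  -- The sum factors into the terms 1 - [Γ p] over the boundaries p, and a split makes one of them
  -- 0.
  splitWeight-sum : ∀ N Γ {p} → p < N → Γ p ≡ true → bitSum N (splitWeight Γ) ≈ 0#
  splitWeight-sum (suc N) Γ {zero} _ Γ₀ rewrite Γ₀ = begin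
    x + bitSum N (λ bs → - 1# * splitWeight (Γ ∘ suc) bs) ≈⟨ +-congˡ (trans (bitSum-*ˡ N _ _) (-1*x≈-x x)) ⟩
    x + - x                                               ≈⟨ -‿inverseʳ x ⟩
    0#                                                    ∎
    where x = bitSum N (splitWeight (Γ ∘ suc))
  splitWeight-sum (suc N) Γ {suc p} (s≤s p<N) Γₚ = begin
    x + bitSum N (λ bs → - [ Γ 0 ]? * splitWeight (Γ ∘ suc) bs) 
      ≈⟨ +-cong ih (trans (bitSum-*ˡ N _ _) (trans (*-congˡ ih) (zeroʳ _))) ⟩
    0# + 0#
      ≈⟨ +-identityˡ 0# ⟩
    0# ∎
    where
    x = bitSum N (splitWeight (Γ ∘ suc))
    ih = splitWeight-sum N (Γ ∘ suc) p<N Γₚ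

  splitWeight-zero : ∀ {N} Γ (bs : Vec Bool N) p → lookup bs p ≡ true → Γ (toℕ p) ≡ false →
                     splitWeight Γ bs ≈ 0#
  splitWeight-zero Γ (true ∷ bs) zero _ e rewrite e = trans (*-congʳ -0#≈0#) (zeroˡ _)
  splitWeight-zero Γ (false ∷ bs) (suc p) l e = splitWeight-zero (Γ ∘ suc) bs p l e
  splitWeight-zero Γ (true ∷ bs)  (suc p) l e =
    trans (*-congˡ (splitWeight-zero (Γ ∘ suc) bs p l e)) (zeroʳ _)

  splitWeight-sign : ∀ {N} Γ i m (bs : Vec Bool N) →
    (∀ p → lookup bs p ≡ true → Γ (toℕ p) ≡ true) →
    ∃ λ r → size i m bs ≡ suc (r ℕ.+ i) × splitWeight Γ bs ≈ (- 1#) ^ r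
  splitWeight-sign Γ i m []           h = 0 , refl , ≈-refl
  splitWeight-sign Γ i m (false ∷ bs) h = splitWeight-sign (Γ ∘ suc) i (suc m) bs (h ∘ suc)
  splitWeight-sign Γ i m (true ∷ bs)  h rewrite h zero refl
    with splitWeight-sign (Γ ∘ suc) (suc i) 0 bs (h ∘ suc)
  ... | r , size≡ , w = suc r , ≡.trans size≡ (≡.cong suc (ℕ.+-suc r i)) , *-congˡ w

  δ : ∀ {N} → Vec Bool N → Vec Bool N → Carrier
  δ []       []       = 1#
  δ (x ∷ xs) (y ∷ ys) = [ does (x Bool.≟ y) ]? * δ xs ys

  δ-refl : ∀ {N} (xs : Vec Bool N) → δ xs xs ≈ 1#
  δ-refl []           = ≈-refl
  δ-refl (true  ∷ xs) = trans (*-identityˡ _) (δ-refl xs)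
  δ-refl (false ∷ xs) = trans (*-identityˡ _) (δ-refl xs)

  δ-≢ : ∀ {N} {xs ys : Vec Bool N} → xs ≢ ys → δ xs ys ≈ 0#
  δ-≢ {xs = []}     {[]}     ≢ = contradiction refl ≢
  δ-≢ {xs = x ∷ xs} {y ∷ ys} ≢ with x Bool.≟ y
  ... | yes refl = trans (*-congˡ (δ-≢ (≢ ∘ ≡.cong (x ∷_)))) (zeroʳ _)
  ... | no  _    = zeroˡ _

  δ-sum : ∀ {N} (xs : Vec Bool N) → bitSum N (δ xs) ≈ 1#
  δ-sum []           = ≈-refl
  δ-sum {suc N} (false ∷ xs) = trans
    (+-cong (trans (bitSum-*ˡ N 1# (δ xs)) (trans (*-identityˡ _) (δ-sum xs)))
            (trans (bitSum-*ˡ N 0# (δ xs)) (zeroˡ _)))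
    (+-identityʳ 1#)
  δ-sum {suc N} (true ∷ xs) = trans
    (+-cong (trans (bitSum-*ˡ N 0# (δ xs)) (zeroˡ _))
            (trans (bitSum-*ˡ N 1# (δ xs)) (trans (*-identityˡ _) (δ-sum xs))))
    (+-identityˡ 1#)

  size-none : ∀ {N} i m → size i m (replicate N false) ≡ suc i
  size-none {zero}  i m = refl
  size-none {suc N} i m = size-none {N} i (suc m)

  module _ {N : ℕ} {B : Blocks} (S : IsBlockSystem (suc N) B) where

    private
      n : ℕ
      n = suc N

      toPosition : ∀ {c} → 0 < c → c < n → ∃ λ (p : Fin N) → suc (toℕ p) ≡ c
      toPosition {suc c} _ c<n = fromℕ< (s≤s⁻¹ c<n) , ≡.cong suc (Fin.toℕ-fromℕ< (s≤s⁻¹ c<n))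

    module _ (bs : Vec Bool N) where

      open Quotient S (cuts-enumerate bs)
      private
        k = size 0 0 bs

      inner : ∀ p {x} → cut 0 0 bs x ≡ suc (toℕ p) → 0 < x × x < k
      inner p e = reflects-< (≡.subst₂ _<_ (≡.sym (cut-fix 0 0 bs z≤n)) (≡.sym e) (s≤s z≤n)) ,
        reflects-< (≡.subst₂ _<_ (≡.sym e) (≡.sym (cut-size 0 0 bs)) (s≤s (Fin.toℕ<n p)))

      lookup-cut : ∀ p {x} → cut 0 0 bs x ≡ suc (toℕ p) → lookup bs p ≡ true
      lookup-cut p {x} e with lookup bs p in l
      ... | true  = refl
      ... | false = contradiction e (lookup-false 0 0 bs p l x)

      -- Once there is a split, a quotient with only trivial blocks is monotone as well, so `μ`
      -- vanishes unless the quotient is monotone, which means that every cut is a split.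
      μ-split : ∀ {c} → c < n → IsSplit n B c →
                μ k B/ ≈ splitWeight (λ p → does (isSplit? n B (suc p))) bs
      μ-split c<n split with Fin.any? (λ p →
        (lookup bs p Bool.≟ true) ×-dec (does (isSplit? n B (suc (toℕ p))) Bool.≟ false))
      ... | yes (p , l , ¬s) = trans (μ-zero ¬mono λ o → ¬mono (split⇒isMono o c<n split))
              (sym (splitWeight-zero _ bs p l ¬s))
        where
        ¬mono : ¬ IsMono k B/
        ¬mono m with lookup-true 0 0 bs p l
        ... | x , e with inner p e
        ... | 0<x , x<k = contradiction (≡.trans (≡.sym ¬s) (dec-true (isSplit? n B (suc (toℕ p)))
              (≡.subst (IsSplit n B) e (isMono⇒splits m 0<x x<k)))) λ ()
      ... | no all with splitWeight-sign (λ p → does (isSplit? n B (suc p))) 0 0 bs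
              (λ p l → Bool.¬-not λ ¬s → all (p , l , ¬s))
      ...   | r , size≡ , w rewrite size≡ | ℕ.+-identityʳ r = trans (μ-mono {r} mono) (sym w)
        where
        mono : IsMono (suc r) B/
        mono = ≡.subst (λ z → IsMono z B/) size≡
          (splits⇒isMono λ {x} 0<x x<k → case toPosition (0< 0<x) (<n x<k) of λ where
            (p , e) → ≡.subst (IsSplit n B) e
              (does-true⁻ (isSplit? n B (suc (toℕ p)))
                (Bool.¬-not λ ¬s → all (p , lookup-cut p (≡.sym e) , ¬s))))

      μ-onlyTrivial : 2 ≤ k → ¬ IsMono k B/ → HasOnlyTrivial k B/ → μ k B/ ≈ - 1#
      μ-onlyTrivial 2≤k ¬m o with size 0 0 bs
      μ-onlyTrivial (s≤s _) ¬m o | suc _ = μ-trivial ¬m o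

    μ-none : μ (size 0 0 (replicate N false))
               (λ x y → B (cut 0 0 (replicate N false) x) (cut 0 0 (replicate N false) y)) ≈ 1#
    μ-none = none refl (size-none {N} 0 0)
      where
      open Quotient S (cuts-enumerate (replicate N false))
      none : ∀ {k} → k ≡ size 0 0 (replicate N false) → k ≡ 1 → μ k B/ ≈ 1#
      none size≡ refl = μ-mono (≡.subst (λ z → IsMono z B/) (≡.sym size≡)
        (splits⇒isMono λ 0<x x<k → contradiction (≡.subst (_ <_) (≡.sym size≡) x<k) (ℕ.<⇒≱ (s≤s 0<x))))

    module _ (1≤N : 1 ≤ N) (¬split : ∀ {c} → c < n → ¬ IsSplit n B c) where

      private
        uncovered : Vec Bool N
        uncovered = tabulate λ p → not (does (covered? n B (suc (toℕ p))))

        lookup-uncovered : ∀ p → lookup uncovered p ≡ not (does (covered? n B (suc (toℕ p))))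
        lookup-uncovered = Vec.lookup∘tabulate _

      module _ (bs : Vec Bool N) where

        open Quotient S (cuts-enumerate bs)
        private
          k = size 0 0 bs

        k≤1⇒none : k ≤ 1 → bs ≡ replicate N false
        k≤1⇒none k≤1 = lookup-ext bs (replicate N false) λ p →
          ≡.trans (Bool.¬-not λ l → case lookup-true 0 0 bs p l of λ where
            (x , e) → ℕ.<⇒≱ (proj₂ (inner bs p e)) (ℕ.≤-trans k≤1 (proj₁ (inner bs p e))))
            (≡.sym (Vec.lookup-replicate p false))

        onlyTrivial⇒uncovered : 3 ≤ k → HasOnlyTrivial k B/ → bs ≡ uncovered
        onlyTrivial⇒uncovered 3≤k o = lookup-ext bs uncovered λ p →
          ≡.trans (agree p) (≡.sym (lookup-uncovered p))
          where
          agree : ∀ p → lookup bs p ≡ not (does (covered? n B (suc (toℕ p))))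
          agree p with lookup bs p in l
          ... | true  = ≡.cong not (≡.sym (dec-false (covered? n B (suc (toℕ p))) λ cov →
                case lookup-true 0 0 bs p l of λ where
                  (x , e) → cut⇒¬covered o 3≤k (≡.subst (Covered n B) (≡.sym e) cov)))
          ... | false = ≡.cong not (≡.sym (dec-true (covered? n B (suc (toℕ p)))
                (¬cut⇒covered o 3≤k (s≤s (Fin.toℕ<n p)) (lookup-false 0 0 bs p l))))

      private
        module U = Quotient S (cuts-enumerate uncovered)

        lookup-covered : ∀ p → lookup uncovered p ≡ true → ¬ Covered n B (suc (toℕ p))
        lookup-covered p l cov = contradiction (≡.trans (≡.sym l) (≡.trans (lookup-uncovered p)
          (≡.cong not (dec-true (covered? n B (suc (toℕ p))) cov)))) λ ()

        cut⇒ : ∀ {x} → 0 < x → x < size 0 0 uncovered → ¬ Covered n B (cut 0 0 uncovered x)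
        cut⇒ 0<x x<k with toPosition (U.0< 0<x) (U.<n x<k)
        ... | p , e = lookup-covered p (lookup-cut uncovered p (≡.sym e)) ∘ ≡.subst (Covered n B) (≡.sym e)

        ¬cut⇒ : ∀ {c} → 0 < c → c < n → (∀ x → cut 0 0 uncovered x ≢ c) → Covered n B c
        ¬cut⇒ 0<c c<n ¬cut with toPosition 0<c c<n
        ... | p , refl with covered? n B (suc (toℕ p)) in cov?
        ...   | yes cov = cov
        ...   | no ¬cov with lookup-true 0 0 uncovered p
                (≡.trans (lookup-uncovered p) (≡.cong not (≡.cong does cov?)))
        ...     | x , e = contradiction e (¬cut x)

        2≤k : 2 ≤ size 0 0 uncovered
        2≤k = U.2≤k ¬split (s≤s 1≤N) cut⇒ ¬cut⇒

        onlyTrivial : HasOnlyTrivial (size 0 0 uncovered) U.B/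
        onlyTrivial = U.onlyTrivial ¬split (s≤s 1≤N) cut⇒ ¬cut⇒

        uncovered≢none : uncovered ≢ replicate N false
        uncovered≢none e = ℕ.<⇒≱ 2≤k (ℕ.≤-reflexive
          (≡.trans (≡.cong (size 0 0) e) (size-none {N} 0 0)))

      -- Without splits, a monotone quotient has a single part, which gives the term 1. A quotient
      -- with only trivial blocks and more than one part has at least three, so its cuts are the
      -- uncovered boundaries, which gives the term -1.
      μ-prime : ∀ bs → μ (size 0 0 bs) (λ x y → B (cut 0 0 bs x) (cut 0 0 bs y)) ≈
                δ (replicate N false) bs + - 1# * δ uncovered bs
      μ-prime bs with Vec.≡-dec Bool._≟_ bs (replicate N false)
      ... | yes refl = begin
        μ _ _         ≈⟨ μ-none ⟩
        1#            ≈⟨ +-identityʳ 1# ⟨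
        1# + 0#       ≈⟨ +-cong (δ-refl (replicate N false)) (trans (*-congˡ (δ-≢ uncovered≢none)) (zeroʳ _)) ⟨
        δ (replicate N false) (replicate N false) + - 1# * δ uncovered (replicate N false) ∎
      ... | no bs≢none with Vec.≡-dec Bool._≟_ bs uncovered
      ...   | yes refl = begin
        μ _ _         ≈⟨ μ-onlyTrivial uncovered 2≤k (ℕ.<⇒≱ 2≤k ∘ U.isMono⇒k≤1 ¬split) onlyTrivial ⟩
        - 1#          ≈⟨ trans (+-identityˡ _) (*-identityʳ _) ⟨
        0# + - 1# * 1# ≈⟨ +-cong (δ-≢ (bs≢none ∘ ≡.sym)) (*-congˡ (δ-refl uncovered)) ⟨
        δ (replicate N false) uncovered + - 1# * δ uncovered uncovered ∎
      ...   | no bs≢uncovered = begin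
        μ _ _         ≈⟨ μ-zero (bs≢none ∘ k≤1⇒none bs ∘ isMono⇒k≤1 ¬split) ¬onlyTrivial ⟩
        0#            ≈⟨ trans (+-identityˡ _) (zeroʳ _) ⟨
        0# + - 1# * 0# ≈⟨ +-cong (δ-≢ (bs≢none ∘ ≡.sym)) (*-congˡ (δ-≢ (bs≢uncovered ∘ ≡.sym))) ⟨
        δ (replicate N false) bs + - 1# * δ uncovered bs ∎
        where
        open Quotient S (cuts-enumerate bs)
        ¬onlyTrivial : ¬ HasOnlyTrivial (size 0 0 bs) B/
        -- There are at least two parts because the partition is not the trivial one, and not
        -- exactly two because there is no split.
        ¬onlyTrivial o = bs≢uncovered (onlyTrivial⇒uncovered bs
          (ℕ.≤∧≢⇒< (ℕ.≰⇒> (bs≢none ∘ k≤1⇒none bs)) (λ 2≡k → onlyTrivial⇒k≢2 ¬split o (≡.sym 2≡k))) o)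

    value-sum : 1 ≤ N → bitSum N (λ bs → value 0 0 bs B) ≈ 0#
    value-sum 1≤N with ℕ.anyUpTo? (isSplit? n B) n
    ... | yes (zero  , _   , () , _)
    ... | yes (suc c , c<n , split) = trans
      (bitSum-cong N (λ bs → trans (value≈μ 0 0 bs B) (μ-split bs c<n split)))
      (splitWeight-sum N _ (s≤s⁻¹ c<n) (dec-true (isSplit? n B (suc c)) split))
    ... | no ¬split = begin
      bitSum N (λ bs → value 0 0 bs B) ≈⟨ bitSum-cong N (λ bs → trans (value≈μ 0 0 bs B)
                                            (μ-prime 1≤N (λ c<n s → ¬split (_ , c<n , s)) bs)) ⟩
      bitSum N (λ bs → δ (replicate N false) bs + - 1# * δ uncov bs)
                                       ≈⟨ trans (bitSum-+ N _ _) (+-cong (δ-sum (replicate N false))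
                                            (trans (bitSum-*ˡ N _ _) (trans (*-congˡ (δ-sum uncov)) (*-identityʳ _)))) ⟩
      1# + - 1#                        ≈⟨ -‿inverseʳ 1# ⟩
      0#                               ∎
      where
      uncov : Vec Bool N
      uncov = tabulate λ p → not (does (covered? n B (suc (toℕ p))))

  value-singleton : ∀ {B} → IsBlockSystem 1 B → value 0 0 [] B ≈ 1#
  value-singleton {B} S = trans (value≈μ 0 0 [] B) (μ-none S)

-- Recursion and right cancellation for composition of power series

module Composition {c ℓ} (R : CommutativeRing c ℓ) where

  open CommutativeRing R hiding (zero) renaming (refl to ≈-refl)
  open PowerSeries R
  open Exponentiation (CommutativeRing.semiring seriesRing) using (_^_; ^-congˡ)
  open GroupProperties +-group using () renaming (∙-cancelˡ to +-cancelˡ)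
  open SetoidReasoning setoid
  open CommutativeSemigroupProperties +-commutativeSemigroup using (interchange)

  sumUpTo-cong-≤ : ∀ n {h h′ : Series} → (∀ {k} → k ≤ n → h k ≈ h′ k) → sumUpTo n h ≈ sumUpTo n h′
  sumUpTo-cong-≤ zero    e = e z≤n
  sumUpTo-cong-≤ (suc n) e = +-cong (e z≤n) (sumUpTo-cong-≤ n (e ∘ s≤s))

  sumUpTo-cong : ∀ n {h h′ : Series} → h ≋ h′ → sumUpTo n h ≈ sumUpTo n h′
  sumUpTo-cong n e = sumUpTo-cong-≤ n (λ {k} _ → e k)

  sumUpTo-zero : ∀ n {h : Series} → (∀ k → h k ≈ 0#) → sumUpTo n h ≈ 0#
  sumUpTo-zero zero    e = e 0
  sumUpTo-zero (suc n) e = trans (+-cong (e 0) (sumUpTo-zero n (e ∘ suc))) (+-identityˡ 0#)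

  sumUpTo-+ : ∀ n (h h′ : Series) → sumUpTo n (h ⊞ h′) ≈ sumUpTo n h + sumUpTo n h′
  sumUpTo-+ zero    h h′ = ≈-refl
  sumUpTo-+ (suc n) h h′ = trans (+-congˡ (sumUpTo-+ n _ _)) (interchange _ _ _ _)

  sumUpTo-*ˡ : ∀ n a (h : Series) → sumUpTo n (λ k → a * h k) ≈ a * sumUpTo n h
  sumUpTo-*ˡ zero    a h = ≈-refl
  sumUpTo-*ˡ (suc n) a h = trans (+-congˡ (sumUpTo-*ˡ n a _)) (sym (distribˡ _ _ _))

  sumUpTo-swap : ∀ m n (h : ℕ → ℕ → Carrier) →
    sumUpTo m (λ j → sumUpTo n (λ k → h j k)) ≈ sumUpTo n (λ k → sumUpTo m (λ j → h j k))
  sumUpTo-swap zero    n h = ≈-refl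
  sumUpTo-swap (suc m) n h =
    trans (+-congˡ (sumUpTo-swap m n (h ∘ suc))) (sym (sumUpTo-+ n _ _))

  sumUpTo-truncate : ∀ {j n} {h : Series} → j ≤ n → (∀ {k} → j < k → h k ≈ 0#) →
                     sumUpTo n h ≈ sumUpTo j h
  sumUpTo-truncate {zero}  {zero}  _         e = ≈-refl
  sumUpTo-truncate {zero}  {suc n} _         e =
    trans (+-congˡ (sumUpTo-zero n (λ k → e (s≤s z≤n)))) (+-identityʳ _)
  sumUpTo-truncate {suc j} {suc n} (s≤s j≤n) e = +-congˡ (sumUpTo-truncate j≤n (e ∘ s≤s))

  sumUpTo-last : ∀ n (h : Series) → sumUpTo (suc n) h ≈ sumUpTo n h + h (suc n)
  sumUpTo-last zero    h = ≈-refl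
  sumUpTo-last (suc n) h = trans (+-congˡ (sumUpTo-last n (h ∘ suc))) (sym (+-assoc _ _ _))

  module _ {g : Series} (g₀≈0 : g 0 ≈ 0#) where

    ^-suc : ∀ k n → (g ^ suc k) (suc n) ≈ ((g ∘ suc) ⊛ (g ^ k)) n
    ^-suc k n = trans (+-congʳ (trans (*-congʳ g₀≈0) (zeroˡ _))) (+-identityˡ _)

    ^-vanishes : ∀ k {j} → j < k → (g ^ k) j ≈ 0#
    ^-vanishes (suc k) {zero}  _         = trans (*-congʳ g₀≈0) (zeroˡ _)
    ^-vanishes (suc k) {suc j} (s≤s j<k) = trans (^-suc k j) (sumUpTo-zero j λ d →
      trans (*-congˡ (^-vanishes k (ℕ.≤-<-trans (ℕ.m∸n≤m j d) j<k))) (zeroʳ _))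

    ^-leading : g 1 ≈ 1# → ∀ k → (g ^ k) k ≈ 1#
    ^-leading g₁≈1 zero          = ≈-refl
    ^-leading g₁≈1 (suc zero)    = trans (^-suc 0 0) (trans (*-congʳ g₁≈1) (*-identityˡ 1#))
    ^-leading g₁≈1 (suc (suc k)) = begin
      (g ^ suc (suc k)) (suc (suc k))            ≈⟨ ^-suc (suc k) (suc k) ⟩
      g 1 * (g ^ suc k) (suc k) + ((λ d → g (suc (suc d))) ⊛ (g ^ suc k)) k
        ≈⟨ +-cong (*-cong g₁≈1 (^-leading g₁≈1 (suc k))) (sumUpTo-zero k λ d →
             trans (*-congˡ (^-vanishes (suc k) (s≤s (ℕ.m∸n≤m k d)))) (zeroʳ _)) ⟩
      1# * 1# + 0#                               ≈⟨ trans (+-identityʳ _) (*-identityˡ 1#) ⟩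
      1#                                         ∎

    -- One factor `g` is split off each power; its degree d + 1 will be the length of the first part
    -- of a partition. After the sums are exchanged, k still runs to n, beyond the degree n - d of
    -- the inner composite, but there the powers of `g` vanish.
    compose-suc : ∀ f n → compose f g (suc n) ≈ ((g ∘ suc) ⊛ compose (f ∘ suc) g) n
    compose-suc f n = begin
      f 0 * 0# + sumUpTo n (λ k → f (suc k) * (g ^ suc k) (suc n))
        ≈⟨ trans (+-congʳ (zeroʳ _)) (+-identityˡ _) ⟩
      sumUpTo n (λ k → f (suc k) * (g ^ suc k) (suc n))
        ≈⟨ sumUpTo-cong n (λ k → trans (*-congˡ (^-suc k n)) (sym (sumUpTo-*ˡ n _ _))) ⟩
      sumUpTo n (λ k → sumUpTo n (λ d → f (suc k) * (g (suc d) * (g ^ k) (n ∸ d))))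
        ≈⟨ sumUpTo-swap n n _ ⟩
      sumUpTo n (λ d → sumUpTo n (λ k → f (suc k) * (g (suc d) * (g ^ k) (n ∸ d))))
        ≈⟨ sumUpTo-cong n (λ d → trans
             (sumUpTo-cong n (λ k → trans (sym (*-assoc _ _ _))
               (trans (*-congʳ (*-comm _ _)) (*-assoc _ _ _))))
             (trans (sumUpTo-*ˡ n _ _) (*-congˡ (sumUpTo-truncate (ℕ.m∸n≤m n d) λ {k} j<k →
               trans (*-congˡ (^-vanishes k j<k)) (zeroʳ _))))) ⟩
      ((g ∘ suc) ⊛ compose (f ∘ suc) g) n ∎

    -- The system is triangular: since g^n starts with x^n, the coefficient of the composite in
    -- degree n is f n plus a combination of the f k with k < n.
    compose-cancelʳ : g 1 ≈ 1# → ∀ {f f′} → compose f g ≋ compose f′ g → f ≋ f′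
    compose-cancelʳ g₁≈1 {f} {f′} e n = up-to n ℕ.≤-refl
      where
      top : ∀ f n → f n * (g ^ n) n ≈ f n
      top f n = trans (*-congˡ (^-leading g₁≈1 n)) (*-identityʳ _)

      up-to : ∀ n {k} → k ≤ n → f k ≈ f′ k
      up-to zero    z≤n = trans (sym (top f 0)) (trans (e 0) (top f′ 0))
      up-to (suc n) k≤n with ℕ.m≤n⇒m<n∨m≡n k≤n
      ... | inj₁ k<n  = up-to n (s≤s⁻¹ k<n)
      ... | inj₂ refl = +-cancelˡ lower _ _ (begin
        lower + f (suc n)     ≈⟨ +-congˡ (top f (suc n)) ⟨
        lower + f (suc n) * (g ^ suc n) (suc n)    ≈⟨ sumUpTo-last n _ ⟨
        compose f g (suc n)   ≈⟨ e (suc n) ⟩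
        compose f′ g (suc n)  ≈⟨ sumUpTo-last n _ ⟩
        sumUpTo n (λ k → f′ k * (g ^ k) (suc n)) + f′ (suc n) * (g ^ suc n) (suc n)
          ≈⟨ +-cong (sumUpTo-cong-≤ n λ k≤n → *-congʳ (sym (up-to n k≤n))) (top f′ (suc n)) ⟩
        lower + f′ (suc n)    ∎)
        where lower = sumUpTo n (λ k → f k * (g ^ k) (suc n))

  compose-congʳ : ∀ f {g g′} → g ≋ g′ → compose f g ≋ compose f g′
  compose-congʳ f g≋g′ n = sumUpTo-cong n (λ k → *-congˡ (^-congˡ k g≋g′ n))

  drop : ℕ → Series → Series
  drop zero    f = f
  drop (suc i) f = drop i f ∘ suc

  drop-+ : ∀ i f k → drop i f k ≡ f (k ℕ.+ i)
  drop-+ zero    f k = ≡.cong f (≡.sym (ℕ.+-identityʳ k))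
  drop-+ (suc i) f k = ≡.trans (drop-+ i f (suc k)) (≡.cong f (≡.sym (ℕ.+-suc k i)))

-- The left inverse of F and the formula, over an arbitrary commutative ring

module Weighted {c ℓ} (R : CommutativeRing c ℓ) (s t : CommutativeRing.Carrier R) where

  open CommutativeRing R hiding (zero) renaming (refl to ≈-refl)
  open PowerSeries R using (Series; _≋_; _⊛_; compose; X; ⊛-cong)
  open RingProperties ring using (-1*x≈-x)
  open GroupProperties +-group using (inverseˡ-unique)
  open CommutativeSemigroupProperties *-commutativeSemigroup using () renaming (interchange to *-interchange)
  open Exponentiation semiring using (_^_; ^-homo-*; ^-congˡ)
  open CommutativeExponentiation commutativeSemiring using (^-distrib-*)
  open SetoidReasoning setoid
  open Sums R
  open Möbius R
  open Composition R

  weight : ∀ {n} → Permutation′ n → Carrier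
  weight π = s ^ des π * t ^ ides π

  weight-cong : ∀ {n} {π ρ : Permutation′ n} → π Perm.≈ ρ → weight π ≈ weight ρ
  weight-cong {π = π} {ρ} π≈ρ = reflexive (≡.cong₂ (λ d e → s ^ d * t ^ e)
    (des-cong {π = π} {ρ} π≈ρ) (ides-cong {π = π} {ρ} π≈ρ))

  weight-inflate : ∀ {m r} (τ : Permutation′ (suc r)) (ρ : Permutation′ (suc m)) i (i≤r : i ≤ r) →
                   weight (inflate τ ρ i i≤r) ≈ weight ρ * weight τ
  weight-inflate τ ρ i i≤r = begin
    s ^ des π * t ^ ides π
      ≈⟨ reflexive (≡.cong₂ (λ d e → s ^ d * t ^ e) (des-inflate τ ρ i i≤r) (ides-inflate τ ρ i i≤r)) ⟩
    s ^ (des ρ ℕ.+ des τ) * t ^ (ides ρ ℕ.+ ides τ)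
      ≈⟨ *-cong (^-homo-* s (des ρ) (des τ)) (^-homo-* t (ides ρ) (ides τ)) ⟩
    (s ^ des ρ * s ^ des τ) * (t ^ ides ρ * t ^ ides τ)
      ≈⟨ *-interchange _ _ _ _ ⟩
    weight ρ * weight τ ∎
    where π = inflate τ ρ i i≤r

  F : Series
  F zero      = 0#
  F n@(suc _) = ∑ (permutations n) weight

  blocksOf : ∀ {n} → Permutation′ n → Blocks
  blocksOf {n} π = blocks n (ord π)

  blocksOf-cong : ∀ {n} {π ρ : Permutation′ n} → π Perm.≈ ρ → ∀ x y → blocksOf π x y ≡ blocksOf ρ x y
  blocksOf-cong {n} {π} {ρ} π≈ρ = blocks-cong n (λ {p} {q} _ _ → ord-cong {π = π} {ρ} π≈ρ p q)

  A : Series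
  A k = ∑ (permutations k) (λ τ → weight τ * μ k (blocksOf τ))

  module _ {i m r : ℕ} (i≤r : i ≤ r) (Φ : Blocks → Carrier)
           (Φ-cong : ∀ {B B′} → (∀ x y → B x y ≡ B′ x y) → Φ B ≈ Φ B′) where

    private
      n : ℕ
      n = suc (m ℕ.+ r)
      module S = Setoid (permSetoid n)

      B/ : Permutation′ n → Blocks
      B/ π x y = blocksOf π (ε i m x) (ε i m y)

      v : Permutation′ n → Carrier
      v π = weight π * Φ (B/ π)

      v-cong : ∀ {π ρ} → π S.≈ ρ → v π ≈ v ρ
      v-cong {π} {ρ} π≈ρ = *-cong (weight-cong {π = π} {ρ} π≈ρ)
        (Φ-cong λ x y → blocksOf-cong {π = π} {ρ} π≈ρ (ε i m x) (ε i m y))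

      HasModule : Permutation′ n → Set
      HasModule π = Module n (ord π) i (i ℕ.+ suc m)

      hasModule? : Decidable HasModule
      hasModule? π = module? n (ord π) i (i ℕ.+ suc m)

      hasModule-resp : ∀ {π ρ} → π S.≈ ρ → HasModule π → HasModule ρ
      hasModule-resp {π} {ρ} π≈ρ = module-cong n (λ {p} {q} _ _ → ord-cong {π = π} {ρ} π≈ρ p q)

      glue : Permutation′ (suc m) → Permutation′ (suc r) → Permutation′ n
      glue ρ τ = inflate τ ρ i i≤r

      glued = cartesianProductWith glue (permutations (suc m)) (permutations (suc r))
      modular = filter hasModule? (permutations n)

      open SetoidMembership (permSetoid n) using (_∈_)

      modular⊆glued : ∀ {π} → π ∈ modular → π ∈ glued
      modular⊆glued {π} π∈ with module-inflate i≤r π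
        (proj₂ (Membership.∈-filter⁻ (permSetoid n) hasModule? (λ {π} {ρ} → hasModule-resp {π} {ρ})
          {xs = permutations n} π∈))
      ... | ρ , τ , π≈ = Membership.∈-resp-≈ (permSetoid n) {x = glue ρ τ} {π} (S.sym {π} {glue ρ τ} π≈)
        (Membership.∈-cartesianProductWith⁺ (permSetoid (suc m)) (permSetoid (suc r)) (permSetoid n)
          (λ {ρ} {ρ′} {τ} {τ′} → inflate-cong i≤r {τ} {τ′} {ρ} {ρ′})
          (permutations-complete ρ) (permutations-complete τ))

      glued⊆modular : ∀ {π} → π ∈ glued → π ∈ modular
      glued⊆modular {π} π∈ with Membership.∈-cartesianProductWith⁻
        (permSetoid (suc m)) (permSetoid (suc r)) (permSetoid n)
        glue (permutations (suc m)) (permutations (suc r)) {π} π∈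
      ... | ρ , τ , _ , _ , π≈ = Membership.∈-filter⁺ (permSetoid n) hasModule?
        (λ {π} {ρ} → hasModule-resp {π} {ρ}) (permutations-complete π)
        (hasModule-resp {glue ρ τ} {π} (S.sym {π} {glue ρ τ} π≈) (inflate-module i≤r τ ρ))

    -- The permutations with a block at i, ..., i + m are the inflations at i of some τ by some ρ,
    -- each arising once; weights multiply, and the blocks of the quotient are those of τ. `Φ` is
    -- arbitrary so that it can stand for the whole sum over the ways to continue the partition.
    block-sum : ∑ (permutations n) (λ π → weight π * ([ blocksOf π i (i ℕ.+ suc m) ]? * Φ (B/ π)))
                ≈ F (suc m) * ∑ (permutations (suc r)) (λ τ → weight τ * Φ (blocksOf τ))
    block-sum = begin
      ∑ (permutations n) (λ π → weight π * ([ blocksOf π i (i ℕ.+ suc m) ]? * Φ (B/ π)))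
        ≈⟨ ∑-cong (permutations n) (λ π → trans (sym (*-assoc _ _ _))
             (trans (*-congʳ (*-comm _ _)) (trans (*-assoc _ _ _)
               (*-congʳ (reflexive (≡.cong [_]? (blocks-does n (ord π) i (i ℕ.+ suc m)))))))) ⟩
      ∑ (permutations n) (λ π → [ does (hasModule? π) ]? * v π)
        ≈⟨ ∑-filter hasModule? (permutations n) v ⟨
      ∑ modular v
        ≈⟨ ∑-same (permSetoid n) (λ {π} {ρ} → v-cong {π} {ρ}) modular glued
             (Unique.filter⁺ (permSetoid n) hasModule? (permutations-unique n))
             (Unique.cartesianProductWith⁺ (permSetoid (suc m)) (permSetoid (suc r)) (permSetoid n) glue
               (λ {ρ} {ρ′} {τ} {τ′} → inflate-injective i≤r {τ} {τ′} {ρ} {ρ′})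
               (permutations-unique (suc m)) (permutations-unique (suc r)))
             (λ {π} → modular⊆glued {π}) (λ {π} → glued⊆modular {π}) ⟩
      ∑ glued v
        ≈⟨ ∑-cartesianProductWith glue (permutations (suc m)) (permutations (suc r)) v ⟩
      ∑ (permutations (suc m)) (λ ρ → ∑ (permutations (suc r)) (λ τ → v (glue ρ τ)))
        ≈⟨ ∑-cong (permutations (suc m)) (λ ρ → trans
             (∑-cong (permutations (suc r)) (λ τ → trans
               (*-cong (weight-inflate τ ρ i i≤r) (Φ-cong (blocks-inflate i≤r τ ρ))) (*-assoc _ _ _)))
             (∑-*ˡ (permutations (suc r)) (weight ρ) _)) ⟩
      ∑ (permutations (suc m)) (λ ρ → weight ρ * ∑ (permutations (suc r)) (λ τ → weight τ * Φ (blocksOf τ)))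
        ≈⟨ ∑-*ʳ (permutations (suc m)) weight _ ⟩
      F (suc m) * ∑ (permutations (suc r)) (λ τ → weight τ * Φ (blocksOf τ)) ∎

  -- The i positions in front are parts already collapsed, the current part has m + 1 positions so
  -- far, and N boundaries are still open. On the right, the convolution runs over the final length
  -- of the current part. The shift of `A` by i + 1 accounts for the current part and the collapsed
  -- ones, which count towards the number of parts but supply no factor of the inner power of F.
  partition-sum : ∀ n i m N → n ≡ suc (m ℕ.+ (i ℕ.+ N)) →
    ∑ (permutations n) (λ π → weight π * bitSum N (λ bs → value i m bs (blocksOf π)))
    ≈ (drop (suc m) F ⊛ compose (drop (suc i) A) F) N
  partition-sum n i m zero n≡ with refl ← ≡.trans n≡ (≡.cong (λ z → suc (m ℕ.+ z)) (ℕ.+-identityʳ i)) = begin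
    ∑ (permutations n) (λ π → weight π *
      ([ blocksOf π i (i ℕ.+ suc m) ]? * μ (suc i) (λ x y → blocksOf π (ε i m x) (ε i m y))))
      ≈⟨ block-sum {i} {m} {i} ℕ.≤-refl (μ (suc i)) (μ-cong (suc i)) ⟩
    F (suc m) * A (suc i)
      ≈⟨ *-cong (reflexive (≡.sym (drop-+ (suc m) F 0)))
           (trans (reflexive (≡.sym (drop-+ (suc i) A 0))) (sym (*-identityʳ _))) ⟩
    drop (suc m) F 0 * (drop (suc i) A 0 * 1#) ∎
  partition-sum n i m (suc N) refl = begin
    ∑ (permutations n) (λ π → weight π *
      (V₁ π + bitSum N (λ bs → [ blocksOf π i (i ℕ.+ suc m) ]? * V₂ π bs)))
      ≈⟨ ∑-cong (permutations n) (λ π → trans (*-congˡ (+-congˡ (bitSum-*ˡ N _ _))) (distribˡ _ _ _)) ⟩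
    ∑ (permutations n) (λ π →
      weight π * V₁ π + weight π * ([ blocksOf π i (i ℕ.+ suc m) ]? * bitSum N (V₂ π)))
      ≈⟨ ∑-+ (permutations n) _ _ ⟩
    ∑ (permutations n) (λ π → weight π * V₁ π)
      + ∑ (permutations n) (λ π → weight π * ([ blocksOf π i (i ℕ.+ suc m) ]? * bitSum N (V₂ π)))
      ≈⟨ +-cong
           (partition-sum n i (suc m) N
             (≡.cong suc (≡.trans (≡.cong (m ℕ.+_) (ℕ.+-suc i N)) (ℕ.+-suc m (i ℕ.+ N)))))
           (block-sum {i} {m} {i ℕ.+ suc N} (ℕ.m≤m+n i (suc N)) (λ B → bitSum N (λ bs → value (suc i) 0 bs B))
             (λ e → bitSum-cong N (λ bs → value-cong (suc i) 0 bs e))) ⟩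
    (drop (suc (suc m)) F ⊛ T) N
      + F (suc m) * U
      ≈⟨ +-comm _ _ ⟩
    F (suc m) * U + (drop (suc (suc m)) F ⊛ T) N
      ≈⟨ +-congʳ (*-cong (reflexive (≡.sym (drop-+ (suc m) F 0)))
           -- The current part is complete and has been collapsed to position i, so a new part
           -- starts at i + 1. By `compose-suc` the resulting sum is the next coefficient of the
           -- same composite `T`, that is the leading term of the convolution.
           (trans (partition-sum (suc (i ℕ.+ suc N)) (suc i) 0 N (≡.cong suc (ℕ.+-suc i N)))
             (sym (compose-suc ≈-refl (drop (suc i) A) N)))) ⟩
    drop (suc m) F 0 * T (suc N) + (drop (suc (suc m)) F ⊛ T) N ∎
    where
    T = compose (drop (suc i) A) F
    U = ∑ (permutations (suc (i ℕ.+ suc N)))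
          (λ τ → weight τ * bitSum N (λ bs → value (suc i) 0 bs (blocksOf τ)))
    V₁ : Permutation′ n → Carrier
    V₁ π = bitSum N (λ bs → value i (suc m) bs (blocksOf π))
    V₂ : Permutation′ n → Vec Bool N → Carrier
    V₂ π bs = value (suc i) 0 bs (λ x y → blocksOf π (ε i m x) (ε i m y))

  F₁≈1 : F 1 ≈ 1#
  F₁≈1 = trans (+-identityʳ _) (*-identityʳ 1#)

  A∘F≋X : compose A F ≋ X
  A∘F≋X zero = trans (*-congʳ (trans (∑-cong (permutations 0)
      {λ τ → weight τ * μ 0 (blocksOf τ)} (λ τ → trans (*-congˡ (μ₀ (blocksOf τ))) (zeroʳ _)))
    (∑-zero (permutations 0)))) (zeroˡ _)
  A∘F≋X (suc N) = begin
    compose A F (suc N)                        ≈⟨ compose-suc ≈-refl A N ⟩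
    (drop 1 F ⊛ compose (drop 1 A) F) N        ≈⟨ partition-sum (suc N) 0 0 N refl ⟨
    ∑ (permutations (suc N)) (λ π → weight π * bitSum N (λ bs → value 0 0 bs (blocksOf π)))
                                               ≈⟨ evaluate N ⟩
    X (suc N)                                  ∎
    where
    evaluate : ∀ N → ∑ (permutations (suc N)) (λ π → weight π * bitSum N (λ bs → value 0 0 bs (blocksOf π)))
                     ≈ X (suc N)
    evaluate zero = trans
      (∑-cong (permutations 1) {λ π → weight π * value 0 0 [] (blocksOf π)} {weight}
        (λ π → trans (*-congˡ (value-singleton (isBlockSystem π))) (*-identityʳ _)))
      F₁≈1
    evaluate (suc N) = trans
      (∑-cong (permutations (suc (suc N))) (λ π →
        trans (*-congˡ (value-sum (isBlockSystem π) (s≤s z≤n))) (zeroʳ _)))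
      (∑-zero (permutations (suc (suc N))))

  F⁻¹≋A : ∀ {G} → compose G F ≋ X → G ≋ A
  F⁻¹≋A G∘F≋X = compose-cancelʳ ≈-refl F₁≈1 λ n → trans (G∘F≋X n) (sym (A∘F≋X n))

  simp : ℕ → Carrier
  simp n = ∑ (filter isSimple? (permutations n)) weight

  module _ (k : ℕ) (2≤k : 2 ≤ k) where

    private
      n : ℕ
      n = suc k
      sign = (- 1#) ^ k
      S = permSetoid n
      module S = Setoid S

      Mono : Permutation′ n → Set
      Mono π = IsMono n (blocksOf π)

      mono? : Decidable Mono
      mono? π = isMono? n (blocksOf π)

      mono-resp : ∀ {π ρ} → π S.≈ ρ → Mono π → Mono ρ
      mono-resp {π} {ρ} π≈ρ = isMono-cong {n} {blocksOf π} {blocksOf ρ} (blocksOf-cong {π = π} {ρ} π≈ρ)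

      open SetoidMembership S using (_∈_)

      monotones : List (Permutation′ n)
      monotones = Perm.id ∷ Perm.reverse ∷ []

      mono⇒∈ : ∀ {π} → Mono π → π ∈ monotones
      mono⇒∈ {π} mono with isMono⇒id⊎reverse π mono
      ... | inj₁ π≈id      = here π≈id
      ... | inj₂ π≈reverse = there (here π≈reverse)

      ∈⇒mono : ∀ {π} → π ∈ monotones → Mono π
      ∈⇒mono {π} (here π≈id)              = mono-resp {Perm.id} {π} (S.sym {π} {Perm.id} π≈id) isMono-id
      ∈⇒mono {π} (there (here π≈reverse)) =
        mono-resp {Perm.reverse} {π} (S.sym {π} {Perm.reverse} π≈reverse) isMono-reverse

    mono-sum : ∑ (filter mono? (permutations n)) weight ≈ 1# + s ^ k * t ^ k
    mono-sum = begin
      ∑ (filter mono? (permutations n)) weight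
        ≈⟨ ∑-same S (λ {π} {ρ} → weight-cong {π = π} {ρ}) (filter mono? (permutations n)) monotones
             (Unique.filter⁺ S mono? (permutations-unique n))
             ((id≉reverse 2≤k ∷ []) ∷ [] ∷ [])
             (λ {π} π∈ → mono⇒∈ {π} (proj₂ (Membership.∈-filter⁻ S mono?
               (λ {π} {ρ} → mono-resp {π} {ρ}) {xs = permutations n} π∈)))
             (λ {π} π∈ → Membership.∈-filter⁺ S mono? (λ {π} {ρ} → mono-resp {π} {ρ})
               (permutations-complete π) (∈⇒mono {π} π∈)) ⟩
      weight (Perm.id {n}) + (weight (Perm.reverse {n}) + 0#)
        ≈⟨ +-cong
             (trans (reflexive (≡.cong₂ (λ d e → s ^ d * t ^ e) (des-id k) (ides-id k))) (*-identityʳ 1#))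
             (trans (+-identityʳ _)
               (reflexive (≡.cong₂ (λ d e → s ^ d * t ^ e) (des-reverse k) (ides-reverse k)))) ⟩
      1# + s ^ k * t ^ k ∎

    private
      -- From length 3 on, no permutation is both monotone and simple, because the interval [0, 2⟩
      -- is then nontrivial; so `μ` is a combination of two indicators.
      term : ∀ π → weight π * μ n (blocksOf π) ≈
                   [ does (mono? π) ]? * weight π * sign + [ does (isSimple? π) ]? * weight π * - 1#
      term π = cases (mono? π) (isSimple? π)
        where
        0-term : ∀ x → 0# * weight π * x ≈ 0#
        0-term x = trans (*-congʳ (zeroˡ _)) (zeroˡ x)

        1-term : ∀ x → 1# * weight π * x ≈ weight π * x
        1-term x = *-congʳ (*-identityˡ _)

        cases : (m? : Dec (Mono π)) (s? : Dec (IsSimple π)) → weight π * μ n (blocksOf π) ≈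
                [ does m? ]? * weight π * sign + [ does s? ]? * weight π * - 1#
        cases (yes mono) (yes simple) = ⊥-elim
          (isMono⇒¬hasOnlyTrivial {n} {blocksOf π} (s≤s 2≤k) mono (isSimple⇒hasOnlyTrivial π simple))
        cases (yes mono) (no ¬simple) = begin
          weight π * μ n (blocksOf π)                  ≈⟨ *-congˡ (μ-mono mono) ⟩
          weight π * sign                              ≈⟨ trans (+-cong (1-term _) (0-term _)) (+-identityʳ _) ⟨
          1# * weight π * sign + 0# * weight π * - 1#  ∎
        cases (no ¬mono) (yes simple) = begin
          weight π * μ n (blocksOf π)                  ≈⟨ *-congˡ (μ-trivial ¬mono
                                                            (isSimple⇒hasOnlyTrivial π simple)) ⟩
          weight π * - 1#                              ≈⟨ trans (+-cong (0-term _) (1-term _)) (+-identityˡ _) ⟨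
          0# * weight π * sign + 1# * weight π * - 1#  ∎
        cases (no ¬mono) (no ¬simple) = begin
          weight π * μ n (blocksOf π)                  ≈⟨ *-congˡ (μ-zero ¬mono
                                                            (λ o → ¬simple (hasOnlyTrivial⇒isSimple π o))) ⟩
          weight π * 0#                                ≈⟨ zeroʳ _ ⟩
          0#                                           ≈⟨ trans (+-cong (0-term _) (0-term _)) (+-identityˡ _) ⟨
          0# * weight π * sign + 0# * weight π * - 1#  ∎

    A-simp : A n ≈ (1# + s ^ k * t ^ k) * sign + - simp n
    A-simp = begin
      A n
        ≈⟨ ∑-cong (permutations n) term ⟩
      ∑ (permutations n) (λ π →
        [ does (mono? π) ]? * weight π * sign + [ does (isSimple? π) ]? * weight π * - 1#)
        ≈⟨ trans (∑-+ (permutations n) _ _) (+-cong (∑-*ʳ (permutations n) _ sign) (∑-*ʳ (permutations n) _ (- 1#))) ⟩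
      ∑ (permutations n) (λ π → [ does (mono? π) ]? * weight π) * sign
        + ∑ (permutations n) (λ π → [ does (isSimple? π) ]? * weight π) * - 1#
        ≈⟨ +-cong (*-congʳ (∑-filter mono? (permutations n) weight))
                  (*-congʳ (∑-filter isSimple? (permutations n) weight)) ⟨
      ∑ (filter mono? (permutations n)) weight * sign + simp n * - 1#
        ≈⟨ +-cong (*-congʳ mono-sum) (trans (*-comm _ _) (-1*x≈-x _)) ⟩
      (1# + s ^ k * t ^ k) * sign + - simp n ∎

    simp-formula : ∀ {G} → compose G F ≋ X → simp n ≈ - G n + sign + (- (s * t)) ^ k
    simp-formula {G} G∘F≋X = begin
      simp n                          ≈⟨ +-identityˡ _ ⟨
      0# + simp n                     ≈⟨ +-congʳ (-‿inverseˡ (G n)) ⟨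
      - G n + G n + simp n            ≈⟨ +-assoc _ _ _ ⟩
      - G n + (G n + simp n)          ≈⟨ +-congˡ (+-congʳ (trans (F⁻¹≋A G∘F≋X n) A-simp)) ⟩
      - G n + ((1# + s ^ k * t ^ k) * sign + - simp n + simp n)
        ≈⟨ +-congˡ (trans (+-assoc _ _ _) (trans (+-congˡ (-‿inverseˡ _)) (+-identityʳ _))) ⟩
      - G n + (1# + s ^ k * t ^ k) * sign
        ≈⟨ +-congˡ (trans (distribʳ _ _ _) (+-cong (*-identityˡ _) (begin
             s ^ k * t ^ k * sign     ≈⟨ *-comm _ _ ⟩
             sign * (s ^ k * t ^ k)   ≈⟨ *-congˡ (^-distrib-* s t k) ⟨
             sign * (s * t) ^ k       ≈⟨ ^-distrib-* (- 1#) (s * t) k ⟨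
             (- 1# * (s * t)) ^ k     ≈⟨ ^-congˡ k (-1*x≈-x (s * t)) ⟩
             (- (s * t)) ^ k          ∎))) ⟩
      - G n + (sign + (- (s * t)) ^ k) ≈⟨ +-assoc _ _ _ ⟨
      - G n + sign + (- (s * t)) ^ k  ∎

-- Transport of the formula to ℚ(s,t)

module Formula {c ℓ} (R : CommutativeRing c ℓ) where

  open CommutativeRing R using (Carrier; semiring; trans; reflexive; 1#)
    renaming (_≈_ to _≋_; _+_ to _⊕_; _*_ to _⊗_; -_ to ⊖_)
  open Exponentiation semiring using () renaming (_^_ to _↑_)
  private
    module P = PowerSeries R

  -- With e and st in place of 1# and s ⊗ t, the type of the instance at ℚ(s,t) is syntactically that
  -- of the theorem, so that comparing them does not unfold the arithmetic of ℚ(s,t).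
  formula : ∀ {s t e st : Carrier} {F simp : ℕ → Carrier} → 1# ≡ e → s ⊗ t ≡ st →
    (∀ n → Weighted.F R s t n ≡ F n) → (∀ n → Weighted.simp R s t n ≡ simp n) →
    ∀ {G} → P.compose G F P.≋ P.X → ∀ n → 4 ≤ n →
    simp n ≋ (((⊖ G n) ⊕ ((⊖ e) ↑ (n ∸ 1))) ⊕ ((⊖ st) ↑ (n ∸ 1)))
  formula {s} {t} refl refl F≡ simp≡ {G} G∘F≋X (suc k) (s≤s 3≤k) =
    ≡.subst (_≋ _) (simp≡ (suc k)) (Weighted.simp-formula R s t k (ℕ.<⇒≤ 3≤k) {G} λ n →
      trans (Composition.compose-congʳ R G (λ m → reflexive (F≡ m)) n) (G∘F≋X n))

open import Defs

private
  1#≡ : CommutativeRing.1# ℚ⟨s,t⟩ ≡ 1#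
  1#≡ = refl

  st≡ : CommutativeRing._*_ ℚ⟨s,t⟩ s t ≡ s * t
  st≡ = refl

  F≡ : ∀ n → Weighted.F ℚ⟨s,t⟩ s t n ≡ F n
  F≡ zero    = refl
  F≡ (suc n) = refl

  simp≡ : ∀ n → Weighted.simp ℚ⟨s,t⟩ s t n ≡ simp n
  simp≡ n = refl

corollary5p4 : (F⟨-1⟩ : Series) → IsCompositionalInverse F F⟨-1⟩ →
    (n : ℕ) → 4 ≤ n →
    simp n ≈ - F⟨-1⟩ n + (- 1#) ^ (n ∸ 1) + (- (s * t)) ^ (n ∸ 1)
corollary5p4 F⟨-1⟩ inverse =
  Formula.formula ℚ⟨s,t⟩ 1#≡ st≡ F≡ simp≡
    {F⟨-1⟩} (IsCompositionalInverse.g∘f≋X inverse)
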